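{- Let $G_1$ be a connected graph on $n_1$ vertices and $m_1$ edges and let $G_2$ be a graph on $n_2$ vertices and $m_2$ edges, with vertex degrees $d_1,\dots,d_{n_2}$ and Laplacian eigenvalues $\mu_1(G_2),\dots,\mu_{n_2}(G_2)$. Let $Q=L_{G_2}+2I_{n_2}$, $D_{G_2}=\mathrm{diag}(d_1,\dots,d_{n_2})$, $A_{G_2}$ the adjacency matrix of $G_2$, and $\pi=(d_1,\dots,d_{n_2})^T$. Then \begin{align*} Kf(G_1\diamondsuit G_2)&=n_1(1+n_2+m_2)\Big[\frac{n_1m_2}{2}+\frac{n_1}{2}\big(\mathrm{tr}(Q^{ -1}A_{G_2})+\mathrm{tr}(Q^{ -1}D_{G_2})\big)+2n_1\sum_{i=1}^{n_2}\frac{1}{\mu_i(G_2)+2}\\ &\qquad+\frac{m_2+n_2+1}{n_1}Kf(G_1)\Big]-\frac{n_1}{2}\,\pi^TQ^{ -1}\pi-\frac{5n_1m_2+2n_1n_2}{2}. \end{align*}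
   Context: All graphs are simple and undirected; $L_G=D_G-A_G$ is the Laplacian matrix. The resistance distance between two vertices of a connected graph is the effective resistance between them when every edge is a unit resistor, and the Kirchhoff index $Kf(G)$ of a connected graph is the sum of resistance distances over all unordered pairs of distinct vertices. The corona-vertex of the subdivision graph $G_1\diamondsuit G_2$ is obtained from $G_1$ and $|V(G_1)|$ vertex-disjoint copies of the subdivision graph $S(G_2)$ (the graph obtained from $G_2$ by inserting a new vertex into every edge) by joining the $i$-th vertex of $G_1$ to every original vertex (i.e. vertex coming from $V(G_2)$, not a subdivision vertex) of the $i$-th copy. It has $n_1(1+n_2+m_2)$ vertices. -}

module Defs where

open import Algebra.Apartness.Bundles using (HeytingField; HeytingCommutativeRing)
open import Algebra.Bundles using (CommutativeRing; Semiring)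
import Algebra.Definitions.RawMonoid as RawMonoidDefs
import Algebra.Definitions.RawSemiring as RawSemiringDefs
open import Data.Bool.Base using (Bool; true; false; _∧_; _∨_; if_then_else_)
open import Data.Bool.Properties using (∧-zeroʳ)
open import Data.Fin.Base using (Fin; zero; suc; toℕ; punchIn)
open import Data.Fin.Properties using (_≟_; _<?_; +↔⊎; *↔×)
open import Data.List.Base using (List; length; lookup; filterᵇ; allFin; cartesianProduct)
open import Data.Nat.Base as ℕ using (ℕ; zero; suc; NonZero)
open import Data.Product.Base using (Σ-syntax; _×_; _,_; proj₁; proj₂)
open import Data.Product.Function.NonDependent.Propositional using (_×-↔_)
open import Data.Sum.Base using (_⊎_; inj₁; inj₂)
open import Data.Sum.Function.Propositional using (_⊎-↔_)
open import Function.Bundles using (_↔_; Inverse)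
open import Function.Construct.Composition using (_↔-∘_)
open import Function.Construct.Identity using (↔-id)
open import Level using (Level; _⊔_)
open import Relation.Binary.Construct.Closure.ReflexiveTransitive using (Star)
open import Relation.Binary.PropositionalEquality
  using (_≡_; _≢_; refl; sym; cong; cong₂; ≢-sym)
open import Relation.Nullary.Decidable using (does; yes; no; dec-true; dec-false)

private
  variable
    c ℓ₁ ℓ₂ : Level
    n n₁ n₂ : ℕ

record Graph (V : Set) : Set where
  field
    adj        : V → V → Bool
    adj-sym    : ∀ u v → adj u v ≡ adj v u
    adj-irrefl : ∀ v → adj v v ≡ false

open Graph public

-- Nonemptiness is not part of this notion; it has to be required separately.
Connected : {V : Set} → Graph V → Set
Connected G = ∀ u v → Star (λ x y → adj G x y ≡ true) u v

degree : Graph (Fin n) → Fin n → ℕ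
degree {n} G v = length (filterᵇ (adj G v) (allFin n))

-- Each edge {u , v} is listed once, as the pair with u < v.
edges : Graph (Fin n) → List (Fin n × Fin n)
edges {n} G =
  filterᵇ (λ (u , v) → does (u <? v) ∧ adj G u v)
          (cartesianProduct (allFin n) (allFin n))

numEdges : Graph (Fin n) → ℕ
numEdges G = length (edges G)

endpoint : (G : Graph (Fin n)) → Fin n → Fin (numEdges G) → Bool
endpoint G v e = does (v ≟ proj₁ uw) ∨ does (v ≟ proj₂ uw)
  where uw = lookup (edges G) e

-- inj₁ : original vertices; inj₂ : vertices inserted into the edges.
SubdivisionVertex : Graph (Fin n) → Set
SubdivisionVertex {n} G = Fin n ⊎ Fin (numEdges G)

isOriginal : (G : Graph (Fin n)) → SubdivisionVertex G → Bool
isOriginal _ (inj₁ _) = true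
isOriginal _ (inj₂ _) = false

subdivision : (G : Graph (Fin n)) → Graph (SubdivisionVertex G)
subdivision G = record { adj = a ; adj-sym = s ; adj-irrefl = i }
  where
  a : SubdivisionVertex G → SubdivisionVertex G → Bool
  a (inj₁ v) (inj₂ e) = endpoint G v e
  a (inj₂ e) (inj₁ v) = endpoint G v e
  a (inj₁ _) (inj₁ _) = false
  a (inj₂ _) (inj₂ _) = false

  s : ∀ x y → a x y ≡ a y x
  s (inj₁ _) (inj₁ _) = refl
  s (inj₁ _) (inj₂ _) = refl
  s (inj₂ _) (inj₁ _) = refl
  s (inj₂ _) (inj₂ _) = refl

  i : ∀ x → a x x ≡ false
  i (inj₁ _) = refl
  i (inj₂ _) = refl

private
  does-≟-sym : (i j : Fin n) → does (i ≟ j) ≡ does (j ≟ i)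
  does-≟-sym i j with i ≟ j
  ... | yes i≡j = sym (dec-true  (j ≟ i) (sym i≡j))
  ... | no  i≢j = sym (dec-false (j ≟ i) (≢-sym i≢j))

-- inj₁ i : the i-th vertex of G₁; inj₂ (i , x) : vertex x of the i-th copy of S(G₂).
CoronaVertex : Graph (Fin n₁) → Graph (Fin n₂) → Set
CoronaVertex {n₁} G₁ G₂ = Fin n₁ ⊎ (Fin n₁ × SubdivisionVertex G₂)

corona : (G₁ : Graph (Fin n₁)) (G₂ : Graph (Fin n₂)) → Graph (CoronaVertex G₁ G₂)
corona G₁ G₂ = record { adj = a ; adj-sym = s ; adj-irrefl = irr }
  where
  V = CoronaVertex G₁ G₂
  S = subdivision G₂

  a : V → V → Bool
  a (inj₁ i)       (inj₁ j)       = adj G₁ i j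
  a (inj₁ i)       (inj₂ (j , y)) = does (i ≟ j) ∧ isOriginal G₂ y
  a (inj₂ (i , x)) (inj₁ j)       = does (i ≟ j) ∧ isOriginal G₂ x
  a (inj₂ (i , x)) (inj₂ (j , y)) = does (i ≟ j) ∧ adj S x y

  s : ∀ x y → a x y ≡ a y x
  s (inj₁ i)       (inj₁ j)       = adj-sym G₁ i j
  s (inj₁ i)       (inj₂ (j , y)) = cong (_∧ isOriginal G₂ y) (does-≟-sym i j)
  s (inj₂ (i , x)) (inj₁ j)       = cong (_∧ isOriginal G₂ x) (does-≟-sym i j)
  s (inj₂ (i , x)) (inj₂ (j , y)) = cong₂ _∧_ (does-≟-sym i j) (adj-sym S x y)

  irr : ∀ x → a x x ≡ false
  irr (inj₁ i)       = adj-irrefl G₁ i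
  irr (inj₂ (i , x)) rewrite adj-irrefl S x = ∧-zeroʳ (does (i ≟ i))

relabel : {V W : Set} → W ↔ V → Graph V → Graph W
relabel f G = record
  { adj        = λ u v → adj G (to u) (to v)
  ; adj-sym    = λ u v → adj-sym G (to u) (to v)
  ; adj-irrefl = λ v → adj-irrefl G (to v)
  }
  where open Inverse f using (to)

coronaVertices : (G₁ : Graph (Fin n₁)) (G₂ : Graph (Fin n₂)) →
                 Fin (n₁ ℕ.+ n₁ ℕ.* (n₂ ℕ.+ numEdges G₂)) ↔ CoronaVertex G₁ G₂
coronaVertices {n₁} _ _ =
  (↔-id (Fin n₁) ⊎-↔ ((↔-id (Fin n₁) ×-↔ +↔⊎) ↔-∘ *↔×)) ↔-∘ +↔⊎

infix 5 _◇_
_◇_ : (G₁ : Graph (Fin n₁)) (G₂ : Graph (Fin n₂)) →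
      Graph (Fin (n₁ ℕ.+ n₁ ℕ.* (n₂ ℕ.+ numEdges G₂)))
G₁ ◇ G₂ = relabel (coronaVertices G₁ G₂) (corona G₁ G₂)

CharacteristicZero : HeytingField c ℓ₁ ℓ₂ → Set ℓ₂
CharacteristicZero K = ∀ n .{{_ : NonZero n}} → (n · 1#) # 0#
  where
  open HeytingField K
  open HeytingCommutativeRing heytingCommutativeRing using (commutativeRing)
  open CommutativeRing commutativeRing using (+-rawMonoid)
  open RawMonoidDefs +-rawMonoid using () renaming (_×_ to _·_)

-- The scalars are an arbitrary (Heyting) field of characteristic zero; the real
-- numbers are the intended instance.
module OverField (K : HeytingField c ℓ₁ ℓ₂) (char0 : CharacteristicZero K) where

  open HeytingField K hiding (refl; sym; zero)
  open HeytingCommutativeRing heytingCommutativeRing using (commutativeRing)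
  open CommutativeRing commutativeRing using (semiring)
  open RawSemiringDefs (Semiring.rawSemiring semiring) using (_^_) renaming (_×_ to _·_)
  open RawSemiringDefs (Semiring.rawSemiring semiring) public using (sum; product)

  ⟦_⟧ : ℕ → Carrier
  ⟦ n ⟧ = n · 1#

  -- #⇒invertible supplies an inverse of x - 0#.
  1/_ : ∀ {x} → x # 0# → Carrier
  1/ x#0 = proj₁ (#⇒invertible x#0)

  infixl 7 _÷_
  _÷_ : Carrier → (n : ℕ) → .{{_ : NonZero n}} → Carrier
  x ÷ n = x * 1/ (char0 n)

  Vect : ℕ → Set c
  Vect n = Fin n → Carrier

  Matrix : ℕ → Set c
  Matrix n = Fin n → Fin n → Carrier

  δ : Matrix n
  δ i j = if does (i ≟ j) then 1# else 0#

  infixl 7 _⊗_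
  _⊗_ : Matrix n → Matrix n → Matrix n
  (M ⊗ N) i j = sum λ k → M i k * N k j

  IsInverse : Matrix n → Matrix n → Set ℓ₁
  IsInverse M N = (∀ i j → (M ⊗ N) i j ≈ δ i j) × (∀ i j → (N ⊗ M) i j ≈ δ i j)

  tr : Matrix n → Carrier
  tr M = sum λ i → M i i

  -- xᵀ M y
  bilinear : Vect n → Matrix n → Vect n → Carrier
  bilinear x M y = sum λ i → sum λ j → x i * M i j * y j

  -- Laplace expansion along the first row.
  det : Matrix n → Carrier
  det {zero}  M = 1#
  det {suc n} M =
    sum λ j → (- 1#) ^ toℕ j * M zero j * det λ i k → M (suc i) (punchIn j k)

  module _ (G : Graph (Fin n)) where

    A D L Q : Matrix n
    A i j = if adj G i j then 1# else 0#
    D i j = if does (i ≟ j) then ⟦ degree G i ⟧ else 0#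
    L i j = D i j - A i j
    Q i j = L i j + ⟦ 2 ⟧ * δ i j

    π : Vect n
    π i = ⟦ degree G i ⟧

    -- The eigenvalues with multiplicity: det (x I - L) = ∏ᵢ (x - μᵢ). As K is
    -- infinite, equality at every x is equality of polynomials.
    IsLaplacianSpectrum : Vect n → Set (c ⊔ ℓ₁)
    IsLaplacianSpectrum μ =
      ∀ x → det (λ i j → x * δ i j - L i j) ≈ product λ i → x - μ i

    -- The potential φ drives a unit current from i to j through unit resistors:
    -- by Ohm's law the current along an edge xy is φ x - φ y, and by Kirchhoff's
    -- current law the net current out of x is 1 at i, -1 at j, and 0 elsewhere
    -- (0 everywhere if i = j).
    IsPotential : Fin n → Fin n → Vect n → Set ℓ₁
    IsPotential i j φ =
      ∀ x → (sum λ y → A x y * (φ x - φ y)) ≈ δ x i - δ x j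

    IsEffectiveResistance : Fin n → Fin n → Carrier → Set (c ⊔ ℓ₁)
    IsEffectiveResistance i j r =
      Σ[ φ ∈ Vect n ] IsPotential i j φ × r ≈ φ i - φ j

    IsKirchhoffIndex : Carrier → Set (c ⊔ ℓ₁)
    IsKirchhoffIndex k =
      Σ[ r ∈ Matrix n ]
        (∀ i j → IsEffectiveResistance i j (r i j)) ×
        k ≈ (sum λ i → sum λ j → if does (i <? j) then r i j else 0#)

{-# OPTIONS --safe #-}

-- Let X = (X u w) be a matrix whose columns are potentials of a graph on N vertices
-- driven by a unit current entering at w and leaving through one fixed distribution
-- of sinks. Then the resistances are X u u + X w w - X u w - X w u, and the Kirchhoff
-- index is N tr X - (sum of the entries of X). For the corona such an X is
--   X u w = X₁ (root u) (root w) + [u and w lie in the same copy] T u w,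
-- where X₁ belongs to G₁ and T = [[2 Q⁻¹, Q⁻¹ B], [Bᵀ Q⁻¹, ½ (I + Bᵀ Q⁻¹ B)]] is the
-- inverse of the Laplacian of S(G₂) grounded at the root. The formula follows from
-- B Bᵀ = D + A and Q 1 = 2·1 (B is the incidence matrix), and from
-- tr Q⁻¹ = Σ 1/(μᵢ + 2), the logarithmic derivative of det (t I - Q) = ∏ (t - μᵢ - 2)
-- at t = 0. Positive rationals inside the field replace an ordering in the
-- elimination argument that inverts Q and the grounded Laplacians.
module Submission where

open import Algebra.Apartness.Bundles using (HeytingField; HeytingCommutativeRing)
import Algebra.Apartness.Properties.HeytingCommutativeRing as HeytingProperties
open import Algebra.Bundles using (CommutativeRing; Semiring)
import Algebra.Definitions.RawSemiring as RawSemiringDefs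
import Algebra.Properties.CommutativeSemiring.Exp as Exp
import Algebra.Properties.Ring as RingProperties
import Algebra.Properties.Semiring.Mult as Mult
import Algebra.Properties.Semiring.Mult.TCOptimised as SemiringMult
import Algebra.Properties.Semiring.Sum as SumProperties
import Algebra.Solver.Ring as RingSolver
open import Algebra.Solver.Ring.AlmostCommutativeRing
  using (AlmostCommutativeRing; fromCommutativeRing; _-Raw-AlmostCommutative⟶_)
open import Data.Bool.Base as Bool using (Bool; true; false; _∧_; _∨_; if_then_else_)
open import Data.Bool.Properties using (T?; T-∧)
open import Data.Fin.Base using (Fin; zero; suc; toℕ; punchIn; punchOut; inject₁; splitAt; remQuot; quotRem)
open import Data.Fin.Properties
  using (_≟_; _<?_; <-cmp; toℕ-inject₁; toℕ-injective; suc-injective; punchIn-punchOut; punchIn-injective; punchInᵢ≢i)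
open import Data.Integer.Base as ℤ using (ℤ; +_; -[1+_])
import Data.Integer.Properties as ℤₚ
open import Data.List.Base
  using (List; []; _∷_; _++_; map; foldr; length; lookup; filterᵇ; tabulate; allFin; cartesianProduct)
open import Data.List.Membership.Propositional.Properties using (∈-lookup)
open import Data.List.Relation.Unary.All as All using ()
open import Data.List.Relation.Unary.All.Properties using (all-filter)
open import Data.Maybe.Base using (Maybe; just; nothing)
open import Data.Nat.Base as ℕ using (ℕ; zero; suc; NonZero)
import Data.Nat.Properties as ℕₚ
open import Data.Product.Base as Product using (∃; Σ-syntax; ∃-syntax; _×_; _,_; proj₁; proj₂)
open import Data.Sum.Base as Sum using (_⊎_; inj₁; inj₂; [_,_]′)
open import Function.Base using (_∘_)
open import Function.Bundles using (Equivalence; Inverse)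
open import Level using (Level; _⊔_; Lift; lift)
open import Relation.Binary.Construct.Closure.ReflexiveTransitive using (Star; ε; _◅_; _◅◅_; gmap; reverse)
open import Relation.Binary.Definitions using (tri<; tri≈; tri>)
open import Relation.Binary.PropositionalEquality as ≡ using (_≡_; _≢_)
import Data.Sign.Base as Sign
import Relation.Binary.Reasoning.Setoid as SetoidReasoning
open import Relation.Nullary.Decidable using (Dec; does; yes; no; dec-true; dec-false)
open import Relation.Nullary.Negation using (contradiction)
open import Defs

-- The field has neither an order nor decidable equality, so every pivot and determinant that is
-- divided by needs an explicit reason to be invertible. The matrices to be inverted have rational
-- entries and are taken with the sign of A - D, so that off-diagonal entries are nonnegative:
-- eliminating a vertex only adds products of nonnegative rationals, and a path to the ground keeps
-- each pivot positive. No sign of μᵢ is available either; μᵢ + 2 is apart from 0 as a factor of an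
-- invertible determinant. The spectrum is known only through values of det (x I - L), so extracting
-- a trace requires that a polynomial function determine its coefficients. Gluing works because a
-- root separates its copy from the rest: current injected into a copy leaves through the root,
-- where it acts as if injected into G₁. The part X₁ of X is therefore constant on blocks of 1 + n₂
-- + m₂ vertices, and T stays within one copy. The T part of the trace gives most of the bracket in
-- the formula, the T part of the sum of entries gives the subtracted terms, and the two X₁ parts
-- combine to Kf(G₁).

-- Ring solver with integer coefficients.

module IntegerCoefficientSolver {c ℓ : Level} (R : CommutativeRing c ℓ) where

  open CommutativeRing R
  open SemiringMult semiring using (1+×; ×-homo-+; ×1-homo-*) renaming (_×_ to _·_)
  open RingProperties ring
  open SetoidReasoning setoid

  -- Coefficients come from ℤ because the solver must recognise cancelled terms as zero, which
  -- equality in the field cannot decide. With these multiples `con (+ 2)` unfolds to `1# + 1#`,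
  -- whereas `⟦ 2 ⟧` unfolds to `1# + (1# + 0#)`; this is why the latter shape is spelled out in
  -- some solver calls.
  fromℤ : ℤ → Carrier
  fromℤ (+ n)    = n · 1#
  fromℤ -[1+ n ] = - (suc n · 1#)

  fromℤ-⊖ : ∀ m n → fromℤ (m ℤ.⊖ n) ≈ m · 1# - n · 1#
  fromℤ-⊖ m       zero    = sym (trans (+-congˡ -0#≈0#) (+-identityʳ _))
  fromℤ-⊖ zero    (suc n) = sym (+-identityˡ _)
  fromℤ-⊖ (suc m) (suc n) = begin
    fromℤ (suc m ℤ.⊖ suc n)                ≡⟨ ≡.cong fromℤ (ℤₚ.[1+m]⊖[1+n]≡m⊖n m n) ⟩
    fromℤ (m ℤ.⊖ n)                        ≈⟨ fromℤ-⊖ m n ⟩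
    m · 1# - n · 1#                        ≈⟨ +-congʳ (+-identityʳ _) ⟨
    m · 1# + 0# - n · 1#                   ≈⟨ +-congʳ (+-congˡ (-‿inverseʳ 1#)) ⟨
    m · 1# + (1# - 1#) - n · 1#            ≈⟨ +-congʳ (trans (sym (+-assoc _ _ _)) (+-congʳ (+-comm _ _))) ⟩
    1# + m · 1# - 1# - n · 1#              ≈⟨ +-assoc _ _ _ ⟩
    1# + m · 1# + (- 1# - n · 1#)          ≈⟨ +-congˡ (-‿+-comm _ _) ⟩
    1# + m · 1# - (1# + n · 1#)            ≈⟨ +-cong (1+× m 1#) (-‿cong (1+× n 1#)) ⟨
    suc m · 1# - suc n · 1#                ∎

  fromℤ-◃ : ∀ n → fromℤ (Sign.- ℤ.◃ n) ≈ - (n · 1#)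
  fromℤ-◃ zero    = sym -0#≈0#
  fromℤ-◃ (suc n) = refl

  fromℤ-+ : ∀ i j → fromℤ (i ℤ.+ j) ≈ fromℤ i + fromℤ j
  fromℤ-+ (+ m)    (+ n)    = ×-homo-+ 1# m n
  fromℤ-+ (+ m)    -[1+ n ] = fromℤ-⊖ m (suc n)
  fromℤ-+ -[1+ m ] (+ n)    = trans (fromℤ-⊖ n (suc m)) (+-comm _ _)
  fromℤ-+ -[1+ m ] -[1+ n ] = begin
    - (suc (suc (m ℕ.+ n)) · 1#)          ≡⟨ ≡.cong (λ k → - (suc k · 1#)) (≡.sym (ℕₚ.+-suc m n)) ⟩
    - ((suc m ℕ.+ suc n) · 1#)            ≈⟨ -‿cong (×-homo-+ 1# (suc m) (suc n)) ⟩
    - (suc m · 1# + suc n · 1#)           ≈⟨ -‿+-comm _ _ ⟨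
    - (suc m · 1#) - suc n · 1#           ∎

  fromℤ-* : ∀ i j → fromℤ (i ℤ.* j) ≈ fromℤ i * fromℤ j
  fromℤ-* (+ m)    (+ n)    = trans (reflexive (≡.cong fromℤ (ℤₚ.+◃n≡+n (m ℕ.* n)))) (×1-homo-* m n)
  fromℤ-* (+ m)    -[1+ n ] = begin
    fromℤ (Sign.- ℤ.◃ (m ℕ.* suc n))    ≈⟨ fromℤ-◃ (m ℕ.* suc n) ⟩
    - ((m ℕ.* suc n) · 1#)              ≈⟨ -‿cong (×1-homo-* m (suc n)) ⟩
    - (m · 1# * (suc n · 1#))           ≈⟨ -‿distribʳ-* _ _ ⟩
    m · 1# * - (suc n · 1#)             ∎
  fromℤ-* -[1+ m ] (+ n)    = begin
    fromℤ (Sign.- ℤ.◃ (suc m ℕ.* n))    ≈⟨ fromℤ-◃ (suc m ℕ.* n) ⟩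
    - ((suc m ℕ.* n) · 1#)              ≈⟨ -‿cong (×1-homo-* (suc m) n) ⟩
    - (suc m · 1# * (n · 1#))           ≈⟨ -‿distribˡ-* _ _ ⟩
    - (suc m · 1#) * (n · 1#)           ∎
  fromℤ-* -[1+ m ] -[1+ n ] = begin
    (suc m ℕ.* suc n) · 1#              ≈⟨ ×1-homo-* (suc m) (suc n) ⟩
    suc m · 1# * (suc n · 1#)           ≈⟨ -‿involutive _ ⟨
    - - (suc m · 1# * (suc n · 1#))     ≈⟨ -‿cong (-‿distribˡ-* _ _) ⟩
    - (- (suc m · 1#) * (suc n · 1#))   ≈⟨ -‿distribʳ-* _ _ ⟩
    - (suc m · 1#) * - (suc n · 1#)     ∎

  fromℤ-neg : ∀ i → fromℤ (ℤ.- i) ≈ - fromℤ i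
  fromℤ-neg (+ zero)  = sym -0#≈0#
  fromℤ-neg (+ suc n) = refl
  fromℤ-neg -[1+ n ]  = sym (-‿involutive _)

  private
    ring′ : AlmostCommutativeRing c ℓ
    ring′ = fromCommutativeRing R

    morphism : ℤ.+-*-rawRing -Raw-AlmostCommutative⟶ ring′
    morphism = record
      { ⟦_⟧    = fromℤ
      ; +-homo = fromℤ-+
      ; *-homo = fromℤ-*
      ; -‿homo = fromℤ-neg
      ; 0-homo = refl
      ; 1-homo = refl
      }

    _≟ℤ_ : ∀ i j → Maybe (fromℤ i ≈ fromℤ j)
    i ≟ℤ j with i ℤₚ.≟ j
    ... | yes i≡j = just (reflexive (≡.cong fromℤ i≡j))
    ... | no  _   = nothing

  open RingSolver ℤ.+-*-rawRing ring′ morphism _≟ℤ_ public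

-- Finite sums and Kronecker deltas over the field.

module Scalars {c ℓ₁ ℓ₂ : Level} (K : HeytingField c ℓ₁ ℓ₂) (char0 : CharacteristicZero K) where

  open HeytingField K public hiding (zero)
  open HeytingCommutativeRing heytingCommutativeRing public using (commutativeRing)
  open CommutativeRing commutativeRing public using (semiring; ring)
  open RawSemiringDefs (Semiring.rawSemiring semiring) public using (_^_)
  open OverField K char0 public
  open RingProperties ring public using (x[y-z]≈xy-xz; -1*x≈-x)
  open HeytingProperties heytingCommutativeRing public using (x-0≈x)
  open Mult semiring public using (×-homo-+; ×1-homo-*)
  open SumProperties semiring public
    using (sum-cong-≋; sum-remove; ∑-distrib-+; ∑-comm; *-distribˡ-sum; *-distribʳ-sum; sum-replicate-zero)
  open IntegerCoefficientSolver commutativeRing public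
    using (solve; _:+_; _:*_; _:-_; :-_; _:=_; con)
  open SetoidReasoning setoid public

  x*0≈0 : ∀ x → x * 0# ≈ 0#
  x*0≈0 x = trans (*-comm x 0#) (solve 1 (λ x → con (+ 0) :* x := con (+ 0)) refl x)

  sum-cong : ∀ {n} {f g : Vect n} → (∀ i → f i ≈ g i) → sum f ≈ sum g
  sum-cong = sum-cong-≋

  sum-zero : ∀ {n} {f : Vect n} → (∀ i → f i ≈ 0#) → sum f ≈ 0#
  sum-zero {n} f≈0 = trans (sum-cong f≈0) (sum-replicate-zero n)

  sum-single : ∀ {n} {f : Vect n} i → (∀ k → k ≢ i → f k ≈ 0#) → sum f ≈ f i
  sum-single {suc n} {f} i f≈0 = begin
    sum f                           ≈⟨ sum-remove f ⟩
    f i + sum (f ∘ punchIn i)       ≈⟨ +-congˡ (sum-zero λ k → f≈0 _ (punchInᵢ≢i i k)) ⟩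
    f i + 0#                        ≈⟨ +-identityʳ _ ⟩
    f i                             ∎

  sum-pair : ∀ {n} {f : Vect n} {i j} → i ≢ j → (∀ k → k ≢ i → k ≢ j → f k ≈ 0#) → sum f ≈ f i + f j
  sum-pair {suc n} {f} {i} {j} i≢j f≈0 = begin
    sum f                                    ≈⟨ sum-remove f ⟩
    f i + sum (f ∘ punchIn i)                ≈⟨ +-congˡ (sum-single (punchOut i≢j) λ k k≢ → f≈0 _ (punchInᵢ≢i i k)
                                                  λ eq → k≢ (punchIn-injective i _ _ (≡.trans eq (≡.sym (punchIn-punchOut i≢j))))) ⟩
    f i + f (punchIn i (punchOut i≢j))       ≡⟨ ≡.cong (λ k → f i + f k) (punchIn-punchOut i≢j) ⟩
    f i + f j                                ∎

  sum-linear : ∀ {n} a b (f g : Vect n) → sum (λ i → a * f i + b * g i) ≈ a * sum f + b * sum g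
  sum-linear a b f g = trans (∑-distrib-+ (λ i → a * f i) (λ i → b * g i))
                             (+-cong (sym (*-distribˡ-sum a f)) (sym (*-distribˡ-sum b g)))

  sum-neg : ∀ {n} (f : Vect n) → sum (λ i → - f i) ≈ - sum f
  sum-neg f = begin
    sum (λ i → - f i)      ≈⟨ sum-cong (λ i → sym (-1*x≈-x (f i))) ⟩
    sum (λ i → - 1# * f i) ≈⟨ *-distribˡ-sum (- 1#) f ⟨
    - 1# * sum f           ≈⟨ -1*x≈-x (sum f) ⟩
    - sum f                ∎

  sum-sub : ∀ {n} (f g : Vect n) → sum (λ i → f i - g i) ≈ sum f - sum g
  sum-sub f g = trans (∑-distrib-+ f (λ i → - g i)) (+-congˡ (sum-neg g))

  sum-const : ∀ n x → sum {n} (λ _ → x) ≈ ⟦ n ⟧ * x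
  sum-const zero    x = solve 1 (λ x → con (+ 0) := con (+ 0) :* x) refl x
  sum-const (suc n) x = trans (+-congˡ (sum-const n x))
    (solve 2 (λ x n → x :+ n :* x := (con (+ 1) :+ n) :* x) refl x ⟦ n ⟧)

  δ-refl : ∀ {n} (i : Fin n) → δ i i ≈ 1#
  δ-refl i rewrite dec-true (i ≟ i) ≡.refl = refl

  δ-≢ : ∀ {n} {i j : Fin n} → i ≢ j → δ i j ≈ 0#
  δ-≢ {i = i} {j} i≢j rewrite dec-false (i ≟ j) i≢j = refl

  δ-sym : ∀ {n} (i j : Fin n) → δ i j ≈ δ j i
  δ-sym i j with i ≟ j
  ... | yes ≡.refl = sym (δ-refl i)
  ... | no  i≢j    = sym (δ-≢ (i≢j ∘ ≡.sym))

  sum-δˡ : ∀ {n} i (f : Vect n) → sum (λ k → δ i k * f k) ≈ f i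
  sum-δˡ i f = trans (sum-single i λ k k≢i → trans (*-congʳ (δ-≢ (k≢i ∘ ≡.sym))) (zeroˡ _))
                     (trans (*-congʳ (δ-refl i)) (*-identityˡ _))

  sum-δʳ : ∀ {n} i (f : Vect n) → sum (λ k → f k * δ k i) ≈ f i
  sum-δʳ i f = trans (sum-cong λ k → trans (*-comm _ _) (*-congʳ (δ-sym k i))) (sum-δˡ i f)

-- Determinants: linearity in columns, equal columns, Cramer's rule.

module Determinant {c ℓ₁ ℓ₂ : Level} (K : HeytingField c ℓ₁ ℓ₂) (char0 : CharacteristicZero K) where

  open Scalars K char0

  private variable n m : ℕ

  minor : Matrix (suc n) → Fin (suc n) → Matrix n
  minor M l i k = M (suc i) (punchIn l k)

  det-cong : {M N : Matrix n} → (∀ i j → M i j ≈ N i j) → det M ≈ det N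
  det-cong {zero}  M≈N = refl
  det-cong {suc n} M≈N = sum-cong λ l →
    *-cong (*-congˡ {(- 1#) ^ toℕ l} (M≈N zero l)) (det-cong λ i k → M≈N (suc i) (punchIn l k))

  -- In the expansion, the term of column `j` is linear through its entry, and its minor no longer
  -- contains that column. Every other term is linear through its minor, by induction.
  det-linear : (M A B : Matrix n) (j : Fin n) (a b : Carrier) →
               (∀ i → M i j ≈ a * A i j + b * B i j) →
               (∀ i k → k ≢ j → M i k ≈ A i k) →
               (∀ i k → k ≢ j → M i k ≈ B i k) →
               det M ≈ a * det A + b * det B
  det-linear {suc n} M A B j a b Mⱼ M≈A M≈B = trans (sum-cong term) (sum-linear a b
    (λ l → (- 1#) ^ toℕ l * A zero l * det (minor A l)) (λ l → (- 1#) ^ toℕ l * B zero l * det (minor B l)))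
    where
    term : ∀ l → (- 1#) ^ toℕ l * M zero l * det (minor M l) ≈
                 a * ((- 1#) ^ toℕ l * A zero l * det (minor A l)) +
                 b * ((- 1#) ^ toℕ l * B zero l * det (minor B l))
    term l with l ≟ j
    ... | yes ≡.refl = begin
      s * M zero j * det (minor M j)                             ≈⟨ *-congʳ (*-congˡ (Mⱼ zero)) ⟩
      s * (a * A zero j + b * B zero j) * det (minor M j)
        ≈⟨ solve 6 (λ s a x b y d → s :* (a :* x :+ b :* y) :* d := a :* (s :* x :* d) :+ b :* (s :* y :* d))
             refl s a (A zero j) b (B zero j) (det (minor M j)) ⟩
      a * (s * A zero j * det (minor M j)) + b * (s * B zero j * det (minor M j))
        ≈⟨ +-cong (*-congˡ (*-congˡ (det-cong λ i k → M≈A (suc i) _ (punchInᵢ≢i j k))))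
                  (*-congˡ (*-congˡ (det-cong λ i k → M≈B (suc i) _ (punchInᵢ≢i j k)))) ⟩
      a * (s * A zero j * det (minor A j)) + b * (s * B zero j * det (minor B j)) ∎
      where s = (- 1#) ^ toℕ j
    ... | no l≢j = begin
      s * M zero l * det (minor M l)
        ≈⟨ *-congˡ (det-linear (minor M l) (minor A l) (minor B l) j′ a b
             column (λ i k k≢ → M≈A _ _ (other k k≢)) (λ i k k≢ → M≈B _ _ (other k k≢))) ⟩
      s * M zero l * (a * det (minor A l) + b * det (minor B l))
        ≈⟨ solve 6 (λ s x a d b e → s :* x :* (a :* d :+ b :* e) := a :* (s :* x :* d) :+ b :* (s :* x :* e))
             refl s (M zero l) a (det (minor A l)) b (det (minor B l)) ⟩
      a * (s * M zero l * det (minor A l)) + b * (s * M zero l * det (minor B l))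
        ≈⟨ +-cong (*-congˡ (*-congʳ (*-congˡ (M≈A zero l l≢j)))) (*-congˡ (*-congʳ (*-congˡ (M≈B zero l l≢j)))) ⟩
      a * (s * A zero l * det (minor A l)) + b * (s * B zero l * det (minor B l)) ∎
      where
      s  = (- 1#) ^ toℕ l
      j′ = punchOut l≢j
      column : ∀ i → minor M l i j′ ≈ a * minor A l i j′ + b * minor B l i j′
      column i rewrite punchIn-punchOut l≢j = Mⱼ (suc i)
      other : ∀ k → k ≢ j′ → punchIn l k ≢ j
      other k k≢ eq = k≢ (punchIn-injective l _ _ (≡.trans eq (≡.sym (punchIn-punchOut l≢j))))

  det-zero-column : (M : Matrix n) (j : Fin n) → (∀ i → M i j ≈ 0#) → det M ≈ 0#
  det-zero-column M j Mⱼ≈0 = trans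
    (det-linear M M M j 0# 0#
      (λ i → trans (Mⱼ≈0 i) (solve 1 (λ x → con (+ 0) := con (+ 0) :* x :+ con (+ 0) :* x) refl (M i j)))
      (λ _ _ _ → refl) (λ _ _ _ → refl))
    (solve 1 (λ x → con (+ 0) :* x :+ con (+ 0) :* x := con (+ 0)) refl (det M))

  -- Compares the two minors that drop one of two adjacent columns: they list the same columns
  -- except at one position, where each shows the column that the other drops.
  punchIn-adjacent : ∀ (i : Fin n) k → punchIn (inject₁ i) k ≡ punchIn (suc i) k ⊎
                     punchIn (inject₁ i) k ≡ suc i × punchIn (suc i) k ≡ inject₁ i
  punchIn-adjacent zero    zero    = inj₂ (≡.refl , ≡.refl)
  punchIn-adjacent zero    (suc k) = inj₁ ≡.refl
  punchIn-adjacent (suc i) zero    = inj₁ ≡.refl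
  punchIn-adjacent (suc i) (suc k) with punchIn-adjacent i k
  ... | inj₁ eq       = inj₁ (≡.cong suc eq)
  ... | inj₂ (p , q)  = inj₂ (≡.cong suc p , ≡.cong suc q)

  -- Two neighbouring columns remain neighbours when a third one is dropped, so the induction in
  -- `det-adjacent` applies to the minor.
  punchIn-keeps-adjacent : ∀ (l : Fin (suc (suc n))) (i : Fin (suc n)) → l ≢ inject₁ i → l ≢ suc i →
                           ∃[ i′ ] punchIn l (inject₁ i′) ≡ inject₁ i × punchIn l (suc i′) ≡ suc i
  punchIn-keeps-adjacent zero zero l≢ _ = contradiction ≡.refl l≢
  punchIn-keeps-adjacent zero (suc i) _ _ = i , ≡.refl , ≡.refl
  punchIn-keeps-adjacent (suc zero) zero _ l≢ = contradiction ≡.refl l≢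
  punchIn-keeps-adjacent {suc n} (suc (suc l)) zero _ _ = zero , ≡.refl , ≡.refl
  punchIn-keeps-adjacent {suc n} (suc l) (suc i) l≢ l≢′
    with i′ , p , q ← punchIn-keeps-adjacent l i (l≢ ∘ ≡.cong suc) (l≢′ ∘ ≡.cong suc)
    = suc i′ , ≡.cong suc p , ≡.cong suc q

  inject₁≢suc : ∀ (i : Fin n) → inject₁ i ≢ suc i
  inject₁≢suc (suc i) eq = inject₁≢suc i (suc-injective eq)

  -- The terms of the two equal columns have the same minor and opposite signs. Every other minor
  -- again has two equal adjacent columns.
  det-adjacent : (M : Matrix (suc n)) (i : Fin n) → (∀ r → M r (inject₁ i) ≈ M r (suc i)) → det M ≈ 0#
  det-adjacent {suc n} M i eq = begin
    det M             ≈⟨ sum-pair (inject₁≢suc i) rest ⟩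
    t (inject₁ i) + t (suc i)
      ≈⟨ +-congʳ (*-cong (*-cong (reflexive (≡.cong ((- 1#) ^_) (toℕ-inject₁ i))) (eq zero)) (det-cong minors)) ⟩
    s * M zero (suc i) * d + - 1# * s * M zero (suc i) * d
      ≈⟨ solve 3 (λ s x d → s :* x :* d :+ con -[1+ 0 ] :* s :* x :* d := con (+ 0)) refl s (M zero (suc i)) d ⟩
    0#                ∎
    where
    t : Vect (suc (suc n))
    t l = (- 1#) ^ toℕ l * M zero l * det (minor M l)
    s = (- 1#) ^ toℕ i
    d = det (minor M (suc i))
    minors : ∀ r k → minor M (inject₁ i) r k ≈ minor M (suc i) r k
    minors r k with punchIn-adjacent i k
    ... | inj₁ p       = reflexive (≡.cong (M (suc r)) p)
    ... | inj₂ (p , q) = begin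
      M (suc r) (punchIn (inject₁ i) k) ≡⟨ ≡.cong (M (suc r)) p ⟩
      M (suc r) (suc i)                 ≈⟨ eq (suc r) ⟨
      M (suc r) (inject₁ i)             ≡⟨ ≡.cong (M (suc r)) q ⟨
      M (suc r) (punchIn (suc i) k)     ∎
    rest : ∀ l → l ≢ inject₁ i → l ≢ suc i → t l ≈ 0#
    rest l l≢ l≢′ with i′ , p , q ← punchIn-keeps-adjacent l i l≢ l≢′ =
      trans (*-congˡ (det-adjacent (minor M l) i′ λ r →
        trans (reflexive (≡.cong (M (suc r)) p)) (trans (eq (suc r)) (reflexive (≡.cong (M (suc r)) (≡.sym q))))))
        (x*0≈0 _)

  infixl 8 _[_≔_]
  _[_≔_] : Matrix n → Fin n → Vect n → Matrix n
  (M [ c ≔ v ]) r k = if does (k ≟ c) then v r else M r k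

  ≔-hit : (M : Matrix n) (c : Fin n) (v : Vect n) (r : Fin n) → (M [ c ≔ v ]) r c ≈ v r
  ≔-hit M c v r rewrite dec-true (c ≟ c) ≡.refl = refl

  ≔-miss : (M : Matrix n) {c k : Fin n} (v : Vect n) (r : Fin n) → k ≢ c → (M [ c ≔ v ]) r k ≈ M r k
  ≔-miss M {c} {k} v r k≢c rewrite dec-false (k ≟ c) k≢c = refl

  det-≔-linear : (M : Matrix n) (c : Fin n) {v u w : Vect n} (a b : Carrier) →
                 (∀ r → v r ≈ a * u r + b * w r) →
                 det (M [ c ≔ v ]) ≈ a * det (M [ c ≔ u ]) + b * det (M [ c ≔ w ])
  det-≔-linear M c {v} {u} {w} a b v≈ = det-linear _ _ _ c a b
    (λ r → trans (≔-hit M c v r) (trans (v≈ r) (sym (+-cong (*-congˡ (≔-hit M c u r)) (*-congˡ (≔-hit M c w r))))))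
    (λ r k k≢ → trans (≔-miss M v r k≢) (sym (≔-miss M u r k≢)))
    (λ r k k≢ → trans (≔-miss M v r k≢) (sym (≔-miss M w r k≢)))

  ≔-self : (M : Matrix n) (c : Fin n) {v : Vect n} → (∀ r → v r ≈ M r c) → ∀ r k → (M [ c ≔ v ]) r k ≈ M r k
  ≔-self M c v≈ r k with k ≟ c
  ... | yes ≡.refl = v≈ r
  ... | no _       = refl

  ≔-comm : (M : Matrix n) {c d : Fin n} (u v : Vect n) → c ≢ d →
           ∀ r k → (M [ c ≔ u ] [ d ≔ v ]) r k ≈ (M [ d ≔ v ] [ c ≔ u ]) r k
  ≔-comm M {c} {d} u v c≢d r k with k ≟ c | k ≟ d
  ... | yes k≡c | yes k≡d = contradiction (≡.trans (≡.sym k≡c) k≡d) c≢d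
  ... | yes _   | no _    = refl
  ... | no _    | yes _   = refl
  ... | no _    | no _    = refl

  -- With columns a, b, a in positions j, k, k + 1, expand the determinant with
  -- columns a, a + b, a + b: it vanishes, and so do all summands but the given one.
  det-equal-columns-at-distance :
    ∀ d (M : Matrix (suc n)) (j : Fin (suc n)) (k : Fin n) → toℕ k ≡ d ℕ.+ toℕ j →
    (∀ r → M r j ≈ M r (suc k)) → det M ≈ 0#
  det-equal-columns-at-distance zero M j k k≡j eq
    with ≡.refl ← toℕ-injective {i = j} {inject₁ k} (≡.trans (≡.sym k≡j) (≡.sym (toℕ-inject₁ k)))
    = det-adjacent M k eq
  det-equal-columns-at-distance {suc n} (suc d) M j (suc k) k≡d+j eq = begin
    det M                        ≈⟨ det-cong (≔-self M i λ _ → refl) ⟨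
    det (M [ i ≔ b ])            ≈⟨ det-cong (≔-self (M [ i ≔ b ]) s λ r → trans (eq r) (sym (≔-miss M b r (i≢s ∘ ≡.sym)))) ⟨
    F b a                        ≈⟨ solve 1 (λ x → x := con (+ 1) :* x :+ con (+ 1) :* con (+ 0)) refl (F b a) ⟩
    1# * F b a + 1# * 0#         ≈⟨ +-congˡ (*-congˡ (F-diagonal b)) ⟨
    1# * F b a + 1# * F b b      ≈⟨ det-≔-linear (M [ i ≔ b ]) s 1# 1# a+b ⟨
    F b ab                       ≈⟨ solve 1 (λ x → x := con (+ 1) :* con (+ 0) :+ con (+ 1) :* x) refl (F b ab) ⟩
    1# * 0# + 1# * F b ab        ≈⟨ +-congʳ (*-congˡ Fa≈0) ⟨
    1# * F a ab + 1# * F b ab    ≈⟨ +-cong (*-congˡ (swap a)) (*-congˡ (swap b)) ⟩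
    1# * det (M [ s ≔ ab ] [ i ≔ a ]) + 1# * det (M [ s ≔ ab ] [ i ≔ b ])
                                 ≈⟨ det-≔-linear (M [ s ≔ ab ]) i 1# 1# a+b ⟨
    det (M [ s ≔ ab ] [ i ≔ ab ]) ≈⟨ swap ab ⟨
    F ab ab                      ≈⟨ F-diagonal ab ⟩
    0#                           ∎
    where
    i = inject₁ (suc k)
    s = suc (suc k)
    i≢s : i ≢ s
    i≢s = inject₁≢suc (suc k)
    a b ab : Vect (suc (suc n))
    a r  = M r j
    b r  = M r i
    ab r = a r + b r
    a+b : ∀ r → ab r ≈ 1# * a r + 1# * b r
    a+b r = solve 2 (λ x y → x :+ y := con (+ 1) :* x :+ con (+ 1) :* y) refl (a r) (b r)
    F : Vect (suc (suc n)) → Vect (suc (suc n)) → Carrier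
    F u v = det (M [ i ≔ u ] [ s ≔ v ])
    swap : ∀ u → F u ab ≈ det (M [ s ≔ ab ] [ i ≔ u ])
    swap u = det-cong (≔-comm M u ab i≢s)
    F-diagonal : ∀ v → F v v ≈ 0#
    F-diagonal v = det-adjacent (M [ i ≔ v ] [ s ≔ v ]) (suc k) λ r →
      trans (≔-miss (M [ i ≔ v ]) v r i≢s) (trans (≔-hit M i v r) (sym (≔-hit (M [ i ≔ v ]) s v r)))
    k≡d+j′ : toℕ (inject₁ k) ≡ d ℕ.+ toℕ j
    k≡d+j′ = ≡.trans (toℕ-inject₁ k) (ℕₚ.suc-injective k≡d+j)
    j≢i : j ≢ i
    j≢i ≡.refl = ℕₚ.m≢1+n+m (toℕ k) {d} (≡.trans (ℕₚ.suc-injective k≡d+j)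
      (≡.trans (≡.cong (d ℕ.+_) (≡.cong suc (toℕ-inject₁ k))) (ℕₚ.+-suc d (toℕ k))))
    j≢s : j ≢ s
    j≢s ≡.refl = ℕₚ.m≢1+n+m (toℕ k) {suc d} (≡.trans (ℕₚ.suc-injective k≡d+j)
      (≡.trans (ℕₚ.+-suc d (suc (toℕ k))) (≡.cong suc (ℕₚ.+-suc d (toℕ k)))))
    Fa≈0 : F a ab ≈ 0#
    Fa≈0 = det-equal-columns-at-distance d (M [ i ≔ a ] [ s ≔ ab ]) j (inject₁ k) k≡d+j′ λ r → begin
      (M [ i ≔ a ] [ s ≔ ab ]) r j   ≈⟨ ≔-miss (M [ i ≔ a ]) ab r j≢s ⟩
      (M [ i ≔ a ]) r j              ≈⟨ ≔-miss M a r j≢i ⟩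
      a r                            ≈⟨ ≔-hit M i a r ⟨
      (M [ i ≔ a ]) r i              ≈⟨ ≔-miss (M [ i ≔ a ]) ab r i≢s ⟨
      (M [ i ≔ a ] [ s ≔ ab ]) r i   ∎

  det-equal-columns-< : (M : Matrix n) (j k : Fin n) → toℕ j ℕ.< toℕ k → (∀ r → M r j ≈ M r k) → det M ≈ 0#
  det-equal-columns-< M j (suc k) (ℕ.s≤s j≤k) =
    det-equal-columns-at-distance (toℕ k ℕ.∸ toℕ j) M j k (≡.sym (ℕₚ.m∸n+n≡m j≤k))

  det-equal-columns : (M : Matrix n) {j k : Fin n} → j ≢ k → (∀ r → M r j ≈ M r k) → det M ≈ 0#
  det-equal-columns M {j} {k} j≢k eq with ℕₚ.<-cmp (toℕ j) (toℕ k)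
  ... | tri< j<k _ _ = det-equal-columns-< M j k j<k eq
  ... | tri≈ _ j≡k _ = contradiction (toℕ-injective j≡k) j≢k
  ... | tri> _ _ k<j = det-equal-columns-< M k j k<j (sym ∘ eq)

  det-≔-combination : (M : Matrix n) (c : Fin n) (x : Vect m) (V : Fin m → Vect n) →
    det (M [ c ≔ (λ r → sum λ k → x k * V k r) ]) ≈ sum λ k → x k * det (M [ c ≔ V k ])
  det-≔-combination {m = zero}  M c x V = det-zero-column _ c (≔-hit M c (λ _ → 0#))
  det-≔-combination {m = suc m} M c x V = begin
    det (M [ c ≔ (λ r → sum λ k → x k * V k r) ])
      ≈⟨ det-≔-linear M c (x zero) 1# (λ r → +-congˡ (sym (*-identityˡ _))) ⟩
    x zero * det (M [ c ≔ V zero ]) + 1# * det (M [ c ≔ (λ r → sum λ k → x (suc k) * V (suc k) r) ])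
      ≈⟨ +-congˡ (trans (*-identityˡ _) (det-≔-combination M c (x ∘ suc) (V ∘ suc))) ⟩
    (sum λ k → x k * det (M [ c ≔ V k ])) ∎

  ≔-cong : (M : Matrix n) (c : Fin n) {u v : Vect n} → (∀ r → u r ≈ v r) → ∀ r k → (M [ c ≔ u ]) r k ≈ (M [ c ≔ v ]) r k
  ≔-cong M c u≈v r k with k ≟ c
  ... | yes _ = u≈v r
  ... | no  _ = refl

  -- Since v is the combination of the columns of M with coefficients x, expanding column `c`
  -- linearly leaves only k = c: every other summand has column k twice.
  cramer : (M : Matrix n) (c : Fin n) (x v : Vect n) → (∀ r → (sum λ k → M r k * x k) ≈ v r) →
           det (M [ c ≔ v ]) ≈ x c * det M
  cramer M c x v Mx≈v = begin
    det (M [ c ≔ v ])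
      ≈⟨ det-cong (≔-cong M c λ r → trans (sym (Mx≈v r)) (sum-cong λ k → *-comm (M r k) (x k))) ⟩
    det (M [ c ≔ (λ r → sum λ k → x k * M r k) ])
      ≈⟨ det-≔-combination M c x (λ k r → M r k) ⟩
    (sum λ k → x k * det (M [ c ≔ (λ r → M r k) ]))
      ≈⟨ sum-single c (λ k k≢c → trans (*-congˡ (det-equal-columns _ k≢c λ r →
           trans (≔-miss M (λ r → M r k) r k≢c) (sym (≔-hit M c (λ r → M r k) r)))) (x*0≈0 _)) ⟩
    x c * det (M [ c ≔ (λ r → M r c) ])
      ≈⟨ *-congˡ (det-cong (≔-self M c λ _ → refl)) ⟩
    x c * det M ∎

  -- Identifies the numerator in Cramer's rule for the right-hand side e₀ with a principal minor. In
  -- the expansion, each other minor still contains the zero part of the replaced column.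
  det-≔-unit : (M : Matrix (suc n)) → det (M [ zero ≔ (λ r → δ r zero) ]) ≈ det (minor M zero)
  det-≔-unit M = begin
    det N                                             ≈⟨ sum-single zero rest ⟩
    1# * N zero zero * det (minor N zero)             ≈⟨ solve 1 (λ x → con (+ 1) :* con (+ 1) :* x := x) refl _ ⟩
    det (minor M zero)                                ∎
    where
    N = M [ zero ≔ (λ r → δ r zero) ]
    rest : ∀ l → l ≢ zero → (- 1#) ^ toℕ l * N zero l * det (minor N l) ≈ 0#
    rest l l≢0 = trans (*-congˡ (det-zero-column (minor N l) (punchOut l≢0) λ i →
      reflexive (≡.cong (N (suc i)) (punchIn-punchOut l≢0)))) (x*0≈0 _)

-- Positive rationals as elements of the field.

module Positivity {c ℓ₁ ℓ₂ : Level} (K : HeytingField c ℓ₁ ℓ₂) (char0 : CharacteristicZero K) where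

  open Scalars K char0

  *-1/ : ∀ {x} (x#0 : x # 0#) → x * 1/ x#0 ≈ 1#
  *-1/ {x} x#0 = trans (*-congʳ (sym (x-0≈x x))) (proj₂ (proj₂ (#⇒invertible x#0)))

  unit⇒# : ∀ {x y} → x * y ≈ 1# → x # 0#
  unit⇒# {x} {y} xy≈1 = invertible⇒# (y , trans (*-congˡ (x-0≈x x)) (trans (*-comm y x) xy≈1)
                                        , trans (*-congʳ (x-0≈x x)) xy≈1)

  -- `Pos x` places x at the rational (p + 1)/(q + 1), written without division. `NonNeg` carries
  -- the decision between zero and positive, which the field itself could not make.
  Pos NonNeg : Carrier → Set ℓ₁
  Pos x    = ∃[ p ] ∃[ q ] x * ⟦ suc q ⟧ ≈ ⟦ suc p ⟧
  NonNeg x = x ≈ 0# ⊎ Pos x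

  pos-cong : ∀ {x y} → x ≈ y → Pos x → Pos y
  pos-cong x≈y (p , q , eq) = p , q , trans (*-congʳ (sym x≈y)) eq

  pos-1 : Pos 1#
  pos-1 = 0 , 0 , *-identityˡ _

  -- The witnesses are the predecessors of (p + 1)(b + 1) + (q + 1)(a + 1) and (a + 1)(b + 1),
  -- arranged so that their successors unfold to these numbers.
  pos-+ : ∀ {x y} → Pos x → Pos y → Pos (x + y)
  pos-+ {x} {y} (p , a , xa≈p) (q , b , yb≈q) = b ℕ.+ p ℕ.* suc b ℕ.+ suc q ℕ.* suc a , b ℕ.+ a ℕ.* suc b , (begin
    (x + y) * ⟦ suc a ℕ.* suc b ⟧               ≈⟨ *-congˡ (×1-homo-* (suc a) (suc b)) ⟩
    (x + y) * (⟦ suc a ⟧ * ⟦ suc b ⟧)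
      ≈⟨ solve 4 (λ x y a b → (x :+ y) :* (a :* b) := x :* a :* b :+ y :* b :* a) refl x y ⟦ suc a ⟧ ⟦ suc b ⟧ ⟩
    x * ⟦ suc a ⟧ * ⟦ suc b ⟧ + y * ⟦ suc b ⟧ * ⟦ suc a ⟧
      ≈⟨ +-cong (*-congʳ xa≈p) (*-congʳ yb≈q) ⟩
    ⟦ suc p ⟧ * ⟦ suc b ⟧ + ⟦ suc q ⟧ * ⟦ suc a ⟧
      ≈⟨ +-cong (×1-homo-* (suc p) (suc b)) (×1-homo-* (suc q) (suc a)) ⟨
    ⟦ suc p ℕ.* suc b ⟧ + ⟦ suc q ℕ.* suc a ⟧
      ≈⟨ ×-homo-+ 1# (suc p ℕ.* suc b) (suc q ℕ.* suc a) ⟨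
    ⟦ suc p ℕ.* suc b ℕ.+ suc q ℕ.* suc a ⟧ ∎)

  pos-* : ∀ {x y} → Pos x → Pos y → Pos (x * y)
  pos-* {x} {y} (p , a , xa≈p) (q , b , yb≈q) = q ℕ.+ p ℕ.* suc q , b ℕ.+ a ℕ.* suc b , (begin
    x * y * ⟦ suc a ℕ.* suc b ⟧               ≈⟨ *-congˡ (×1-homo-* (suc a) (suc b)) ⟩
    x * y * (⟦ suc a ⟧ * ⟦ suc b ⟧)
      ≈⟨ solve 4 (λ x y a b → x :* y :* (a :* b) := x :* a :* (y :* b)) refl x y ⟦ suc a ⟧ ⟦ suc b ⟧ ⟩
    x * ⟦ suc a ⟧ * (y * ⟦ suc b ⟧)           ≈⟨ *-cong xa≈p yb≈q ⟩
    ⟦ suc p ⟧ * ⟦ suc q ⟧                     ≈⟨ ×1-homo-* (suc p) (suc q) ⟨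
    ⟦ suc p ℕ.* suc q ⟧ ∎)

  pos-inverse : ∀ {x} → Pos x → ∃[ y ] Pos y × x * y ≈ 1#
  pos-inverse {x} (p , q , xq≈p) = ⟦ suc q ⟧ * i , (q , p , (begin
      ⟦ suc q ⟧ * i * ⟦ suc p ⟧      ≈⟨ *-assoc _ _ _ ⟩
      ⟦ suc q ⟧ * (i * ⟦ suc p ⟧)    ≈⟨ *-congˡ (trans (*-comm _ _) (*-1/ (char0 (suc p)))) ⟩
      ⟦ suc q ⟧ * 1#                 ≈⟨ *-identityʳ _ ⟩
      ⟦ suc q ⟧                      ∎))
    , (begin
      x * (⟦ suc q ⟧ * i)            ≈⟨ *-assoc _ _ _ ⟨
      x * ⟦ suc q ⟧ * i              ≈⟨ *-congʳ xq≈p ⟩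
      ⟦ suc p ⟧ * i                  ≈⟨ *-1/ (char0 (suc p)) ⟩
      1#                             ∎)
    where i = 1/ (char0 (suc p))

  nonNeg-cong : ∀ {x y} → x ≈ y → NonNeg x → NonNeg y
  nonNeg-cong x≈y (inj₁ x≈0) = inj₁ (trans (sym x≈y) x≈0)
  nonNeg-cong x≈y (inj₂ x>0) = inj₂ (pos-cong x≈y x>0)

  pos+nonNeg : ∀ {x y} → Pos x → NonNeg y → Pos (x + y)
  pos+nonNeg x>0 (inj₁ y≈0) = pos-cong (sym (trans (+-congˡ y≈0) (+-identityʳ _))) x>0
  pos+nonNeg x>0 (inj₂ y>0) = pos-+ x>0 y>0

  nonNeg+pos : ∀ {x y} → NonNeg x → Pos y → Pos (x + y)
  nonNeg+pos x≥0 y>0 = pos-cong (+-comm _ _) (pos+nonNeg y>0 x≥0)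

  nonNeg-+ : ∀ {x y} → NonNeg x → NonNeg y → NonNeg (x + y)
  nonNeg-+ (inj₁ x≈0) y≥0 = nonNeg-cong (sym (trans (+-congʳ x≈0) (+-identityˡ _))) y≥0
  nonNeg-+ (inj₂ x>0) y≥0 = inj₂ (pos+nonNeg x>0 y≥0)

  nonNeg-* : ∀ {x y} → NonNeg x → NonNeg y → NonNeg (x * y)
  nonNeg-* (inj₁ x≈0) _          = inj₁ (trans (*-congʳ x≈0) (zeroˡ _))
  nonNeg-* (inj₂ _)   (inj₁ y≈0) = inj₁ (trans (*-congˡ y≈0) (x*0≈0 _))
  nonNeg-* (inj₂ x>0) (inj₂ y>0) = inj₂ (pos-* x>0 y>0)

  nonNeg-sum : ∀ {n} {f : Vect n} → (∀ i → NonNeg (f i)) → NonNeg (sum f)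
  nonNeg-sum {zero}  f≥0 = inj₁ refl
  nonNeg-sum {suc n} f≥0 = nonNeg-+ (f≥0 zero) (nonNeg-sum (f≥0 ∘ suc))

  pos-sum : ∀ {n} {f : Vect n} → (∀ i → NonNeg (f i)) → ∀ i → Pos (f i) → Pos (sum f)
  pos-sum f≥0 zero    fi>0 = pos+nonNeg fi>0 (nonNeg-sum (f≥0 ∘ suc))
  pos-sum f≥0 (suc i) fi>0 = nonNeg+pos (f≥0 zero) (pos-sum (f≥0 ∘ suc) i fi>0)

-- Solvability of grounded networks by elimination.

module Elimination {c ℓ₁ ℓ₂ : Level} (K : HeytingField c ℓ₁ ℓ₂) (char0 : CharacteristicZero K) where

  open Scalars K char0
  open Determinant K char0
  open Positivity K char0

  private variable n : ℕ

  -- `W` is read as minus a grounded Laplacian: off-diagonal entries are conductances, and minus a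
  -- row sum is the conductance from `i` to the ground.
  leak : Matrix n → Vect n
  leak W i = - sum (W i)

  -- A path of positive conductances from `i` to a leaking node. It guarantees positive pivots when
  -- only some nodes leak.
  data Grounded (W : Matrix n) (i : Fin n) : Set (c ⊔ ℓ₁) where
    here  : Pos (leak W i) → Grounded W i
    there : ∀ {j} → i ≢ j → Pos (W i j) → Grounded W j → Grounded W i

  NonNegOffDiagonal : Matrix n → Set ℓ₁
  NonNegOffDiagonal W = ∀ i j → i ≢ j → NonNeg (W i j)

  -- The Schur complement of the first entry. Here `e` stands for the inverse of `- W zero zero`,
  -- which turns the usual minus sign into a plus.
  schur : Matrix (suc n) → Carrier → Matrix n
  schur W e i j = W (suc i) (suc j) + W (suc i) zero * e * W zero (suc j)

  -- The ground behaves like one more column: eliminating node 0 redistributes its leakage by the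
  -- same rule as its conductances.
  leak-schur : (W : Matrix (suc n)) (e : Carrier) → - W zero zero * e ≈ 1# → ∀ i →
               leak (schur W e) i ≈ leak W (suc i) + W (suc i) zero * e * leak W zero
  leak-schur W e de≈1 i = begin
    - sum (schur W e i)
      ≈⟨ -‿cong (trans (∑-distrib-+ (λ j → W (suc i) (suc j)) (λ j → w * e * W zero (suc j)))
                       (+-congˡ (sym (*-distribˡ-sum (w * e) (λ j → W zero (suc j)))))) ⟩
    - (s + w * e * s₀)
      ≈⟨ solve 5 (λ s w e s₀ d → :- (s :+ w :* e :* s₀) :=
           :- (w :+ s) :+ w :* e :* :- (d :+ s₀) :+ w :* (con (+ 1) :- :- d :* e)) refl s w e s₀ d ⟩
    leak W (suc i) + w * e * leak W zero + w * (1# - - d * e)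
      ≈⟨ +-congˡ (*-congˡ (+-congˡ (-‿cong de≈1))) ⟩
    leak W (suc i) + w * e * leak W zero + w * (1# - 1#)
      ≈⟨ solve 2 (λ x w → x :+ w :* (con (+ 1) :- con (+ 1)) := x) refl _ w ⟩
    leak W (suc i) + w * e * leak W zero ∎
    where
    w  = W (suc i) zero
    d  = W zero zero
    s  = sum (λ j → W (suc i) (suc j))
    s₀ = sum (λ j → W zero (suc j))

  -- Row zero solved for the eliminated unknown: W₀₀ x₀ = b₀ - t, where t is the contribution of the
  -- remaining unknowns and `e` is -1/W₀₀.
  extend : Matrix (suc n) → Carrier → Vect (suc n) → Vect n → Vect (suc n)
  extend W e b y zero    = e * (sum (λ k → W zero (suc k) * y k) - b zero)
  extend W e b y (suc k) = y k

  back-substitute : (W : Matrix (suc n)) (e : Carrier) (b : Vect (suc n)) (y : Vect n) → - W zero zero * e ≈ 1# →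
                    (∀ i → (sum λ k → schur W e i k * y k) ≈ b (suc i) + W (suc i) zero * e * b zero) →
                    ∀ i → (sum λ k → W i k * extend W e b y k) ≈ b i
  back-substitute W e b y de≈1 Sy≈ zero = begin
    d * (e * (t - b₀)) + t         ≈⟨ solve 4 (λ d e t b → d :* (e :* (t :- b)) :+ t := b :+ (con (+ 1) :- :- d :* e) :* (t :- b)) refl d e t b₀ ⟩
    b₀ + (1# - - d * e) * (t - b₀) ≈⟨ +-congˡ (*-congʳ (+-congˡ (-‿cong de≈1))) ⟩
    b₀ + (1# - 1#) * (t - b₀)      ≈⟨ solve 2 (λ b t → b :+ (con (+ 1) :- con (+ 1)) :* (t :- b) := b) refl b₀ t ⟩
    b₀                             ∎
    where
    d  = W zero zero
    b₀ = b zero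
    t  = sum (λ k → W zero (suc k) * y k)
  back-substitute W e b y de≈1 Sy≈ (suc i) = begin
    w * (e * (t - b₀)) + u                    ≈⟨ solve 5 (λ w e t b u → w :* (e :* (t :- b)) :+ u := (u :+ w :* e :* t) :- w :* e :* b) refl w e t b₀ u ⟩
    (u + w * e * t) - w * e * b₀              ≈⟨ +-congʳ (+-congˡ (*-distribˡ-sum (w * e) (λ k → W zero (suc k) * y k))) ⟩
    (u + sum (λ k → w * e * (W zero (suc k) * y k))) - w * e * b₀
      ≈⟨ +-congʳ (∑-distrib-+ (λ k → W (suc i) (suc k) * y k) (λ k → w * e * (W zero (suc k) * y k))) ⟨
    sum (λ k → W (suc i) (suc k) * y k + w * e * (W zero (suc k) * y k)) - w * e * b₀
      ≈⟨ +-congʳ (sum-cong (λ k → solve 4 (λ a we c y → a :* y :+ we :* (c :* y) := (a :+ we :* c) :* y) refl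
           (W (suc i) (suc k)) (w * e) (W zero (suc k)) (y k))) ⟩
    sum (λ k → schur W e i k * y k) - w * e * b₀      ≈⟨ +-congʳ (Sy≈ i) ⟩
    b (suc i) + w * e * b₀ - w * e * b₀       ≈⟨ solve 2 (λ x z → x :+ z :- z := x) refl (b (suc i)) (w * e * b₀) ⟩
    b (suc i)                                 ∎
    where
    w  = W (suc i) zero
    b₀ = b zero
    t  = sum (λ k → W zero (suc k) * y k)
    u  = sum (λ k → W (suc i) (suc k) * y k)

  -- The pivot is the leakage plus all conductances at node 0. The start of the grounding path makes
  -- one of these positive.
  diagonal>0 : (W : Matrix (suc n)) → NonNegOffDiagonal W → NonNeg (leak W zero) → Grounded W zero →
               Pos (- W zero zero)
  diagonal>0 W W≥0 l≥0 gr = pos-cong (solve 2 (λ d s → :- (d :+ s) :+ s := :- d) refl (W zero zero) _) (total gr)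
    where
    W₀≥0 : ∀ j → NonNeg (W zero (suc j))
    W₀≥0 j = W≥0 zero (suc j) λ ()
    total : Grounded W zero → Pos (leak W zero + sum (λ j → W zero (suc j)))
    total (here l>0)              = pos+nonNeg l>0 (nonNeg-sum W₀≥0)
    total (there {zero} 0≢0 _ _)  = contradiction ≡.refl 0≢0
    total (there {suc j} _ w>0 _) = nonNeg+pos l≥0 (pos-sum W₀≥0 j w>0)

  module _ (W : Matrix (suc n)) (e : Carrier) (e>0 : Pos e) (de≈1 : - W zero zero * e ≈ 1#)
           (W≥0 : NonNegOffDiagonal W) (l≥0 : ∀ i → NonNeg (leak W i)) where

    schur-NonNegOffDiagonal : NonNegOffDiagonal (schur W e)
    schur-NonNegOffDiagonal i j i≢j = nonNeg-+ (W≥0 (suc i) (suc j) (i≢j ∘ suc-injective))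
      (nonNeg-* (nonNeg-* (W≥0 (suc i) zero λ ()) (inj₂ e>0)) (W≥0 zero (suc j) λ ()))

    schur-leak : ∀ i → NonNeg (leak (schur W e) i)
    schur-leak i = nonNeg-cong (sym (leak-schur W e de≈1 i))
      (nonNeg-+ (l≥0 (suc i)) (nonNeg-* (nonNeg-* (W≥0 (suc i) zero λ ()) (inj₂ e>0)) (l≥0 zero)))

    -- A passage of the path through node 0 is cut short. If 0 leaks, then `i` leaks afterwards; if
    -- the path goes on to k, the edge from `i` to k gains the conductance w e w′; if it comes back
    -- to `i`, the detour is dropped.
    schur-Grounded : ∀ {i} → Grounded W (suc i) → Grounded (schur W e) i
    schur-Grounded {i} (here l>0) = here (pos-cong (sym (leak-schur W e de≈1 i))
      (pos+nonNeg l>0 (nonNeg-* (nonNeg-* (W≥0 (suc i) zero λ ()) (inj₂ e>0)) (l≥0 zero))))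
    schur-Grounded {i} (there {suc j} i≢j w>0 g) = there (i≢j ∘ ≡.cong suc)
      (pos+nonNeg w>0 (nonNeg-* (nonNeg-* (W≥0 (suc i) zero λ ()) (inj₂ e>0)) (W≥0 zero (suc j) λ ())))
      (schur-Grounded g)
    schur-Grounded {i} (there {zero} _ w>0 (here l>0)) = here (pos-cong (sym (leak-schur W e de≈1 i))
      (nonNeg+pos (l≥0 (suc i)) (pos-* (pos-* w>0 e>0) l>0)))
    schur-Grounded {i} (there {zero} _ _ (there {zero} 0≢0 _ _)) = contradiction ≡.refl 0≢0
    schur-Grounded {i} (there {zero} _ w>0 (there {suc k} _ w′>0 g)) with i ≟ k
    ... | yes ≡.refl = schur-Grounded g
    ... | no i≢k     = there i≢k (nonNeg+pos (W≥0 (suc i) (suc k) (i≢k ∘ suc-injective))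
                                             (pos-* (pos-* w>0 e>0) w′>0)) (schur-Grounded g)

  Solvable : ℕ → Set (c ⊔ ℓ₁)
  Solvable n = (W : Matrix n) → NonNegOffDiagonal W → (∀ i → NonNeg (leak W i)) → (∀ i → Grounded W i) →
               ∀ (b : Vect _) → Σ[ x ∈ Vect _ ] ∀ i → (sum λ k → W i k * x k) ≈ b i

  back-substitution : (W : Matrix (suc n)) (e : Carrier) (b : Vect (suc n)) → - W zero zero * e ≈ 1# →
    (Σ[ y ∈ Vect _ ] ∀ i → (sum λ k → schur W e i k * y k) ≈ b (suc i) + W (suc i) zero * e * b zero) →
    Σ[ x ∈ Vect _ ] ∀ i → (sum λ k → W i k * x k) ≈ b i
  back-substitution W e b de≈1 (y , Sy≈) = extend W e b y , back-substitute W e b y de≈1 Sy≈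

  -- Gaussian elimination of the first unknown (a star-mesh transformation).
  solvable-suc : Solvable n → (W : Matrix (suc n)) → NonNegOffDiagonal W → (∀ i → NonNeg (leak W i)) →
                 (∀ i → Grounded W i) → (∃[ e ] Pos e × - W zero zero * e ≈ 1#) →
                 ∀ (b : Vect _) → Σ[ x ∈ Vect _ ] ∀ i → (sum λ k → W i k * x k) ≈ b i
  solvable-suc solve-reduced W W≥0 l≥0 gr (e , e>0 , de≈1) b = back-substitution W e b de≈1
    (solve-reduced (schur W e) (schur-NonNegOffDiagonal W e e>0 de≈1 W≥0 l≥0)
      (schur-leak W e e>0 de≈1 W≥0 l≥0) (λ i → schur-Grounded W e e>0 de≈1 W≥0 l≥0 (gr (suc i)))
      (λ i → b (suc i) + W (suc i) zero * e * b zero))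

  solvable : Solvable n
  solvable {zero}  W _ _ _ b = b , λ ()
  solvable {suc n} W W≥0 l≥0 gr =
    solvable-suc solvable W W≥0 l≥0 gr (pos-inverse (diagonal>0 W W≥0 (l≥0 zero) (gr zero)))

  solvable-strict : (W : Matrix n) → NonNegOffDiagonal W → (∀ i → Pos (leak W i)) →
                    ∀ (b : Vect _) → Σ[ x ∈ Vect _ ] ∀ i → (sum λ k → W i k * x k) ≈ b i
  solvable-strict W W≥0 l>0 = solvable W W≥0 (inj₂ ∘ l>0) (here ∘ l>0)

  -- By Cramer's rule, det (minor W 0) = x₀ det W for the solution x of W x = e₀.
  det-invertible-suc : (W : Matrix (suc n)) → (Σ[ x ∈ Vect _ ] ∀ i → (sum λ k → W i k * x k) ≈ δ i zero) →
                       (∃[ y ] det (minor W zero) * y ≈ 1#) → ∃[ y ] det W * y ≈ 1#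
  det-invertible-suc W (x , Wx≈e₀) (y , dy≈1) = x zero * y , (begin
      det W * (x zero * y)       ≈⟨ solve 3 (λ d x y → d :* (x :* y) := x :* d :* y) refl (det W) (x zero) y ⟩
      x zero * det W * y         ≈⟨ *-congʳ (trans (sym (det-≔-unit W)) (cramer W zero x (λ r → δ r zero) Wx≈e₀)) ⟨
      det (minor W zero) * y     ≈⟨ dy≈1 ⟩
      1#                         ∎)

  -- Strict leakage survives in the minor, because the conductance to the deleted node 0 is added to
  -- the leakage there.
  det-invertible : (W : Matrix n) → NonNegOffDiagonal W → (∀ i → Pos (leak W i)) → ∃[ y ] det W * y ≈ 1#
  det-invertible {zero}  W _ _ = 1# , *-identityˡ 1#
  det-invertible {suc n} W W≥0 l>0 = det-invertible-suc W (solvable-strict W W≥0 l>0 (λ r → δ r zero))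
    (det-invertible (minor W zero) (λ i j i≢j → W≥0 (suc i) (suc j) (i≢j ∘ suc-injective))
      (λ i → pos-cong (solve 2 (λ w s → :- (w :+ s) :+ w := :- s) refl (W (suc i) zero) (sum (λ j → W (suc i) (suc j))))
                      (pos+nonNeg (l>0 (suc i)) (W≥0 (suc i) zero λ ()))))

-- Effective resistances and the Kirchhoff index from a Green matrix.

module Resistance {c ℓ₁ ℓ₂ : Level} (K : HeytingField c ℓ₁ ℓ₂) (char0 : CharacteristicZero K) where

  open Scalars K char0
  open Positivity K char0
  open Elimination K char0

  private variable n m : ℕ

  sum₂-cong : {f g : Fin m → Fin n → Carrier} → (∀ i j → f i j ≈ g i j) →
              (sum λ i → sum (f i)) ≈ (sum λ i → sum (g i))
  sum₂-cong f≈g = sum-cong λ i → sum-cong (f≈g i)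

  sum₂-+ : (f g : Fin m → Fin n → Carrier) →
           (sum λ i → sum λ j → f i j + g i j) ≈ (sum λ i → sum (f i)) + (sum λ i → sum (g i))
  sum₂-+ f g = trans (sum-cong λ i → ∑-distrib-+ (f i) (g i)) (∑-distrib-+ (λ i → sum (f i)) (λ i → sum (g i)))

  sum₂-sub : (f g : Fin m → Fin n → Carrier) →
             (sum λ i → sum λ j → f i j - g i j) ≈ (sum λ i → sum (f i)) - (sum λ i → sum (g i))
  sum₂-sub f g = trans (sum-cong λ i → sum-sub (f i) (g i)) (sum-sub (λ i → sum (f i)) (λ i → sum (g i)))

  if-+ : ∀ b (x y : Carrier) → (if b then x + y else 0#) ≈ (if b then x else 0#) + (if b then y else 0#)
  if-+ true  x y = refl
  if-+ false x y = sym (+-identityˡ 0#)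

  if-cong : ∀ b {x y : Carrier} → x ≈ y → (if b then x else 0#) ≈ (if b then y else 0#)
  if-cong true  x≈y = x≈y
  if-cong false _   = refl

  -- Turns the sum over i < j in `IsKirchhoffIndex` into an unrestricted one: the two summands fill
  -- the two triangles, and the diagonal contributes nothing.
  sum-triangle : (f : Matrix n) → (∀ i → f i i ≈ 0#) →
    (sum λ i → sum λ j → if does (i <? j) then f i j + f j i else 0#) ≈ (sum λ i → sum (f i))
  sum-triangle f f₀ = begin
    (sum λ i → sum λ j → if does (i <? j) then f i j + f j i else 0#)
      ≈⟨ sum₂-cong (λ i j → if-+ (does (i <? j)) (f i j) (f j i)) ⟩
    (sum λ i → sum λ j → upper i j + lower j i)
      ≈⟨ sum₂-+ upper (λ i j → lower j i) ⟩
    (sum λ i → sum (upper i)) + (sum λ i → sum λ j → lower j i)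
      ≈⟨ +-congˡ (∑-comm (λ i j → lower j i)) ⟩
    (sum λ i → sum (upper i)) + (sum λ i → sum (lower i))
      ≈⟨ sum₂-+ upper lower ⟨
    (sum λ i → sum λ j → upper i j + lower i j)
      ≈⟨ sum₂-cong split ⟩
    (sum λ i → sum (f i)) ∎
    where
    upper lower : Matrix _
    upper i j = if does (i <? j) then f i j else 0#
    lower i j = if does (j <? i) then f i j else 0#
    split : ∀ i j → upper i j + lower i j ≈ f i j
    split i j with <-cmp i j
    ... | tri< i<j _ i≯j rewrite dec-true (i <? j) i<j | dec-false (j <? i) i≯j = +-identityʳ _
    ... | tri≈ i≮j ≡.refl _ rewrite dec-false (i <? i) i≮j = trans (+-identityˡ 0#) (sym (f₀ i))
    ... | tri> i≮j _ i>j rewrite dec-false (i <? j) i≮j | dec-true (j <? i) i>j = +-identityˡ _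

  module _ (G : Graph (Fin n)) where

    -- The Laplacian applied to `φ`, in the form in which `IsPotential` states Kirchhoff's law.
    netCurrent : Vect n → Vect n
    netCurrent φ x = sum λ y → A G x y * (φ x - φ y)

    A-sym : ∀ x y → A G x y ≈ A G y x
    A-sym x y rewrite adj-sym G x y = refl

    A-irrefl : ∀ x → A G x x ≈ 0#
    A-irrefl x rewrite adj-irrefl G x = refl

    A-nonNeg : ∀ x y → NonNeg (A G x y)
    A-nonNeg x y with adj G x y
    ... | true  = inj₂ pos-1
    ... | false = inj₁ refl

    A-pos : ∀ {x y} → adj G x y ≡ true → Pos (A G x y)
    A-pos eq rewrite eq = pos-1

    netCurrent-sub : ∀ φ ψ x → netCurrent (λ y → φ y - ψ y) x ≈ netCurrent φ x - netCurrent ψ x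
    netCurrent-sub φ ψ x = trans
      (sum-cong λ y → solve 5 (λ a p q r s → a :* (p :- q :- (r :- s)) := a :* (p :- r) :- a :* (q :- s)) refl
        (A G x y) (φ x) (ψ x) (φ y) (ψ y))
      (sum-sub (λ y → A G x y * (φ x - φ y)) (λ y → A G x y * (ψ x - ψ y)))

    -- Both sides split into a part with φ x ψ x, visibly symmetric in φ and ψ, and a cross term,
    -- symmetric because `A G` is.
    netCurrent-selfAdjoint : ∀ φ ψ → (sum λ x → ψ x * netCurrent φ x) ≈ (sum λ x → φ x * netCurrent ψ x)
    netCurrent-selfAdjoint φ ψ = begin
      (sum λ x → ψ x * netCurrent φ x)                 ≈⟨ expand ψ φ ⟩
      S φ ψ - cross ψ φ                                ≈⟨ +-cong (sum₂-cong λ x y → *-congˡ {A G x y} (*-comm (φ x) (ψ x)))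
                                                                 (-‿cong (cross-comm ψ φ)) ⟩
      S ψ φ - cross φ ψ                                ≈⟨ expand φ ψ ⟨
      (sum λ x → φ x * netCurrent ψ x)                 ∎
      where
      S cross : Vect n → Vect n → Carrier
      S φ ψ     = sum λ x → sum λ y → A G x y * (φ x * ψ x)
      cross ψ φ = sum λ x → sum λ y → A G x y * (ψ x * φ y)
      expand : ∀ ψ φ → (sum λ x → ψ x * netCurrent φ x) ≈ S φ ψ - cross ψ φ
      expand ψ φ = trans (sum-cong λ x → trans (*-distribˡ-sum (ψ x) (λ y → A G x y * (φ x - φ y)))
          (sum-cong λ y → solve 4 (λ a p q r → r :* (a :* (p :- q)) := a :* (p :* r) :- a :* (r :* q)) refl
            (A G x y) (φ x) (φ y) (ψ x)))
        (sum₂-sub (λ x y → A G x y * (φ x * ψ x)) (λ x y → A G x y * (ψ x * φ y)))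
      cross-comm : ∀ ψ φ → cross ψ φ ≈ cross φ ψ
      cross-comm ψ φ = trans (∑-comm λ x y → A G x y * (ψ x * φ y))
        (sum₂-cong λ y x → *-cong (A-sym x y) (*-comm (ψ x) (φ y)))

    -- Self-adjointness tested against the constant potential 1, which drives no current.
    netCurrent-balanced : ∀ φ → sum (netCurrent φ) ≈ 0#
    netCurrent-balanced φ = begin
      sum (netCurrent φ)                              ≈⟨ sum-cong (λ x → sym (*-identityˡ (netCurrent φ x))) ⟩
      (sum λ x → 1# * netCurrent φ x)                 ≈⟨ netCurrent-selfAdjoint φ (λ _ → 1#) ⟩
      (sum λ x → φ x * netCurrent (λ _ → 1#) x)       ≈⟨ sum-zero (λ x → trans (*-congˡ (sum-zero λ y →
                                                           solve 1 (λ a → a :* (con (+ 1) :- con (+ 1)) := con (+ 0)) refl (A G x y))) (x*0≈0 (φ x))) ⟩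
      0#                                              ∎

    potential-difference : ∀ (φ : Vect n) i j → (sum λ x → φ x * (δ x i - δ x j)) ≈ φ i - φ j
    potential-difference φ i j = trans (sum-cong λ x → x[y-z]≈xy-xz (φ x) (δ x i) (δ x j))
      (trans (sum-sub (λ x → φ x * δ x i) (λ x → φ x * δ x j)) (+-cong (sum-δʳ i φ) (-‿cong (sum-δʳ j φ))))

    -- ⟨ψ, Lφ⟩ = ⟨φ, Lψ⟩ evaluates to the two potential differences.
    potential-difference-unique : ∀ {i j} (φ ψ : Vect n) → IsPotential G i j φ → IsPotential G i j ψ → φ i - φ j ≈ ψ i - ψ j
    potential-difference-unique {i} {j} φ ψ φ-pot ψ-pot = begin
      φ i - φ j                             ≈⟨ potential-difference φ i j ⟨
      (sum λ x → φ x * (δ x i - δ x j))     ≈⟨ sum-cong (λ x → *-congˡ (ψ-pot x)) ⟨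
      (sum λ x → φ x * netCurrent ψ x)      ≈⟨ netCurrent-selfAdjoint φ ψ ⟨
      (sum λ x → ψ x * netCurrent φ x)      ≈⟨ sum-cong (λ x → *-congˡ (φ-pot x)) ⟩
      (sum λ x → ψ x * (δ x i - δ x j))     ≈⟨ potential-difference ψ i j ⟩
      ψ i - ψ j                             ∎

    -- Column i of X is a potential for a unit current entering at i and leaving
    -- through the distribution v.
    IsGreenMatrix : Vect n → Matrix n → Set ℓ₁
    IsGreenMatrix v X = ∀ i x → netCurrent (λ y → X y i) x ≈ δ x i - v x

    -- Both columns discharge through the same distribution `v`, which cancels in their difference.
    green-potential : ∀ {v X} → IsGreenMatrix v X → ∀ i j → IsPotential G i j (λ y → X y i - X y j)
    green-potential {v} {X} green i j x = begin
      netCurrent (λ y → X y i - X y j) x                      ≈⟨ netCurrent-sub (λ y → X y i) (λ y → X y j) x ⟩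
      netCurrent (λ y → X y i) x - netCurrent (λ y → X y j) x ≈⟨ +-cong (green i x) (-‿cong (green j x)) ⟩
      δ x i - v x - (δ x j - v x)                             ≈⟨ solve 3 (λ a b c → a :- c :- (b :- c) := a :- b) refl (δ x i) (δ x j) (v x) ⟩
      δ x i - δ x j                                           ∎

    green⇒KirchhoffIndex : ∀ {v X} → IsGreenMatrix v X → ∃ (IsKirchhoffIndex G)
    green⇒KirchhoffIndex {v} {X} green = _ , (λ i j → X i i - X i j - (X j i - X j j)) ,
      (λ i j → (λ y → X y i - X y j) , green-potential {v} {X} green i j , refl) , refl

    kirchhoffIndex-formula : ∀ {v X k} → IsGreenMatrix v X → IsKirchhoffIndex G k →
                             k ≈ ⟦ n ⟧ * tr X - (sum λ i → sum (X i))
    kirchhoffIndex-formula {v} {X} {k} green (r , resistance , k≈) = begin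
      k                                                                       ≈⟨ k≈ ⟩
      (sum λ i → sum λ j → if does (i <? j) then r i j else 0#)
        ≈⟨ sum₂-cong (λ i j → if-cong (does (i <? j)) {r i j} {f i j + f j i} (r≈ i j (resistance i j))) ⟩
      (sum λ i → sum λ j → if does (i <? j) then f i j + f j i else 0#)
        ≈⟨ sum-triangle f (λ i → -‿inverseʳ (X i i)) ⟩
      (sum λ i → sum λ j → X i i - X i j)                                     ≈⟨ sum₂-sub (λ i _ → X i i) X ⟩
      (sum λ i → sum {n} λ _ → X i i) - (sum λ i → sum (X i))
        ≈⟨ +-congʳ (trans (sum-cong λ i → sum-const n (X i i)) (sym (*-distribˡ-sum ⟦ n ⟧ λ i → X i i))) ⟩
      ⟦ n ⟧ * tr X - (sum λ i → sum (X i))                                    ∎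
      where
      -- The resistance between i and j is f i j + f j i with f zero on the diagonal, the shape
      -- required by `sum-triangle`.
      f : Matrix n
      f i j = X i i - X i j
      r≈ : ∀ i j → IsEffectiveResistance G i j (r i j) → r i j ≈ f i j + f j i
      r≈ i j (φ , φ-pot , r≈φ) = begin
        r i j                                   ≈⟨ r≈φ ⟩
        φ i - φ j                               ≈⟨ potential-difference-unique φ (λ y → X y i - X y j) φ-pot (green-potential {v} {X} green i j) ⟩
        X i i - X i j - (X j i - X j j)         ≈⟨ solve 4 (λ a b c d → a :- b :- (c :- d) := a :- b :+ (d :- c)) refl (X i i) (X i j) (X j i) (X j j) ⟩
        f i j + f j i                           ∎

  module GroundedAtZero (G : Graph (Fin (suc n))) where

    -- Minus the Laplacian without the row and column of vertex 0. The subtracted degree still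
    -- counts the edge to vertex 0, which thereby becomes leakage.
    W : Matrix n
    W i j = A G (suc i) (suc j) - δ i j * sum (A G (suc i))

    W-offDiagonal : ∀ {i j} → i ≢ j → W i j ≈ A G (suc i) (suc j)
    W-offDiagonal {i} {j} i≢j = begin
      A G (suc i) (suc j) - δ i j * s  ≈⟨ +-congˡ (-‿cong (*-congʳ (δ-≢ i≢j))) ⟩
      A G (suc i) (suc j) - 0# * s     ≈⟨ solve 2 (λ a s → a :- con (+ 0) :* s := a) refl (A G (suc i) (suc j)) s ⟩
      A G (suc i) (suc j)              ∎
      where s = sum (A G (suc i))

    W-apply : ∀ i (y : Vect n) → (sum λ k → W i k * y k) ≈ (sum λ k → A G (suc i) (suc k) * y k) - sum (A G (suc i)) * y i
    W-apply i y = begin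
      (sum λ k → W i k * y k)
        ≈⟨ sum-cong (λ k → solve 4 (λ a d s y → (a :- d :* s) :* y := a :* y :- d :* (s :* y)) refl (A G (suc i) (suc k)) (δ i k) s (y k)) ⟩
      (sum λ k → A G (suc i) (suc k) * y k - δ i k * (s * y k))
        ≈⟨ sum-sub (λ k → A G (suc i) (suc k) * y k) (λ k → δ i k * (s * y k)) ⟩
      (sum λ k → A G (suc i) (suc k) * y k) - (sum λ k → δ i k * (s * y k))
        ≈⟨ +-congˡ (-‿cong (sum-δˡ i (λ k → s * y k))) ⟩
      (sum λ k → A G (suc i) (suc k) * y k) - s * y i ∎
      where s = sum (A G (suc i))

    leak-W : ∀ i → leak W i ≈ A G (suc i) zero
    leak-W i = begin
      - sum (W i)                                   ≈⟨ -‿cong (sum-cong λ k → sym (*-identityʳ (W i k))) ⟩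
      - (sum λ k → W i k * 1#)                      ≈⟨ -‿cong (W-apply i (λ _ → 1#)) ⟩
      - ((sum λ k → A G (suc i) (suc k) * 1#) - (a + s) * 1#)
        ≈⟨ -‿cong (+-congʳ (sum-cong λ k → *-identityʳ (A G (suc i) (suc k)))) ⟩
      - (s - (a + s) * 1#)                          ≈⟨ solve 2 (λ a s → :- (s :- (a :+ s) :* con (+ 1)) := a) refl a s ⟩
      a                                             ∎
      where
      a = A G (suc i) zero
      s = sum λ k → A G (suc i) (suc k)

    grounded : ∀ {i} → Star (λ x y → adj G x y ≡ true) (suc i) zero → Grounded W i
    grounded {i} (_◅_ {j = zero} e _) = here (pos-cong (sym (leak-W i)) (A-pos G e))
    grounded {i} (_◅_ {j = suc j} e p) = step (i ≟ j) (grounded p)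
      where
      step : Dec (i ≡ j) → Grounded W j → Grounded W i
      step (yes ≡.refl) g = g
      step (no i≢j)     g = there i≢j (pos-cong (sym (W-offDiagonal i≢j)) (A-pos G e)) g

    Potential : Fin (suc n) → Set (c ⊔ ℓ₁)
    Potential i = Σ[ φ ∈ Vect (suc n) ] ∀ x → netCurrent G φ x ≈ δ x i - δ x zero

    potential : Connected G → ∀ i → Potential i
    potential connected i = fromSolution (solvable W
      (λ k l k≢l → nonNeg-cong (sym (W-offDiagonal k≢l)) (A-nonNeg G (suc k) (suc l)))
      (λ k → nonNeg-cong (sym (leak-W k)) (A-nonNeg G (suc k) zero))
      (λ k → grounded (connected (suc k) zero)) (λ k → δ (suc k) i))
      where
      fromSolution : (Σ[ y ∈ Vect n ] ∀ k → (sum λ l → W k l * y l) ≈ δ (suc k) i) → Potential i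
      fromSolution (y , Wy≈) = φ , current
        where
        φ : Vect (suc n)
        -- The ground has potential 0; the minus sign below is there because `W` is minus the
        -- Laplacian.
        φ zero    = 0#
        φ (suc k) = - y k
        current-suc : ∀ k → netCurrent G φ (suc k) ≈ δ (suc k) i
        current-suc k = begin
          a * (- y k - 0#) + (sum λ l → A G (suc k) (suc l) * (- y k - - y l))
            ≈⟨ +-congˡ (sum-cong λ l → solve 3 (λ a x y → a :* (:- x :- :- y) := a :* y :- a :* x) refl (A G (suc k) (suc l)) (y k) (y l)) ⟩
          a * (- y k - 0#) + (sum λ l → A G (suc k) (suc l) * y l - A G (suc k) (suc l) * y k)
            ≈⟨ +-congˡ (trans (sum-sub (λ l → A G (suc k) (suc l) * y l) (λ l → A G (suc k) (suc l) * y k))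
                              (+-congˡ (-‿cong (sym (*-distribʳ-sum (y k) (λ l → A G (suc k) (suc l))))))) ⟩
          a * (- y k - 0#) + (t - s * y k)
            ≈⟨ solve 4 (λ a y t s → a :* (:- y :- con (+ 0)) :+ (t :- s :* y) := t :- (a :+ s) :* y) refl a (y k) t s ⟩
          t - (a + s) * y k             ≈⟨ W-apply k y ⟨
          (sum λ l → W k l * y l)       ≈⟨ Wy≈ k ⟩
          δ (suc k) i                   ∎
          where
          a = A G (suc k) zero
          s = sum λ l → A G (suc k) (suc l)
          t = sum λ l → A G (suc k) (suc l) * y l
        u = sum λ k → δ (suc k) i
        δ-total : δ zero i + u ≈ 1#
        δ-total = trans (sum-cong λ x → sym (*-identityˡ (δ x i))) (sum-δʳ i (λ _ → 1#))
        current : ∀ x → netCurrent G φ x ≈ δ x i - δ x zero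
        current (suc k) = trans (current-suc k) (solve 1 (λ d → d := d :- con (+ 0)) refl (δ (suc k) i))
        -- The equation at the ground is not among those solved. It follows because all net currents
        -- add up to zero.
        current zero    = begin
          N₀                                       ≈⟨ solve 2 (λ x s → x := x :+ s :- s) refl N₀ N₊ ⟩
          N₀ + N₊ - N₊                             ≈⟨ +-cong (netCurrent-balanced G φ) (-‿cong (sum-cong current-suc)) ⟩
          0# - u                                   ≈⟨ solve 2 (λ d u → con (+ 0) :- u := d :- (d :+ u)) refl (δ zero i) u ⟩
          δ zero i - (δ zero i + u)                ≈⟨ +-congˡ (-‿cong δ-total) ⟩
          δ zero i - 1#                            ∎
          where
          N₀ = netCurrent G φ zero
          N₊ = sum λ k → netCurrent G φ (suc k)

    green : Connected G → Matrix (suc n)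
    green connected x i = proj₁ (potential connected i) x

    green-isGreen : (connected : Connected G) → IsGreenMatrix G (λ x → δ x zero) (green connected)
    green-isGreen connected i = proj₂ (potential connected i)

  kirchhoffIndex-exists : (G : Graph (Fin n)) → Connected G → ∃ (IsKirchhoffIndex G)
  kirchhoffIndex-exists {zero}  G connected = 0# , (λ ()) , (λ ()) , refl
  kirchhoffIndex-exists {suc n} G connected = green⇒KirchhoffIndex G {X = green connected} (green-isGreen connected)
    where open GroundedAtZero G using (green; green-isGreen)

-- Sums over edges and the incidence matrix.

module Incidence {c ℓ₁ ℓ₂ : Level} (K : HeytingField c ℓ₁ ℓ₂) (char0 : CharacteristicZero K) where

  open Scalars K char0
  open Resistance K char0

  private variable
    n m : ℕ
    X Y : Set

  -- Degrees and edges are defined by filtering lists; sums over lists pass through filters and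
  -- products and so lead to sums over `Fin`.
  sumᴸ : (X → Carrier) → List X → Carrier
  sumᴸ f = foldr (λ x s → f x + s) 0#

  sumᴸ-lookup : (f : X → Carrier) (xs : List X) → sum (λ e → f (lookup xs e)) ≈ sumᴸ f xs
  sumᴸ-lookup f []       = refl
  sumᴸ-lookup f (x ∷ xs) = +-congˡ (sumᴸ-lookup f xs)

  sumᴸ-filter : (p : X → Bool) (f : X → Carrier) (xs : List X) →
                sumᴸ f (filterᵇ p xs) ≈ sumᴸ (λ x → if p x then f x else 0#) xs
  sumᴸ-filter p f []       = refl
  sumᴸ-filter p f (x ∷ xs) with p x
  ... | true  = +-congˡ (sumᴸ-filter p f xs)
  ... | false = trans (sumᴸ-filter p f xs) (sym (+-identityˡ _))

  sumᴸ-tabulate : (f : X → Carrier) (g : Fin n → X) → sumᴸ f (tabulate g) ≈ sum (f ∘ g)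
  sumᴸ-tabulate {n = zero}  f g = refl
  sumᴸ-tabulate {n = suc n} f g = +-congˡ (sumᴸ-tabulate f (g ∘ suc))

  sumᴸ-++ : (f : X → Carrier) (xs ys : List X) → sumᴸ f (xs ++ ys) ≈ sumᴸ f xs + sumᴸ f ys
  sumᴸ-++ f []       ys = sym (+-identityˡ _)
  sumᴸ-++ f (x ∷ xs) ys = trans (+-congˡ (sumᴸ-++ f xs ys)) (sym (+-assoc _ _ _))

  sumᴸ-map : (f : Y → Carrier) (g : X → Y) (xs : List X) → sumᴸ f (map g xs) ≈ sumᴸ (f ∘ g) xs
  sumᴸ-map f g []       = refl
  sumᴸ-map f g (x ∷ xs) = +-congˡ (sumᴸ-map f g xs)

  sumᴸ-cartesianProduct : (f : X × Y → Carrier) (xs : List X) (ys : List Y) →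
    sumᴸ f (cartesianProduct xs ys) ≈ sumᴸ (λ x → sumᴸ (λ y → f (x , y)) ys) xs
  sumᴸ-cartesianProduct f []       ys = refl
  sumᴸ-cartesianProduct f (x ∷ xs) ys = trans (sumᴸ-++ f (map (x ,_) ys) (cartesianProduct xs ys))
    (+-cong (sumᴸ-map f (x ,_) ys) (sumᴸ-cartesianProduct f xs ys))

  length-sumᴸ : (xs : List X) → ⟦ length xs ⟧ ≈ sumᴸ (λ _ → 1#) xs
  length-sumᴸ []       = refl
  length-sumᴸ (x ∷ xs) = +-congˡ (length-sumᴸ xs)

  module _ (G : Graph (Fin n)) where

    degree-sum : ∀ i → π G i ≈ sum (A G i)
    degree-sum i = begin
      ⟦ degree G i ⟧                                            ≈⟨ length-sumᴸ (filterᵇ (adj G i) (allFin n)) ⟩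
      sumᴸ (λ _ → 1#) (filterᵇ (adj G i) (allFin n))            ≈⟨ sumᴸ-filter (adj G i) (λ _ → 1#) (allFin n) ⟩
      sumᴸ (λ j → if adj G i j then 1# else 0#) (allFin n)      ≈⟨ sumᴸ-tabulate (λ j → if adj G i j then 1# else 0#) (λ j → j) ⟩
      sum (A G i)                                               ∎

    source target : Fin (numEdges G) → Fin n
    source e = proj₁ (lookup (edges G) e)
    target e = proj₂ (lookup (edges G) e)

    -- An edge is listed in one orientation only. Adding g in both orientations yields the sum over
    -- all ordered pairs of adjacent vertices.
    sum-edges : (g : Fin n → Fin n → Carrier) →
      (sum λ e → g (source e) (target e) + g (target e) (source e)) ≈ (sum λ u → sum λ v → A G u v * g u v)
    sum-edges g = begin
      (sum λ e → h (lookup (edges G) e))                        ≈⟨ sumᴸ-lookup h (edges G) ⟩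
      sumᴸ h (edges G)                                          ≈⟨ sumᴸ-filter isEdge h (cartesianProduct (allFin n) (allFin n)) ⟩
      sumᴸ k (cartesianProduct (allFin n) (allFin n))           ≈⟨ sumᴸ-cartesianProduct k (allFin n) (allFin n) ⟩
      sumᴸ (λ u → sumᴸ (λ v → k (u , v)) (allFin n)) (allFin n) ≈⟨ sumᴸ-tabulate (λ u → sumᴸ (λ v → k (u , v)) (allFin n)) (λ u → u) ⟩
      (sum λ u → sumᴸ (λ v → k (u , v)) (allFin n))             ≈⟨ sum-cong (λ u → sumᴸ-tabulate (λ v → k (u , v)) (λ v → v)) ⟩
      (sum λ u → sum λ v → k (u , v))                           ≈⟨ sum₂-cong weight ⟩
      (sum λ u → sum λ v → if does (u <? v) then f u v + f v u else 0#)
                                                                ≈⟨ sum-triangle f (λ u → trans (*-congʳ (A-irrefl G u)) (zeroˡ (g u u))) ⟩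
      (sum λ u → sum λ v → f u v)                               ∎
      where
      isEdge : Fin n × Fin n → Bool
      isEdge (u , v) = does (u <? v) ∧ adj G u v
      h k : Fin n × Fin n → Carrier
      h (u , v) = g u v + g v u
      k x = if isEdge x then h x else 0#
      f : Matrix n
      f u v = A G u v * g u v
      weight : ∀ u v → k (u , v) ≈ (if does (u <? v) then f u v + f v u else 0#)
      weight u v with does (u <? v)
      ... | false = refl
      ... | true rewrite adj-sym G v u with adj G u v
      ...   | true  = sym (+-cong (*-identityˡ _) (*-identityˡ _))
      ...   | false = sym (trans (+-cong (zeroˡ _) (zeroˡ _)) (+-identityˡ 0#))

    -- Listed pairs have passed a filter that tests adjacency, and `adj` is irreflexive.
    source≢target : ∀ e → source e ≢ target e
    source≢target e eq = ≡.subst Bool.T (≡.trans (≡.cong (adj G (source e)) (≡.sym eq)) (adj-irrefl G (source e)))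
      (proj₂ (Equivalence.to (T-∧ {does (source e <? target e)})
        (All.lookup (all-filter (λ uv → T? (does (proj₁ uv <? proj₂ uv) ∧ adj G (proj₁ uv) (proj₂ uv)))
                                (cartesianProduct (allFin n) (allFin n)))
                    (∈-lookup e))))

    B : Fin n → Fin (numEdges G) → Carrier
    B x e = if endpoint G x e then 1# else 0#

    -- The two ends are distinct, so the Boolean disjunction in `endpoint` becomes a genuine sum.
    B-δ : ∀ x e → B x e ≈ δ x (source e) + δ x (target e)
    B-δ x e with x ≟ source e | x ≟ target e
    ... | yes x≡s | yes x≡t = contradiction (≡.trans (≡.sym x≡s) x≡t) (source≢target e)
    ... | yes _   | no _    = sym (+-identityʳ 1#)
    ... | no _    | yes _   = sym (+-identityˡ 1#)
    ... | no _    | no _    = sym (+-identityˡ 0#)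

    B-columnSum : ∀ e → (sum λ x → B x e) ≈ 1# + 1#
    B-columnSum e = begin
      (sum λ x → B x e)                                                ≈⟨ sum-cong (λ x → B-δ x e) ⟩
      (sum λ x → δ x (source e) + δ x (target e))                      ≈⟨ ∑-distrib-+ (λ x → δ x (source e)) (λ x → δ x (target e)) ⟩
      (sum λ x → δ x (source e)) + (sum λ x → δ x (target e))          ≈⟨ +-cong (total (source e)) (total (target e)) ⟩
      1# + 1#                                                          ∎
      where
      total : ∀ u → (sum λ x → δ x u) ≈ 1#
      total u = trans (sum-cong λ x → sym (*-identityˡ (δ x u))) (sum-δʳ u (λ _ → 1#))

    sum-A-δ : ∀ x (f : Fin n → Fin n → Carrier) → (sum λ u → sum λ v → A G u v * (δ x u * f u v)) ≈ (sum λ v → A G x v * f x v)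
    sum-A-δ x f = begin
      (sum λ u → sum λ v → A G u v * (δ x u * f u v))
        ≈⟨ sum-cong (λ u → trans (sum-cong λ v → solve 3 (λ a d f → a :* (d :* f) := d :* (a :* f)) refl (A G u v) (δ x u) (f u v))
                                 (sym (*-distribˡ-sum (δ x u) (λ v → A G u v * f u v)))) ⟩
      (sum λ u → δ x u * (sum λ v → A G u v * f u v))                    ≈⟨ sum-δˡ x (λ u → sum λ v → A G u v * f u v) ⟩
      (sum λ v → A G x v * f x v)                                        ∎

    B-rowSum : ∀ x → sum (B x) ≈ π G x
    B-rowSum x = begin
      sum (B x)                                             ≈⟨ sum-cong (B-δ x) ⟩
      (sum λ e → δ x (source e) + δ x (target e))           ≈⟨ sum-edges (λ u v → δ x u) ⟩
      (sum λ u → sum λ v → A G u v * δ x u)                 ≈⟨ sum₂-cong (λ u v → *-congˡ {A G u v} (sym (*-identityʳ (δ x u)))) ⟩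
      (sum λ u → sum λ v → A G u v * (δ x u * 1#))          ≈⟨ sum-A-δ x (λ _ _ → 1#) ⟩
      (sum λ v → A G x v * 1#)                              ≈⟨ sum-cong (λ v → *-identityʳ (A G x v)) ⟩
      sum (A G x)                                           ≈⟨ degree-sum x ⟨
      π G x                                                 ∎

    D-δ : ∀ x y → D G x y ≈ δ x y * π G x
    D-δ x y with does (x ≟ y)
    ... | true  = sym (*-identityˡ _)
    ... | false = sym (zeroˡ _)

    -- With g u v = δ x u (δ y u + δ y v), the product of the two incidences at an edge is g in one
    -- orientation plus g in the other, so `sum-edges` applies. The summand with u = y yields D, the
    -- one with v = y yields A.
    BBᵀ : ∀ x y → (sum λ e → B x e * B y e) ≈ D G x y + A G x y
    BBᵀ x y = begin
      (sum λ e → B x e * B y e)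
        ≈⟨ sum-cong (λ e → trans (*-cong (B-δ x e) (B-δ y e))
             (solve 4 (λ a b c d → (a :+ b) :* (c :+ d) := a :* (c :+ d) :+ b :* (d :+ c)) refl
               (δ x (source e)) (δ x (target e)) (δ y (source e)) (δ y (target e)))) ⟩
      (sum λ e → g (source e) (target e) + g (target e) (source e))     ≈⟨ sum-edges g ⟩
      (sum λ u → sum λ v → A G u v * (δ x u * (δ y u + δ y v)))         ≈⟨ sum-A-δ x (λ u v → δ y u + δ y v) ⟩
      (sum λ v → A G x v * (δ y x + δ y v))
        ≈⟨ sum-cong (λ v → solve 3 (λ a d e → a :* (d :+ e) := d :* a :+ e :* a) refl (A G x v) (δ y x) (δ y v)) ⟩
      (sum λ v → δ y x * A G x v + δ y v * A G x v)                     ≈⟨ ∑-distrib-+ (λ v → δ y x * A G x v) (λ v → δ y v * A G x v) ⟩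
      (sum λ v → δ y x * A G x v) + (sum λ v → δ y v * A G x v)
        ≈⟨ +-cong (sym (*-distribˡ-sum (δ y x) (A G x))) (sum-δˡ y (A G x)) ⟩
      δ y x * sum (A G x) + A G x y                                     ≈⟨ +-congʳ (*-cong (δ-sym x y) (degree-sum x)) ⟨
      δ x y * π G x + A G x y                                           ≈⟨ +-congʳ (D-δ x y) ⟨
      D G x y + A G x y                                                 ∎
      where
      g : Fin n → Fin n → Carrier
      g u v = δ x u * (δ y u + δ y v)

-- Polynomial functions and their first-order expansion at 0.

module Jets {c ℓ₁ ℓ₂ : Level} (K : HeytingField c ℓ₁ ℓ₂) (char0 : CharacteristicZero K) where

  open Scalars K char0
  open Determinant K char0
  open Positivity K char0
  open Exp (CommutativeRing.commutativeSemiring commutativeRing) using (^-distrib-*)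

  private variable
    n m : ℕ
    f g : Carrier → Carrier
    a b a′ b′ : Carrier

  -- Horner form with `n` coefficients. The leading one may vanish, so `n` only bounds the degree
  -- and no zero test is ever called for.
  Poly : ℕ → (Carrier → Carrier) → Set (c ⊔ ℓ₁)
  Poly zero    f = Lift (c ⊔ ℓ₁) (∀ t → f t ≈ 0#)
  Poly (suc n) f = Σ[ a ∈ Carrier ] Σ[ g ∈ (Carrier → Carrier) ] Poly n g × (∀ t → f t ≈ a + t * g t)

  poly-+ : ∀ n m → Poly n f → Poly m g → Poly (n ℕ.⊔ m) (λ t → f t + g t)
  poly-+ zero zero (lift f≈0) (lift g≈0) = lift λ t → trans (+-cong (f≈0 t) (g≈0 t)) (+-identityˡ 0#)
  poly-+ zero (suc m) (lift f≈0) (b , q , q-poly , g≈) =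
    b , q , q-poly , λ t → trans (+-cong (f≈0 t) (g≈ t)) (+-identityˡ _)
  poly-+ (suc n) zero (a , p , p-poly , f≈) (lift g≈0) =
    a , p , p-poly , λ t → trans (+-cong (f≈ t) (g≈0 t)) (+-identityʳ _)
  poly-+ (suc n) (suc m) (a , p , p-poly , f≈) (b , q , q-poly , g≈) =
    a + b , (λ t → p t + q t) , poly-+ n m p-poly q-poly , λ t → trans (+-cong (f≈ t) (g≈ t))
      (solve 5 (λ a b t p q → a :+ t :* p :+ (b :+ t :* q) := a :+ b :+ t :* (p :+ q)) refl a b t (p t) (q t))

  poly-scale : ∀ n s → Poly n f → Poly n (λ t → s * f t)
  poly-scale zero    s (lift f≈0) = lift λ t → trans (*-congˡ (f≈0 t)) (x*0≈0 s)
  poly-scale (suc n) s (a , p , p-poly , f≈) = s * a , (λ t → s * p t) , poly-scale n s p-poly , λ t →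
    trans (*-congˡ (f≈ t)) (solve 4 (λ s a t p → s :* (a :+ t :* p) := s :* a :+ t :* (s :* p)) refl s a t (p t))

  poly-dilate : ∀ n s → Poly n f → Poly n (λ t → f (s * t))
  poly-dilate zero    s (lift f≈0) = lift λ t → f≈0 (s * t)
  poly-dilate (suc n) s (a , p , p-poly , f≈) =
    a , (λ t → s * p (s * t)) , poly-scale n s (poly-dilate n s p-poly) , λ t →
    trans (f≈ (s * t)) (solve 4 (λ s a t p → a :+ s :* t :* p := a :+ t :* (s :* p)) refl s a t (p (s * t)))

  poly-shift : ∀ n → Poly n f → Poly (suc n) (λ t → t * f t)
  poly-shift {f} n p = 0# , f , p , λ t → sym (+-identityˡ _)

  ∃Poly : (Carrier → Carrier) → Set (c ⊔ ℓ₁)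
  ∃Poly f = ∃[ n ] Poly n f

  poly-* : ∀ n → Poly n f → ∃Poly g → ∃Poly (λ t → f t * g t)
  poly-* zero    (lift f≈0) _ = 0 , lift λ t → trans (*-congʳ (f≈0 t)) (zeroˡ _)
  poly-* {f} {g} (suc n) (a , p , p-poly , f≈) (m , g-poly) = product-rule (poly-* n p-poly (m , g-poly))
    where
    product-rule : ∃Poly (λ t → p t * g t) → ∃Poly (λ t → f t * g t)
    product-rule (k , pg-poly) = m ℕ.⊔ suc k , poly-cong (m ℕ.⊔ suc k)
      (λ t → sym (trans (*-congʳ (f≈ t)) (solve 4 (λ a t p g → (a :+ t :* p) :* g := a :* g :+ t :* (p :* g)) refl a t (p t) (g t))))
      (poly-+ m (suc k) (poly-scale m a g-poly) (poly-shift k pg-poly))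
      where
      poly-cong : ∀ n {f g} → (∀ t → f t ≈ g t) → Poly n f → Poly n g
      poly-cong zero    f≈g (lift f≈0) = lift λ t → trans (sym (f≈g t)) (f≈0 t)
      poly-cong (suc n) f≈g (a , p , p-poly , f≈) = a , p , p-poly , λ t → trans (sym (f≈g t)) (f≈ t)

  Unit : Carrier → Set (c ⊔ ℓ₁)
  Unit t = ∃[ s ] t * s ≈ 1#

  pos⇒unit : Pos a → Unit a
  pos⇒unit a>0 = proj₁ (pos-inverse a>0) , proj₂ (proj₂ (pos-inverse a>0))

  unit-* : Unit a → Unit b → Unit (a * b)
  unit-* {a} {b} (x , ax≈1) (y , by≈1) = x * y ,
    trans (solve 4 (λ a b x y → a :* b :* (x :* y) := a :* x :* (b :* y)) refl a b x y)
          (trans (*-cong ax≈1 by≈1) (*-identityˡ 1#))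

  unit-cancel : Unit a → a * b ≈ a * b′ → b ≈ b′
  unit-cancel {a} {b} {b′} (x , ax≈1) ab≈ab′ = begin
    b               ≈⟨ restore b ⟩
    x * (a * b)     ≈⟨ *-congˡ ab≈ab′ ⟩
    x * (a * b′)    ≈⟨ restore b′ ⟨
    b′              ∎
    where
    restore : ∀ b → b ≈ x * (a * b)
    restore b = sym (trans (solve 3 (λ x a b → x :* (a :* b) := a :* x :* b) refl x a b) (trans (*-congʳ ax≈1) (*-identityˡ b)))

  two : Carrier
  two = 1# + 1#

  -- Up to sign, 2^(m+1) - 1 is the factor left at the constant term when a function is compared
  -- with its dilation by 2. It can be divided out because it is a positive integer.
  two^-1>0 : ∀ m → Pos (two ^ suc m - 1#)
  two^-1>0 zero    = pos-cong (solve 0 (con (+ 1) := con (+ 2) :* con (+ 1) :- con (+ 1)) refl) pos-1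
  two^-1>0 (suc m) = pos-cong (solve 1 (λ x → x :- con (+ 1) :+ (x :- con (+ 1)) :+ con (+ 1) := con (+ 2) :* x :- con (+ 1)) refl (two ^ suc m))
    (pos-+ (pos-+ (two^-1>0 m) (two^-1>0 m)) pos-1)

  -- h(t) = a + t^(m+1) g(t) vanishes on units; h(2t) - 2^(m+1) h(t) has the same
  -- shape with m + 1 for m and a polynomial of lower degree for g.
  constant-vanishes : ∀ n m → Poly n g → (∀ t → Unit t → a + t ^ suc m * g t ≈ 0#) → a ≈ 0#
  constant-vanishes {g} {a} zero m (lift g≈0) h≈0 = begin
    a                           ≈⟨ solve 2 (λ a s → a := a :+ s :* con (+ 0)) refl a (1# ^ suc m) ⟩
    a + 1# ^ suc m * 0#         ≈⟨ +-congˡ (*-congˡ (g≈0 1#)) ⟨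
    a + 1# ^ suc m * g 1#       ≈⟨ h≈0 1# (1# , *-identityˡ 1#) ⟩
    0#                          ∎
  constant-vanishes {g} {a} (suc n) m (g₀ , p , p-poly , g≈) h≈0 =
    unit-cancel (pos⇒unit (two^-1>0 m)) (begin
      (T - 1#) * a       ≈⟨ solve 2 (λ T a → (T :- con (+ 1)) :* a := :- ((con (+ 1) :- T) :* a)) refl T a ⟩
      - ((1# - T) * a)   ≈⟨ -‿cong (constant-vanishes n (suc m) q-poly q≈) ⟩
      - 0#               ≈⟨ solve 1 (λ x → :- con (+ 0) := x :* con (+ 0)) refl (T - 1#) ⟩
      (T - 1#) * 0#      ∎)
    where
    T = two ^ suc m
    q : Carrier → Carrier
    q t = T * (two * p (two * t)) + T * (- 1# * p t)
    q-poly : Poly n q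
    q-poly = ≡.subst (λ k → Poly k q) (ℕₚ.⊔-idem n)
      (poly-+ n n (poly-scale n T (poly-scale n two (poly-dilate n two p-poly))) (poly-scale n T (poly-scale n (- 1#) p-poly)))
    q≈ : ∀ t → Unit t → (1# - T) * a + t ^ suc (suc m) * q t ≈ 0#
    q≈ t t-unit = begin
      (1# - T) * a + t * s * (T * (two * P₂) + T * (- 1# * P))
        ≈⟨ solve 7 (λ T a t s P₂ P g₀ → (con (+ 1) :- T) :* a :+ t :* s :* (T :* (con (+ 2) :* P₂) :+ T :* (:- con (+ 1) :* P))
             := (a :+ T :* s :* (g₀ :+ con (+ 2) :* t :* P₂)) :- T :* (a :+ s :* (g₀ :+ t :* P))) refl T a t s P₂ P g₀ ⟩
      (a + T * s * (g₀ + two * t * P₂)) - T * (a + s * (g₀ + t * P))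
        ≈⟨ +-cong (+-congˡ (*-cong (^-distrib-* two t (suc m)) (g≈ (two * t)))) (-‿cong (*-congˡ (+-congˡ (*-congˡ (g≈ t))))) ⟨
      (a + (two * t) ^ suc m * g (two * t)) - T * (a + s * g t)
        ≈⟨ +-cong (h≈0 (two * t) (unit-* (pos⇒unit (pos-+ pos-1 pos-1)) t-unit)) (-‿cong (*-congˡ (h≈0 t t-unit))) ⟩
      0# - T * 0#       ≈⟨ solve 1 (λ T → con (+ 0) :- T :* con (+ 0) := con (+ 0)) refl T ⟩
      0#                ∎
      where
      s  = t ^ suc m
      P₂ = p (two * t)
      P  = p t

  -- `a` and `b` are the value and the derivative of f at 0. Polynomiality of the remainder is what
  -- lets the values of f determine `b`.
  Jet : (Carrier → Carrier) → Carrier → Carrier → Set (c ⊔ ℓ₁)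
  Jet f a b = Σ[ g ∈ (Carrier → Carrier) ] ∃Poly g × (∀ t → f t ≈ a + t * (b + t * g t))

  jet-cong : (∀ t → f t ≈ g t) → a ≈ a′ → b ≈ b′ → Jet f a b → Jet g a′ b′
  jet-cong f≈g a≈a′ b≈b′ (p , p-poly , f≈) = p , p-poly , λ t →
    trans (sym (f≈g t)) (trans (f≈ t) (+-cong a≈a′ (*-congˡ (+-congʳ b≈b′))))

  jet-affine : ∀ a b → Jet (λ t → a + t * b) a b
  jet-affine a b = (λ _ → 0#) , (0 , lift λ _ → refl) , λ t →
    solve 3 (λ a b t → a :+ t :* b := a :+ t :* (b :+ t :* con (+ 0))) refl a b t

  jet-+ : Jet f a b → Jet g a′ b′ → Jet (λ t → f t + g t) (a + a′) (b + b′)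
  jet-+ {a = a} {b} {a′ = a′} {b′} (p , (n , p-poly) , f≈) (q , (m , q-poly) , g≈) =
    (λ t → p t + q t) , (n ℕ.⊔ m , poly-+ n m p-poly q-poly) , λ t → trans (+-cong (f≈ t) (g≈ t))
      (solve 7 (λ a b a′ b′ t p q → a :+ t :* (b :+ t :* p) :+ (a′ :+ t :* (b′ :+ t :* q)) :=
        a :+ a′ :+ t :* (b :+ b′ :+ t :* (p :+ q))) refl a b a′ b′ t (p t) (q t))

  jet-* : Jet f a b → Jet g a′ b′ → Jet (λ t → f t * g t) (a * a′) (a * b′ + b * a′)
  jet-* {a = a} {b} {a′ = a′} {b′} (p , (n , p-poly) , f≈) (q , (m , q-poly) , g≈) =
    remainder , remainder-poly (poly-* (suc n) (b , p , p-poly , λ _ → refl) (suc m , b′ , q , q-poly , λ _ → refl)) , λ t →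
    trans (*-cong (f≈ t) (g≈ t))
      (solve 7 (λ a b a′ b′ t p q → (a :+ t :* (b :+ t :* p)) :* (a′ :+ t :* (b′ :+ t :* q)) :=
        a :* a′ :+ t :* (a :* b′ :+ b :* a′ :+ t :* (a :* q :+ a′ :* p :+ (b :+ t :* p) :* (b′ :+ t :* q)))) refl
        a b a′ b′ t (p t) (q t))
    where
    remainder : Carrier → Carrier
    remainder t = a * q t + a′ * p t + (b + t * p t) * (b′ + t * q t)
    remainder-poly : ∃Poly (λ t → (b + t * p t) * (b′ + t * q t)) → ∃Poly remainder
    remainder-poly (k , r-poly) = _ , poly-+ (m ℕ.⊔ n) k (poly-+ m n (poly-scale m a q-poly) (poly-scale n a′ p-poly)) r-poly

  jet-sum : {F : Fin n → Carrier → Carrier} {a b : Vect n} → (∀ i → Jet (F i) (a i) (b i)) →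
            Jet (λ t → sum λ i → F i t) (sum a) (sum b)
  jet-sum {zero}  jets = jet-cong (λ t → solve 1 (λ t → con (+ 0) :+ t :* con (+ 0) := con (+ 0)) refl t) refl refl (jet-affine 0# 0#)
  jet-sum {suc n} jets = jet-+ (jets zero) (jet-sum (jets ∘ suc))

  jet-constant-unique : Jet f a b → Jet f a′ b′ → a ≈ a′
  jet-constant-unique {f} {a} {b} {a′} {b′} (p , _ , f≈) (q , _ , f≈′) =
    trans (at-zero a b p) (trans (sym (f≈ 0#)) (trans (f≈′ 0#) (sym (at-zero a′ b′ q))))
    where
    at-zero : ∀ a b (p : Carrier → Carrier) → a ≈ a + 0# * (b + 0# * p 0#)
    at-zero a b p = sym (trans (+-congˡ (zeroˡ _)) (+-identityʳ a))

  -- The difference of the two expansions is t times (b - b′) + t (p - q). The factor t can be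
  -- cancelled for invertible t only, and `constant-vanishes` asks for just those.
  jet-linear-unique : Jet f a b → Jet f a′ b′ → b ≈ b′
  jet-linear-unique {f} {a} {b} {a′} {b′} j@(p , (n , p-poly) , f≈) j′@(q , (m , q-poly) , f≈′) = begin
    b                ≈⟨ solve 2 (λ b b′ → b := b :- b′ :+ b′) refl b b′ ⟩
    b - b′ + b′      ≈⟨ +-congʳ (constant-vanishes _ 0 (poly-+ n m p-poly (poly-scale m (- 1#) q-poly)) difference) ⟩
    0# + b′          ≈⟨ +-identityˡ b′ ⟩
    b′               ∎
    where
    difference : ∀ t → Unit t → b - b′ + t ^ 1 * (p t + - 1# * q t) ≈ 0#
    difference t t-unit = unit-cancel t-unit (begin
      t * (b - b′ + t * 1# * (p t + - 1# * q t))
        ≈⟨ solve 6 (λ t b b′ p q a → t :* (b :- b′ :+ t :* con (+ 1) :* (p :+ :- con (+ 1) :* q)) :=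
             (a :+ t :* (b :+ t :* p)) :- (a :+ t :* (b′ :+ t :* q))) refl t b b′ (p t) (q t) a ⟩
      (a + t * (b + t * p t)) - (a + t * (b′ + t * q t))
        ≈⟨ +-congˡ (-‿cong (+-congʳ (jet-constant-unique j j′))) ⟩
      (a + t * (b + t * p t)) - (a′ + t * (b′ + t * q t))       ≈⟨ +-cong (f≈ t) (-‿cong (f≈′ t)) ⟨
      f t - f t                                                 ≈⟨ solve 2 (λ x t → x :- x := t :* con (+ 0)) refl (f t) t ⟩
      t * 0#                                                    ∎)

  -- The product rule, with the factor missing from each summand restored by multiplying with νᵢ
  -- νᵢ⁻¹ = 1.
  jet-product : (ν ν⁻¹ : Vect n) → (∀ i → ν i * ν⁻¹ i ≈ 1#) →
                Jet (λ t → product λ i → ν i + t) (product ν) (product ν * sum ν⁻¹)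
  jet-product {zero}  ν ν⁻¹ inv = jet-cong (λ t → solve 1 (λ t → con (+ 1) :+ t :* con (+ 0) := con (+ 1)) refl t)
    refl (solve 0 (con (+ 0) := con (+ 1) :* con (+ 0)) refl) (jet-affine 1# 0#)
  jet-product {suc n} ν ν⁻¹ inv = jet-cong (λ t → *-congʳ (+-congˡ (*-identityʳ t))) refl (begin
      ν₀ * (P * S) + 1# * P             ≈⟨ +-congˡ (*-congʳ (inv zero)) ⟨
      ν₀ * (P * S) + ν₀ * i₀ * P        ≈⟨ solve 4 (λ ν P S i → ν :* (P :* S) :+ ν :* i :* P := ν :* P :* (i :+ S)) refl ν₀ P S i₀ ⟩
      ν₀ * P * (i₀ + S)                 ∎)
    (jet-* (jet-affine ν₀ 1#) (jet-product (ν ∘ suc) (ν⁻¹ ∘ suc) (inv ∘ suc)))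
    where
    ν₀ = ν zero
    i₀ = ν⁻¹ zero
    P  = product (ν ∘ suc)
    S  = sum (ν⁻¹ ∘ suc)

  minor-≔ : (M : Matrix (suc n)) (l : Fin (suc n)) (j : Fin n) (v : Vect (suc n)) →
            ∀ i k → (minor M l [ j ≔ v ∘ suc ]) i k ≈ minor (M [ punchIn l j ≔ v ]) l i k
  minor-≔ M l j v i k with k ≟ j
  ... | yes ≡.refl = sym (≔-hit M (punchIn l j) v (suc i))
  ... | no k≢j     = sym (≔-miss M v (suc i) (k≢j ∘ punchIn-injective l k j))

  -- The derivative of a determinant, one column at a time. In the expansion along the first row,
  -- differentiating the entry in column l gives the summand j = l, and differentiating its minor
  -- gives, by induction, the summands j ≠ l.
  jet-det : (M P : Matrix n) →
            Jet (λ t → det λ i j → M i j + t * P i j) (det M) (sum λ j → det (M [ j ≔ (λ r → P r j) ]))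
  jet-det {zero}  M P = jet-cong (λ t → solve 1 (λ t → con (+ 1) :+ t :* con (+ 0) := con (+ 1)) refl t) refl refl (jet-affine 1# 0#)
  jet-det {suc n} M P = jet-cong (λ _ → refl) refl (begin
      (sum λ l → s l * M zero l * Σ′ l + s l * P zero l * det (minor M l))          ≈⟨ sum-cong row ⟩
      (sum λ l → sum λ j → s l * N j zero l * det (minor (N j) l))                  ≈⟨ ∑-comm (λ l j → s l * N j zero l * det (minor (N j) l)) ⟩
      (sum λ j → det (N j))                                                         ∎)
    (jet-sum λ l → jet-* (jet-cong (λ t → solve 4 (λ s m t p → s :* m :+ t :* (s :* p) := s :* (m :+ t :* p)) refl (s l) (M zero l) t (P zero l))
                            refl refl (jet-affine (s l * M zero l) (s l * P zero l)))
                         (jet-det (minor M l) (minor P l)))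
    where
    s : Fin (suc n) → Carrier
    s l = (- 1#) ^ toℕ l
    N : Fin (suc n) → Matrix (suc n)
    N j = M [ j ≔ (λ r → P r j) ]
    Σ′ : Fin (suc n) → Carrier
    Σ′ l = sum λ j → det (minor M l [ j ≔ (λ r → minor P l r j) ])
    row : ∀ l → s l * M zero l * Σ′ l + s l * P zero l * det (minor M l) ≈ (sum λ j → s l * N j zero l * det (minor (N j) l))
    row l = begin
      s l * M zero l * Σ′ l + s l * P zero l * det (minor M l)
        ≈⟨ +-comm _ _ ⟩
      s l * P zero l * det (minor M l) + s l * M zero l * Σ′ l
        ≈⟨ +-cong (*-cong (*-congˡ (sym (≔-hit M l (λ r → P r l) zero)))
                    (det-cong λ i k → sym (≔-miss M (λ r → P r l) (suc i) (punchInᵢ≢i l k))))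
                  (trans (*-distribˡ-sum (s l * M zero l) (λ j → det (minor M l [ j ≔ (λ r → minor P l r j) ])))
                    (sum-cong λ j → *-cong (*-congˡ (sym (≔-miss M (λ r → P r (punchIn l j)) zero (punchInᵢ≢i l j ∘ ≡.sym))))
                      (det-cong (minor-≔ M l j (λ r → P r (punchIn l j)))))) ⟩
      u l + sum (u ∘ punchIn l)
        ≈⟨ sum-remove {i = l} u ⟨
      sum u ∎
      where
      u : Vect (suc n)
      u j = s l * N j zero l * det (minor (N j) l)

-- The inverse of Q and its trace in terms of the spectrum.

module Spectrum {c ℓ₁ ℓ₂ : Level} (K : HeytingField c ℓ₁ ℓ₂) (char0 : CharacteristicZero K) where

  open Scalars K char0
  open Determinant K char0
  open Positivity K char0
  open Elimination K char0
  open Resistance K char0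
  open Incidence K char0
  open Jets K char0

  private variable n : ℕ

  sum-δ-column : ∀ (j : Fin n) → (sum λ i → δ i j) ≈ 1#
  sum-δ-column j = trans (sum-cong λ i → sym (*-identityˡ (δ i j))) (sum-δʳ j (λ _ → 1#))

  sum-δ-row : ∀ (i : Fin n) → sum (δ i) ≈ 1#
  sum-δ-row i = trans (sum-cong λ j → sym (*-identityʳ (δ i j))) (sum-δˡ i (λ _ → 1#))

  ⊗-assoc : (M N P : Matrix n) → ∀ i j → (M ⊗ N ⊗ P) i j ≈ (M ⊗ (N ⊗ P)) i j
  ⊗-assoc M N P i j = begin
    (sum λ k → (sum λ l → M i l * N l k) * P k j)     ≈⟨ sum-cong (λ k → *-distribʳ-sum (P k j) (λ l → M i l * N l k)) ⟩
    (sum λ k → sum λ l → M i l * N l k * P k j)       ≈⟨ ∑-comm (λ k l → M i l * N l k * P k j) ⟩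
    (sum λ l → sum λ k → M i l * N l k * P k j)       ≈⟨ sum₂-cong (λ l k → *-assoc (M i l) (N l k) (P k j)) ⟩
    (sum λ l → sum λ k → M i l * (N l k * P k j))     ≈⟨ sum-cong (λ l → *-distribˡ-sum (M i l) (λ k → N l k * P k j)) ⟨
    (sum λ l → M i l * (sum λ k → N l k * P k j))     ∎

  -- From Mᵀ = M one gets Nᵀ M = I, hence Nᵀ = Nᵀ M N = N and N M = I.
  symmetric-rightInverse⇒inverse : (M N : Matrix n) → (∀ i j → M i j ≈ M j i) →
                                   (∀ i j → (M ⊗ N) i j ≈ δ i j) → IsInverse M N
  symmetric-rightInverse⇒inverse M N M-sym MN≈I = MN≈I , λ i j → begin
    (sum λ k → N i k * M k j)      ≈⟨ sum-cong (λ k → *-congʳ (N-sym i k)) ⟩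
    (sum λ k → N k i * M k j)      ≈⟨ NᵀM≈I i j ⟩
    δ i j                          ∎
    where
    NᵀM≈I : ∀ i j → (sum λ k → N k i * M k j) ≈ δ i j
    NᵀM≈I i j = begin
      (sum λ k → N k i * M k j)      ≈⟨ sum-cong (λ k → trans (*-comm (N k i) (M k j)) (*-congʳ (M-sym k j))) ⟩
      (sum λ k → M j k * N k i)      ≈⟨ MN≈I j i ⟩
      δ j i                          ≈⟨ δ-sym j i ⟩
      δ i j                          ∎
    N-sym : ∀ i j → N i j ≈ N j i
    N-sym i j = begin
      N i j                                                ≈⟨ sum-δˡ i (λ k → N k j) ⟨
      (sum λ k → δ i k * N k j)                            ≈⟨ sum-cong (λ k → *-congʳ (NᵀM≈I i k)) ⟨
      ((λ i k → N k i) ⊗ M ⊗ N) i j                        ≈⟨ ⊗-assoc (λ i k → N k i) M N i j ⟩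
      (sum λ k → N k i * (M ⊗ N) k j)                      ≈⟨ sum-cong (λ k → *-congˡ (MN≈I k j)) ⟩
      (sum λ k → N k i * δ k j)                            ≈⟨ sum-δʳ j (λ k → N k i) ⟩
      N j i                                                ∎

  product-cong : {f g : Vect n} → (∀ i → f i ≈ g i) → product f ≈ product g
  product-cong {zero}  f≈g = refl
  product-cong {suc n} f≈g = *-cong (f≈g zero) (product-cong (f≈g ∘ suc))

  product-unit⇒factor-unit : (ν : Vect n) → Unit (product ν) → ∀ i → Unit (ν i)
  product-unit⇒factor-unit ν (y , Py≈1) zero    = product (ν ∘ suc) * y , trans (sym (*-assoc _ _ _)) Py≈1
  product-unit⇒factor-unit ν (y , Py≈1) (suc i) = product-unit⇒factor-unit (ν ∘ suc)
    (ν zero * y , trans (solve 3 (λ a P y → P :* (a :* y) := a :* P :* y) refl (ν zero) (product (ν ∘ suc)) y) Py≈1) i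

  module _ (G : Graph (Fin n)) where

    D-rowSum : ∀ i → sum (D G i) ≈ π G i
    D-rowSum i = begin
      sum (D G i)                    ≈⟨ sum-cong (λ j → D-δ G i j) ⟩
      (sum λ j → δ i j * π G i)      ≈⟨ sum-δˡ i (λ _ → π G i) ⟩
      π G i                          ∎

    Q-rowSum : ∀ i → sum (Q G i) ≈ ⟦ 2 ⟧
    Q-rowSum i = begin
      (sum λ j → D G i j - A G i j + ⟦ 2 ⟧ * δ i j)
        ≈⟨ ∑-distrib-+ (λ j → D G i j - A G i j) (λ j → ⟦ 2 ⟧ * δ i j) ⟩
      (sum λ j → D G i j - A G i j) + (sum λ j → ⟦ 2 ⟧ * δ i j)
        ≈⟨ +-cong (trans (sum-sub (D G i) (A G i)) (+-cong (D-rowSum i) (-‿cong (sym (degree-sum G i)))))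
                  (trans (sym (*-distribˡ-sum ⟦ 2 ⟧ (δ i))) (*-congˡ (sum-δ-row i))) ⟩
      π G i - π G i + ⟦ 2 ⟧ * 1#     ≈⟨ solve 2 (λ p t → p :- p :+ t :* con (+ 1) := t) refl (π G i) ⟦ 2 ⟧ ⟩
      ⟦ 2 ⟧                          ∎

    Q-sym : ∀ i j → Q G i j ≈ Q G j i
    Q-sym i j = +-cong (+-cong D-sym (-‿cong (A-sym G i j))) (*-congˡ (δ-sym i j))
      where
      D-sym : D G i j ≈ D G j i
      D-sym with i ≟ j
      ... | yes ≡.refl rewrite dec-true (i ≟ i) ≡.refl = refl
      ... | no i≢j     rewrite dec-false (j ≟ i) (i≢j ∘ ≡.sym) = refl

    -- In the sign convention of `Elimination` this is a network with conductances `A G` and leakage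
    -- 2 at every vertex.
    -Q : Matrix n
    -Q i j = - Q G i j

    -Q-nonNegOffDiagonal : NonNegOffDiagonal -Q
    -Q-nonNegOffDiagonal i j i≢j = nonNeg-cong (begin
      A G i j
        ≈⟨ solve 3 (λ a p t → a := :- (con (+ 0) :* p :- a :+ t :* con (+ 0))) refl (A G i j) (π G i) ⟦ 2 ⟧ ⟩
      - (0# * π G i - A G i j + ⟦ 2 ⟧ * 0#)
        ≈⟨ -‿cong (+-cong (+-congʳ (trans (D-δ G i j) (*-congʳ (δ-≢ i≢j)))) (*-congˡ (δ-≢ i≢j))) ⟨
      -Q i j ∎) (A-nonNeg G i j)

    -Q-leak : ∀ i → Pos (leak -Q i)
    -Q-leak i = pos-cong (begin
      1# + 1#               ≈⟨ +-congˡ (+-identityʳ 1#) ⟨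
      ⟦ 2 ⟧                 ≈⟨ Q-rowSum i ⟨
      sum (Q G i)           ≈⟨ solve 1 (λ s → s := :- :- s) refl (sum (Q G i)) ⟩
      - - sum (Q G i)       ≈⟨ -‿cong (sum-neg (Q G i)) ⟨
      leak -Q i             ∎) (pos-+ pos-1 pos-1)

    Q-inverse : ∃ (IsInverse (Q G))
    Q-inverse = R , symmetric-rightInverse⇒inverse (Q G) R Q-sym QR≈I
      where
      solution : ∀ j → Σ[ x ∈ Vect n ] ∀ i → (sum λ k → -Q i k * x k) ≈ δ i j
      solution j = solvable-strict -Q -Q-nonNegOffDiagonal -Q-leak (λ i → δ i j)
      R : Matrix n
      R i j = - proj₁ (solution j) i
      QR≈I : ∀ i j → (Q G ⊗ R) i j ≈ δ i j
      QR≈I i j = trans (sum-cong λ k → solve 2 (λ q x → q :* :- x := :- q :* x) refl (Q G i k) (proj₁ (solution j) k))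
                       (proj₂ (solution j) i)

    module _ (μ : Vect n) (spectrum : IsLaplacianSpectrum G μ) where

      shifted : Vect n
      shifted i = - (μ i + ⟦ 2 ⟧)

      -- The spectrum hypothesis at x = t - 2, because -Q + t I = (t - 2) I - L.
      characteristic : ∀ t → (det λ i j → -Q i j + t * δ i j) ≈ (product λ i → shifted i + t)
      characteristic t = begin
        (det λ i j → -Q i j + t * δ i j)
          ≈⟨ det-cong (λ i j → solve 4 (λ l w t d → :- (l :+ w :* d) :+ t :* d := (:- w :+ t) :* d :- l) refl (L G i j) ⟦ 2 ⟧ t (δ i j)) ⟩
        (det λ i j → (- ⟦ 2 ⟧ + t) * δ i j - L G i j)
          ≈⟨ spectrum (- ⟦ 2 ⟧ + t) ⟩
        (product λ i → - ⟦ 2 ⟧ + t - μ i)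
          ≈⟨ product-cong (λ i → solve 3 (λ w t m → :- w :+ t :- m := :- (m :+ w) :+ t) refl ⟦ 2 ⟧ t (μ i)) ⟩
        (product λ i → shifted i + t) ∎

      det[-Q] : det -Q ≈ product shifted
      det[-Q] = begin
        det -Q                                 ≈⟨ det-cong (λ i j → solve 2 (λ q d → q := q :+ con (+ 0) :* d) refl (-Q i j) (δ i j)) ⟩
        (det λ i j → -Q i j + 0# * δ i j)      ≈⟨ characteristic 0# ⟩
        (product λ i → shifted i + 0#)         ≈⟨ product-cong (λ i → +-identityʳ (shifted i)) ⟩
        product shifted                        ∎

      det[-Q]-unit : Unit (det -Q)
      det[-Q]-unit = det-invertible -Q -Q-nonNegOffDiagonal -Q-leak

      -- Without an order, μᵢ ≥ 0 cannot even be stated. Instead det(-Q), the product of all -(μᵢ +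
      -- 2), is invertible by elimination, hence so is each factor.
      μ+2#0 : ∀ i → (μ i + ⟦ 2 ⟧) # 0#
      μ+2#0 i = nonzero (product-unit⇒factor-unit shifted (proj₁ det[-Q]-unit , trans (*-congʳ (sym det[-Q])) (proj₂ det[-Q]-unit)) i)
        where
        nonzero : Unit (shifted i) → (μ i + ⟦ 2 ⟧) # 0#
        nonzero (y , sy≈1) = unit⇒# {y = - y} (trans (solve 2 (λ x y → x :* :- y := :- x :* y) refl (μ i + ⟦ 2 ⟧) y) sy≈1)

      -- The linear coefficient of det(-Q + t I) is computed twice. As a determinant it is the sum
      -- of det(-Q) with column j replaced by e_j, which is -R j j det(-Q) by Cramer's rule; as a
      -- product it is det(-Q) times the sum of -1/(μᵢ + 2).
      tr-Q⁻¹ : ∀ R → IsInverse (Q G) R → tr R ≈ sum (λ i → 1/ (μ+2#0 i))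
      tr-Q⁻¹ R (QR≈I , _) = begin
        tr R                                 ≈⟨ solve 1 (λ x → x := :- :- x) refl (tr R) ⟩
        - - tr R                             ≈⟨ -‿cong (sum-neg (λ i → R i i)) ⟨
        - (sum λ i → - R i i)                ≈⟨ -‿cong (unit-cancel det[-Q]-unit traces) ⟩
        - (sum λ i → - 1/ (μ+2#0 i))         ≈⟨ -‿cong (sum-neg (λ i → 1/ (μ+2#0 i))) ⟩
        - - sum (λ i → 1/ (μ+2#0 i))         ≈⟨ solve 1 (λ x → :- :- x := x) refl (sum λ i → 1/ (μ+2#0 i)) ⟩
        sum (λ i → 1/ (μ+2#0 i))             ∎
        where
        inverse : ∀ i → shifted i * - 1/ (μ+2#0 i) ≈ 1#
        inverse i = trans (solve 2 (λ x y → :- x :* :- y := x :* y) refl (μ i + ⟦ 2 ⟧) (1/ (μ+2#0 i))) (*-1/ (μ+2#0 i))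
        traces : det -Q * (sum λ i → - R i i) ≈ det -Q * (sum λ i → - 1/ (μ+2#0 i))
        traces = begin
          det -Q * (sum λ i → - R i i)
            ≈⟨ trans (*-distribˡ-sum (det -Q) (λ i → - R i i)) (sum-cong λ i → *-comm (det -Q) (- R i i)) ⟩
          (sum λ j → - R j j * det -Q)
            ≈⟨ sum-cong (λ j → cramer -Q j (λ k → - R k j) (λ r → δ r j) λ r →
                 trans (sum-cong λ k → solve 2 (λ x y → :- x :* :- y := x :* y) refl (Q G r k) (R k j)) (QR≈I r j)) ⟨
          (sum λ j → det (-Q [ j ≔ (λ r → δ r j) ]))
            ≈⟨ jet-linear-unique (jet-cong characteristic refl refl (jet-det -Q δ))
                                 (jet-product shifted (λ i → - 1/ (μ+2#0 i)) inverse) ⟩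
          product shifted * (sum λ i → - 1/ (μ+2#0 i))        ≈⟨ *-congʳ det[-Q] ⟨
          det -Q * (sum λ i → - 1/ (μ+2#0 i))                 ∎

-- The grounded inverse on one copy of the subdivision graph.

module GroundedCopy {c ℓ₁ ℓ₂ : Level} (K : HeytingField c ℓ₁ ℓ₂) (char0 : CharacteristicZero K) where

  open Scalars K char0
  open Positivity K char0
  open Resistance K char0
  open Incidence K char0
  open Jets K char0 using (Unit; unit-cancel)
  open Spectrum K char0

  half : Carrier
  half = 1/ (char0 2)

  2*half : ⟦ 2 ⟧ * half ≈ 1#
  2*half = *-1/ (char0 2)

  2-unit : Unit ⟦ 2 ⟧
  2-unit = half , 2*half

  halve : ∀ {x} → ⟦ 2 ⟧ * x ≈ 1# → x ≈ half
  halve 2x≈1 = unit-cancel 2-unit (trans 2x≈1 (sym 2*half))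

  module _ {n : ℕ} (G : Graph (Fin n)) where

    private
      V = SubdivisionVertex G
      m = numEdges G

    sumˢ : (V → Carrier) → Carrier
    sumˢ f = (sum λ x → f (inj₁ x)) + (sum λ e → f (inj₂ e))

    δˢ : V → V → Carrier
    δˢ (inj₁ x) (inj₁ y) = δ x y
    δˢ (inj₂ e) (inj₂ f) = δ e f
    δˢ (inj₁ _) (inj₂ _) = 0#
    δˢ (inj₂ _) (inj₁ _) = 0#

    sumˢ-cong : {f g : V → Carrier} → (∀ s → f s ≈ g s) → sumˢ f ≈ sumˢ g
    sumˢ-cong f≈g = +-cong (sum-cong λ x → f≈g (inj₁ x)) (sum-cong λ e → f≈g (inj₂ e))

    sumˢ-+ : (f g : V → Carrier) → sumˢ (λ s → f s + g s) ≈ sumˢ f + sumˢ g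
    sumˢ-+ f g = trans (+-cong (∑-distrib-+ (λ x → f (inj₁ x)) (λ x → g (inj₁ x))) (∑-distrib-+ (λ e → f (inj₂ e)) (λ e → g (inj₂ e))))
      (solve 4 (λ a b c d → a :+ b :+ (c :+ d) := a :+ c :+ (b :+ d)) refl
        (sum λ x → f (inj₁ x)) (sum λ x → g (inj₁ x)) (sum λ e → f (inj₂ e)) (sum λ e → g (inj₂ e)))

    sumˢ-* : ∀ a (f : V → Carrier) → sumˢ (λ s → a * f s) ≈ a * sumˢ f
    sumˢ-* a f = trans (+-cong (sym (*-distribˡ-sum a (λ x → f (inj₁ x)))) (sym (*-distribˡ-sum a (λ e → f (inj₂ e)))))
                       (sym (distribˡ a _ _))

    sumˢ-sum : ∀ {k} (f : V → Vect k) → sumˢ (λ s → sum (f s)) ≈ (sum λ i → sumˢ λ s → f s i)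
    sumˢ-sum f = trans (+-cong (∑-comm (λ x → f (inj₁ x))) (∑-comm (λ e → f (inj₂ e))))
      (sym (∑-distrib-+ (λ i → sum λ x → f (inj₁ x) i) (λ i → sum λ e → f (inj₂ e) i)))

  -- T is the inverse of the Laplacian [[D + I, -B], [-Bᵀ, 2I]] of S(G) grounded at
  -- a vertex joined to all original vertices; its Schur complement is ½ Q.
  module _ {n : ℕ} (G : Graph (Fin n)) (R : Matrix n) (R-inverse : IsInverse (Q G) R) where

    private
      V = SubdivisionVertex G
      m = numEdges G

    RB : Fin n → Fin m → Carrier
    RB x e = sum λ z → R x z * B G z e

    T₁ : Fin n → V → Carrier
    T₁ x (inj₁ y) = ⟦ 2 ⟧ * R x y
    T₁ x (inj₂ e) = RB x e

    T : V → V → Carrier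
    T (inj₁ x) t = T₁ x t
    T (inj₂ e) t = half * (δˢ G (inj₂ e) t + (sum λ x → B G x e * T₁ x t))

    -- A row of Q = 2(I + D) - (D + A). With BBᵀ = D + A this says that I + D - ½ BBᵀ, obtained by
    -- eliminating the inserted vertices, is ½ Q.
    Q-half : ∀ x (a : Vect n) → (sum λ z → Q G x z * a z) ≈
             ⟦ 2 ⟧ * (1# + π G x) * a x - (sum λ z → (D G x z + A G x z) * a z)
    Q-half x a = begin
      (sum λ z → Q G x z * a z)
        ≈⟨ sum-cong (λ z → trans (*-congʳ (+-congʳ (+-congʳ (D-δ G x z))))
             (trans (solve 5 (λ d p q t a → (d :* p :- q :+ t :* d) :* a := d :* ((t :+ con (+ 2) :* p) :* a) :- (d :* p :+ q) :* a) refl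
                       (δ x z) (π G x) (A G x z) ⟦ 2 ⟧ (a z))
               (+-congˡ (-‿cong (*-congʳ (+-congʳ (sym (D-δ G x z)))))))) ⟩
      (sum λ z → δ x z * ((⟦ 2 ⟧ + two * π G x) * a z) - (D G x z + A G x z) * a z)
        ≈⟨ sum-sub (λ z → δ x z * ((⟦ 2 ⟧ + two * π G x) * a z)) (λ z → (D G x z + A G x z) * a z) ⟩
      (sum λ z → δ x z * ((⟦ 2 ⟧ + two * π G x) * a z)) - S
        ≈⟨ +-congʳ (sum-δˡ x (λ z → (⟦ 2 ⟧ + two * π G x) * a z)) ⟩
      (⟦ 2 ⟧ + two * π G x) * a x - S
        ≈⟨ solve 3 (λ p a S → ((con (+ 1) :+ (con (+ 1) :+ con (+ 0))) :+ con (+ 2) :* p) :* a :- S :=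
             (con (+ 1) :+ (con (+ 1) :+ con (+ 0))) :* (con (+ 1) :+ p) :* a :- S) refl (π G x) (a x) S ⟩
      ⟦ 2 ⟧ * (1# + π G x) * a x - S ∎
      where
      two = 1# + 1#
      S = sum λ z → (D G x z + A G x z) * a z

    BBᵀ-apply : ∀ x (a : Vect n) → (sum λ e → B G x e * (sum λ z → B G z e * a z)) ≈ (sum λ z → (D G x z + A G x z) * a z)
    BBᵀ-apply x a = begin
      (sum λ e → B G x e * (sum λ z → B G z e * a z))     ≈⟨ sum-cong (λ e → *-distribˡ-sum (B G x e) (λ z → B G z e * a z)) ⟩
      (sum λ e → sum λ z → B G x e * (B G z e * a z))     ≈⟨ ∑-comm (λ e z → B G x e * (B G z e * a z)) ⟩
      (sum λ z → sum λ e → B G x e * (B G z e * a z))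
        ≈⟨ sum-cong (λ z → trans (sum-cong λ e → sym (*-assoc (B G x e) (B G z e) (a z)))
                                 (sym (*-distribʳ-sum (a z) (λ e → B G x e * B G z e)))) ⟩
      (sum λ z → (sum λ e → B G x e * B G z e) * a z)     ≈⟨ sum-cong (λ z → *-congʳ (BBᵀ G x z)) ⟩
      (sum λ z → (D G x z + A G x z) * a z)               ∎

    -- Eliminating the inserted vertices and doubling leaves Q a = 2 d + B g for the potentials a at
    -- the original vertices, where d and g are the currents injected at original and inserted
    -- vertices. `T₁` solves this for unit currents.
    Q-T₁ : ∀ x t → (sum λ z → Q G x z * T₁ z t) ≈ ⟦ 2 ⟧ * δˢ G (inj₁ x) t + (sum λ e → B G x e * δˢ G (inj₂ e) t)
    Q-T₁ x (inj₁ y) = begin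
      (sum λ z → Q G x z * (⟦ 2 ⟧ * R z y))     ≈⟨ sum-cong (λ z → solve 3 (λ q t r → q :* (t :* r) := t :* (q :* r)) refl (Q G x z) ⟦ 2 ⟧ (R z y)) ⟩
      (sum λ z → ⟦ 2 ⟧ * (Q G x z * R z y))     ≈⟨ *-distribˡ-sum ⟦ 2 ⟧ (λ z → Q G x z * R z y) ⟨
      ⟦ 2 ⟧ * (Q G ⊗ R) x y                     ≈⟨ *-congˡ (proj₁ R-inverse x y) ⟩
      ⟦ 2 ⟧ * δ x y                             ≈⟨ +-identityʳ _ ⟨
      ⟦ 2 ⟧ * δ x y + 0#                        ≈⟨ +-congˡ (sum-zero (λ e → x*0≈0 (B G x e))) ⟨
      ⟦ 2 ⟧ * δ x y + (sum λ e → B G x e * 0#)  ∎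
    Q-T₁ x (inj₂ f) = begin
      (sum λ z → Q G x z * (sum λ w → R z w * B G w f))   ≈⟨ sum-cong (λ z → *-distribˡ-sum (Q G x z) (λ w → R z w * B G w f)) ⟩
      (sum λ z → sum λ w → Q G x z * (R z w * B G w f))   ≈⟨ ∑-comm (λ z w → Q G x z * (R z w * B G w f)) ⟩
      (sum λ w → sum λ z → Q G x z * (R z w * B G w f))
        ≈⟨ sum-cong (λ w → trans (sum-cong λ z → sym (*-assoc (Q G x z) (R z w) (B G w f)))
                                 (sym (*-distribʳ-sum (B G w f) (λ z → Q G x z * R z w)))) ⟩
      (sum λ w → (Q G ⊗ R) x w * B G w f)                 ≈⟨ sum-cong (λ w → *-congʳ (proj₁ R-inverse x w)) ⟩
      (sum λ w → δ x w * B G w f)                         ≈⟨ sum-δˡ x (λ w → B G w f) ⟩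
      B G x f                                             ≈⟨ sum-δʳ f (B G x) ⟨
      (sum λ e → B G x e * δ e f)                         ≈⟨ solve 2 (λ t s → s := t :* con (+ 0) :+ s) refl ⟦ 2 ⟧ _ ⟩
      ⟦ 2 ⟧ * 0# + (sum λ e → B G x e * δ e f)            ∎

    -- Substituting the rows of the inserted vertices turns the left side into ½ (Q T₁ - B g), which
    -- `Q-T₁` evaluates.
    T-original : ∀ x t → (1# + π G x) * T (inj₁ x) t - (sum λ e → B G x e * T (inj₂ e) t) ≈ δˢ G (inj₁ x) t
    T-original x t = begin
      p * a - (sum λ e → B G x e * (half * (g e + b e)))
        ≈⟨ +-congˡ (-‿cong (trans (sum-cong λ e → solve 4 (λ u h g b → u :* (h :* (g :+ b)) := h :* (u :* g :+ u :* b)) refl (B G x e) half (g e) (b e))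
             (trans (sym (*-distribˡ-sum half (λ e → B G x e * g e + B G x e * b e)))
               (*-congˡ (∑-distrib-+ (λ e → B G x e * g e) (λ e → B G x e * b e)))))) ⟩
      p * a - half * (Bg + (sum λ e → B G x e * b e))
        ≈⟨ +-congˡ (-‿cong (*-congˡ (+-congˡ (BBᵀ-apply x (λ z → T₁ z t))))) ⟩
      p * a - half * (Bg + S)
        ≈⟨ solve 6 (λ p a h t g S → p :* a :- h :* (g :+ S) := (con (+ 1) :- t :* h) :* (p :* a) :+ h :* (t :* p :* a :- S :- g)) refl p a half ⟦ 2 ⟧ Bg S ⟩
      (1# - ⟦ 2 ⟧ * half) * (p * a) + half * (⟦ 2 ⟧ * p * a - S - Bg)
        ≈⟨ +-cong (*-congʳ (+-congˡ (-‿cong 2*half)))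
                  (*-congˡ (+-congʳ (trans (sym (Q-half x (λ z → T₁ z t))) (Q-T₁ x t)))) ⟩
      (1# - 1#) * (p * a) + half * (⟦ 2 ⟧ * d + Bg - Bg)
        ≈⟨ solve 5 (λ y h t d g → (con (+ 1) :- con (+ 1)) :* y :+ h :* (t :* d :+ g :- g) := t :* h :* d) refl (p * a) half ⟦ 2 ⟧ d Bg ⟩
      ⟦ 2 ⟧ * half * d     ≈⟨ trans (*-congʳ 2*half) (*-identityˡ d) ⟩
      d                    ∎
      where
      p = 1# + π G x
      a = T₁ x t
      d = δˢ G (inj₁ x) t
      g b : Fin m → Carrier
      g e = δˢ G (inj₂ e) t
      b e = sum λ z → B G z e * T₁ z t
      Bg = sum λ e → B G x e * g e
      S  = sum λ z → (D G x z + A G x z) * T₁ z t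

    -- The rows of `T` at inserted vertices are this very equation solved for the potential at e;
    -- the 2 is the degree of an inserted vertex.
    T-inserted : ∀ e t → ⟦ 2 ⟧ * T (inj₂ e) t - (sum λ x → B G x e * T (inj₁ x) t) ≈ δˢ G (inj₂ e) t
    T-inserted e t = begin
      ⟦ 2 ⟧ * (half * (d + s)) - s     ≈⟨ +-congʳ (trans (sym (*-assoc _ _ _)) (trans (*-congʳ 2*half) (*-identityˡ _))) ⟩
      d + s - s                        ≈⟨ solve 2 (λ d s → d :+ s :- s := d) refl d s ⟩
      d                                ∎
      where
      d = δˢ G (inj₂ e) t
      s = sum λ x → B G x e * T₁ x t

    R-rowSum : ∀ x → sum (R x) ≈ half
    R-rowSum x = halve (begin
      ⟦ 2 ⟧ * sum (R x)                        ≈⟨ *-comm _ _ ⟩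
      sum (R x) * ⟦ 2 ⟧                        ≈⟨ *-distribʳ-sum ⟦ 2 ⟧ (R x) ⟩
      (sum λ k → R x k * ⟦ 2 ⟧)                ≈⟨ sum-cong (λ k → trans (*-congˡ (sym (Q-rowSum G k))) (*-distribˡ-sum (R x k) (Q G k))) ⟩
      (sum λ k → sum λ j → R x k * Q G k j)    ≈⟨ ∑-comm (λ k j → R x k * Q G k j) ⟩
      sum ((R ⊗ Q G) x)                        ≈⟨ sum-cong (proj₂ R-inverse x) ⟩
      sum (δ x)                                ≈⟨ sum-δ-row x ⟩
      1#                                       ∎)

    R-columnSum : ∀ y → (sum λ x → R x y) ≈ half
    R-columnSum y = halve (begin
      ⟦ 2 ⟧ * (sum λ z → R z y)                ≈⟨ *-distribˡ-sum ⟦ 2 ⟧ (λ z → R z y) ⟩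
      (sum λ z → ⟦ 2 ⟧ * R z y)
        ≈⟨ sum-cong (λ z → trans (*-congʳ (trans (sym (Q-rowSum G z)) (sum-cong (Q-sym G z)))) (*-distribʳ-sum (R z y) (λ x → Q G x z))) ⟩
      (sum λ z → sum λ x → Q G x z * R z y)    ≈⟨ ∑-comm (λ z x → Q G x z * R z y) ⟩
      (sum λ x → (Q G ⊗ R) x y)                ≈⟨ sum-cong (λ x → proj₁ R-inverse x y) ⟩
      (sum λ x → δ x y)                        ≈⟨ sum-δ-column y ⟩
      1#                                       ∎)

    -- The whole unit current entering the copy leaves through the root.
    T-columnSum : ∀ t → (sum λ x → T (inj₁ x) t) ≈ 1#
    T-columnSum (inj₁ y) = begin
      (sum λ x → ⟦ 2 ⟧ * R x y)                ≈⟨ *-distribˡ-sum ⟦ 2 ⟧ (λ x → R x y) ⟨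
      ⟦ 2 ⟧ * (sum λ x → R x y)                ≈⟨ *-congˡ (R-columnSum y) ⟩
      ⟦ 2 ⟧ * half                             ≈⟨ 2*half ⟩
      1#                                       ∎
    T-columnSum (inj₂ e) = begin
      (sum λ x → sum λ z → R x z * B G z e)    ≈⟨ ∑-comm (λ x z → R x z * B G z e) ⟩
      (sum λ z → sum λ x → R x z * B G z e)    ≈⟨ sum-cong (λ z → trans (sym (*-distribʳ-sum (B G z e) (λ x → R x z))) (*-congʳ (R-columnSum z))) ⟩
      (sum λ z → half * B G z e)               ≈⟨ *-distribˡ-sum half (λ z → B G z e) ⟨
      half * (sum λ z → B G z e)               ≈⟨ *-congˡ (B-columnSum G e) ⟩
      half * (1# + 1#)                         ≈⟨ solve 1 (λ h → h :* con (+ 2) := (con (+ 1) :+ (con (+ 1) :+ con (+ 0))) :* h) refl half ⟩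
      ⟦ 2 ⟧ * half                             ≈⟨ 2*half ⟩
      1#                                       ∎

    sum-one : ∀ k → sum {k} (λ _ → 1#) ≈ ⟦ k ⟧
    sum-one k = trans (sum-const k 1#) (*-identityʳ _)

    -- The inserted block contributes through tr(Bᵀ R B) = tr(R B Bᵀ), and B Bᵀ = D + A.
    trace-T : sumˢ G (λ s → T s s) ≈ ⟦ 2 ⟧ * tr R + half * (⟦ m ⟧ + (tr (R ⊗ A G) + tr (R ⊗ D G)))
    trace-T = +-cong (sym (*-distribˡ-sum ⟦ 2 ⟧ (λ x → R x x))) (begin
      (sum λ e → half * (δ e e + (sum λ x → B G x e * RB x e)))
        ≈⟨ *-distribˡ-sum half (λ e → δ e e + (sum λ x → B G x e * RB x e)) ⟨
      half * (sum λ e → δ e e + (sum λ x → B G x e * RB x e))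
        ≈⟨ *-congˡ (∑-distrib-+ (λ (e : Fin m) → δ e e) (λ e → sum λ x → B G x e * RB x e)) ⟩
      half * ((sum λ (e : Fin m) → δ e e) + (sum λ e → sum λ x → B G x e * RB x e))
        ≈⟨ *-congˡ (+-cong (trans (sum-cong {m} δ-refl) (sum-one m)) (trans (∑-comm (λ e x → B G x e * RB x e)) (trans (sum-cong diagonal) split))) ⟩
      half * (⟦ m ⟧ + (tr (R ⊗ A G) + tr (R ⊗ D G))) ∎)
      where
      diagonal : ∀ x → (sum λ e → B G x e * RB x e) ≈ (sum λ z → R x z * A G z x + R x z * D G z x)
      diagonal x = begin
        (sum λ e → B G x e * (sum λ z → R x z * B G z e))
          ≈⟨ sum-cong (λ e → trans (*-distribˡ-sum (B G x e) (λ z → R x z * B G z e))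
               (sum-cong λ z → solve 3 (λ b r c → b :* (r :* c) := r :* (c :* b)) refl (B G x e) (R x z) (B G z e))) ⟩
        (sum λ e → sum λ z → R x z * (B G z e * B G x e))     ≈⟨ ∑-comm (λ e z → R x z * (B G z e * B G x e)) ⟩
        (sum λ z → sum λ e → R x z * (B G z e * B G x e))
          ≈⟨ sum-cong (λ z → trans (sym (*-distribˡ-sum (R x z) (λ e → B G z e * B G x e))) (*-congˡ (BBᵀ G z x))) ⟩
        (sum λ z → R x z * (D G z x + A G z x))
          ≈⟨ sum-cong (λ z → solve 3 (λ r d a → r :* (d :+ a) := r :* a :+ r :* d) refl (R x z) (D G z x) (A G z x)) ⟩
        (sum λ z → R x z * A G z x + R x z * D G z x) ∎
      split : (sum λ x → sum λ z → R x z * A G z x + R x z * D G z x) ≈ tr (R ⊗ A G) + tr (R ⊗ D G)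
      split = sum₂-+ (λ x z → R x z * A G z x) (λ x z → R x z * D G z x)

    total-degree : sum (π G) ≈ ⟦ 2 ⟧ * ⟦ m ⟧
    total-degree = begin
      sum (π G)                            ≈⟨ sum-cong (B-rowSum G) ⟨
      (sum λ x → sum (B G x))              ≈⟨ ∑-comm (B G) ⟩
      (sum λ e → sum λ x → B G x e)        ≈⟨ sum-cong (B-columnSum G) ⟩
      (sum {m} λ _ → 1# + 1#)              ≈⟨ sum-const m (1# + 1#) ⟩
      ⟦ m ⟧ * (1# + 1#)                    ≈⟨ solve 1 (λ m → m :* con (+ 2) := (con (+ 1) :+ (con (+ 1) :+ con (+ 0))) :* m) refl ⟦ m ⟧ ⟩
      ⟦ 2 ⟧ * ⟦ m ⟧                        ∎

    T₁-rowSum : ∀ x → sumˢ G (T₁ x) ≈ 1# + (sum λ z → R x z * π G z)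
    T₁-rowSum x = +-cong
      (trans (sym (*-distribˡ-sum ⟦ 2 ⟧ (R x))) (trans (*-congˡ (R-rowSum x)) 2*half))
      (begin
        (sum λ e → sum λ z → R x z * B G z e)     ≈⟨ ∑-comm (λ e z → R x z * B G z e) ⟩
        (sum λ z → sum λ e → R x z * B G z e)     ≈⟨ sum-cong (λ z → trans (sym (*-distribˡ-sum (R x z) (B G z))) (*-congˡ (B-rowSum G z))) ⟩
        (sum λ z → R x z * π G z)                 ∎)

    columnTotal : ∀ t → sumˢ G (λ s → T s t) ≈ 1# + half * ((sum λ e → δˢ G (inj₂ e) t) + (sum λ x → π G x * T₁ x t))
    columnTotal t = +-cong (T-columnSum t) (begin
      (sum λ e → half * (δˢ G (inj₂ e) t + (sum λ x → B G x e * T₁ x t)))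
        ≈⟨ *-distribˡ-sum half (λ e → δˢ G (inj₂ e) t + (sum λ x → B G x e * T₁ x t)) ⟨
      half * (sum λ e → δˢ G (inj₂ e) t + (sum λ x → B G x e * T₁ x t))
        ≈⟨ *-congˡ (∑-distrib-+ (λ e → δˢ G (inj₂ e) t) (λ e → sum λ x → B G x e * T₁ x t)) ⟩
      half * ((sum λ e → δˢ G (inj₂ e) t) + (sum λ e → sum λ x → B G x e * T₁ x t))
        ≈⟨ *-congˡ (+-congˡ (trans (∑-comm (λ e x → B G x e * T₁ x t))
             (sum-cong λ x → trans (sym (*-distribʳ-sum (T₁ x t) (B G x))) (*-congʳ (B-rowSum G x))))) ⟩
      half * ((sum λ e → δˢ G (inj₂ e) t) + (sum λ x → π G x * T₁ x t)) ∎)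

    sumˢ-one : sumˢ G (λ _ → 1#) ≈ ⟦ n ⟧ + ⟦ m ⟧
    sumˢ-one = +-cong (sum-one n) (sum-one m)

    -- Each column sums to 1 over the original rows, which gives n + m. The inserted rows add half
    -- of: m from their identity block, the total degree 2m, and πᵀRπ. Hence the coefficient 1 + 3/2
    -- = 5/2 of m₂ in the theorem.
    total-T : (sumˢ G λ t → sumˢ G λ s → T s t) ≈
              ⟦ n ⟧ + ⟦ m ⟧ + half * (⟦ m ⟧ + (⟦ 2 ⟧ * ⟦ m ⟧ + bilinear (π G) R (π G)))
    total-T = begin
      (sumˢ G λ t → sumˢ G λ s → T s t)                             ≈⟨ sumˢ-cong G columnTotal ⟩
      (sumˢ G λ t → 1# + half * (u t + v t))                      ≈⟨ sumˢ-+ G (λ _ → 1#) (λ t → half * (u t + v t)) ⟩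
      sumˢ G (λ _ → 1#) + (sumˢ G λ t → half * (u t + v t))         ≈⟨ +-cong sumˢ-one (sumˢ-* G half (λ t → u t + v t)) ⟩
      ⟦ n ⟧ + ⟦ m ⟧ + half * sumˢ G (λ t → u t + v t)             ≈⟨ +-congˡ (*-congˡ (trans (sumˢ-+ G u v) (+-cong u-total v-total))) ⟩
      ⟦ n ⟧ + ⟦ m ⟧ + half * (⟦ m ⟧ + (⟦ 2 ⟧ * ⟦ m ⟧ + bilinear (π G) R (π G))) ∎
      where
      u v : V → Carrier
      u t = sum λ e → δˢ G (inj₂ e) t
      v t = sum λ x → π G x * T₁ x t
      u-total : sumˢ G u ≈ ⟦ m ⟧
      u-total = begin
        (sum {n} λ _ → sum {m} λ _ → 0#) + (sum λ (f : Fin m) → sum λ (e : Fin m) → δ e f)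
          ≈⟨ +-cong (sum-zero {n} λ _ → sum-zero {m} λ _ → refl) (trans (sum-cong {m} sum-δ-column) (sum-one m)) ⟩
        0# + ⟦ m ⟧      ≈⟨ +-identityˡ _ ⟩
        ⟦ m ⟧           ∎
      v-total : sumˢ G v ≈ ⟦ 2 ⟧ * ⟦ m ⟧ + bilinear (π G) R (π G)
      v-total = begin
        (sumˢ G λ t → sum λ x → π G x * T₁ x t)                   ≈⟨ sumˢ-sum G (λ t x → π G x * T₁ x t) ⟩
        (sum λ x → sumˢ G λ t → π G x * T₁ x t)                   ≈⟨ sum-cong (λ x → trans (sumˢ-* G (π G x) (T₁ x)) (*-congˡ (T₁-rowSum x))) ⟩
        (sum λ x → π G x * (1# + (sum λ z → R x z * π G z)))
          ≈⟨ sum-cong (λ x → trans (trans (distribˡ (π G x) 1# _) (+-congʳ (*-identityʳ (π G x))))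
               (+-congˡ (trans (*-distribˡ-sum (π G x) (λ z → R x z * π G z)) (sum-cong λ z → sym (*-assoc (π G x) (R x z) (π G z)))))) ⟩
        (sum λ x → π G x + (sum λ z → π G x * R x z * π G z))
          ≈⟨ ∑-distrib-+ (π G) (λ x → sum λ z → π G x * R x z * π G z) ⟩
        sum (π G) + bilinear (π G) R (π G)                      ≈⟨ +-congʳ total-degree ⟩
        ⟦ 2 ⟧ * ⟦ m ⟧ + bilinear (π G) R (π G)                  ∎

-- Connectedness of the corona.

module CoronaConnected where

  private variable n₁ n₂ : ℕ

  path-reverse : {V : Set} (G : Graph V) → ∀ {u v} → Star (λ x y → adj G x y ≡ true) u v →
                 Star (λ x y → adj G x y ≡ true) v u
  path-reverse G = reverse λ {x} {y} e → ≡.trans (adj-sym G y x) e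

  relabel-connected : {V W : Set} (f : Inverse (≡.setoid W) (≡.setoid V)) (G : Graph V) → Connected G → Connected (relabel f G)
  relabel-connected f G connected u v =
    ≡.subst₂ (Star _) (strictlyInverseʳ u) (strictlyInverseʳ v)
      (gmap from (λ {x} {y} e → ≡.trans (≡.cong₂ (adj G) (strictlyInverseˡ x) (strictlyInverseˡ y)) e)
        (connected (to u) (to v)))
    where open Inverse f

  -- Every vertex has a path to its root, an inserted vertex by way of its first endpoint, and the
  -- roots are connected within G₁.
  corona-connected : (G₁ : Graph (Fin n₁)) (G₂ : Graph (Fin n₂)) → Connected G₁ → Connected (corona G₁ G₂)
  corona-connected G₁ G₂ connected u v = toRoot u ◅◅ roots (root u) (root v) ◅◅ path-reverse C (toRoot v)
    where
    C = corona G₁ G₂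
    root : CoronaVertex G₁ G₂ → Fin _
    root (inj₁ i)       = i
    root (inj₂ (i , _)) = i
    does-refl : ∀ {n} (i : Fin n) → does (i ≟ i) ≡ true
    does-refl i = dec-true (i ≟ i) ≡.refl
    roots : ∀ i j → Star (λ x y → adj C x y ≡ true) (inj₁ i) (inj₁ j)
    roots i j = gmap inj₁ (λ e → e) (connected i j)
    toRoot : ∀ u → Star (λ x y → adj C x y ≡ true) u (inj₁ (root u))
    toRoot (inj₁ i) = ε
    toRoot (inj₂ (i , inj₁ x)) = ≡.cong (_∧ true) (does-refl i) ◅ ε
    toRoot (inj₂ (i , inj₂ e)) = ≡.cong₂ _∧_ (does-refl i) (≡.cong (_∨ does (a ≟ b)) (does-refl a))
      ◅ toRoot (inj₂ (i , inj₁ a))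
      where
      a = proj₁ (lookup (edges G₂) e)
      b = proj₂ (lookup (edges G₂) e)

-- Sums over the corona and glued potentials.

module CoronaResistance {c ℓ₁ ℓ₂ : Level} (K : HeytingField c ℓ₁ ℓ₂) (char0 : CharacteristicZero K) where

  open Scalars K char0
  open Resistance K char0
  open Incidence K char0
  open Spectrum K char0
  open GroundedCopy K char0

  private variable
    n m : ℕ

  sum-splitAt : ∀ m (F : Fin m ⊎ Fin n → Carrier) →
                (sum λ k → F (splitAt m k)) ≈ (sum λ i → F (inj₁ i)) + (sum λ j → F (inj₂ j))
  sum-splitAt zero    F = sym (+-identityˡ _)
  sum-splitAt (suc m) F = trans (+-congˡ (sum-splitAt m (F ∘ Sum.map₁ suc))) (sym (+-assoc _ _ _))

  sum-remQuot : ∀ m (F : Fin m × Fin n → Carrier) →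
                (sum λ k → F (remQuot {m} n k)) ≈ (sum λ i → sum λ j → F (i , j))
  sum-remQuot         zero    F = refl
  sum-remQuot {n = n} (suc m) F = trans
    -- The function applied to the split index is `remQuot` at `suc m`, unfolded.
    (sum-splitAt n (F ∘ Product.swap ∘ [ (_, zero) , Product.map₂ suc ∘ quotRem {m} n ]′))
    (+-congˡ (sum-remQuot m λ (i , j) → F (suc i , j)))

  indicator : Bool → Carrier
  indicator b = if b then 1# else 0#

  indicator-∧ : ∀ b b′ → indicator (b ∧ b′) ≈ indicator b * indicator b′
  indicator-∧ true  b′ = sym (*-identityˡ _)
  indicator-∧ false b′ = sym (zeroˡ _)

  sum-indicator : ∀ (i : Fin n) b (h : Vect n) → (sum λ j → indicator (does (i ≟ j) ∧ b) * h j) ≈ indicator b * h i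
  sum-indicator i b h = trans
    (sum-cong λ j → trans (*-congʳ (indicator-∧ (does (i ≟ j)) b)) (*-assoc (δ i j) (indicator b) (h j)))
    (sum-δˡ i (λ j → indicator b * h j))

  module _ {n₁ n₂ : ℕ} (G₁ : Graph (Fin n₁)) (G₂ : Graph (Fin n₂)) where

    private
      m₂ = numEdges G₂
      S  = SubdivisionVertex G₂
      V  = CoronaVertex G₁ G₂
      C  = corona G₁ G₂

    open Inverse (coronaVertices G₁ G₂) using (to; from; strictlyInverseʳ)

    sumᵛ : (V → Carrier) → Carrier
    sumᵛ F = (sum λ i → F (inj₁ i)) + (sum λ i → sumˢ G₂ λ s → F (inj₂ (i , s)))

    sum-coronaVertices : ∀ F → (sum λ k → F (to k)) ≈ sumᵛ F
    sum-coronaVertices F = begin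
      (sum λ k → F (to k))
        ≈⟨ sum-splitAt n₁ (F ∘ Sum.map (λ i → i) g) ⟩
      (sum λ i → F (inj₁ i)) + (sum λ k → F (inj₂ (g k)))
        ≈⟨ +-congˡ (sum-remQuot n₁ λ (i , k) → F (inj₂ (i , splitAt n₂ k))) ⟩
      (sum λ i → F (inj₁ i)) + (sum λ i → sum λ k → F (inj₂ (i , splitAt n₂ k)))
        ≈⟨ +-congˡ (sum-cong λ i → sum-splitAt n₂ λ s → F (inj₂ (i , s))) ⟩
      sumᵛ F ∎
      where
      g : Fin (n₁ ℕ.* (n₂ ℕ.+ m₂)) → Fin n₁ × S
      g k = Product.map (λ i → i) (splitAt n₂) (remQuot {n₁} (n₂ ℕ.+ m₂) k)

    δᵛ : V → V → Carrier
    δᵛ (inj₁ i)       (inj₁ j)       = δ i j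
    δᵛ (inj₁ _)       (inj₂ _)       = 0#
    δᵛ (inj₂ _)       (inj₁ _)       = 0#
    δᵛ (inj₂ (i , s)) (inj₂ (j , t)) = δ i j * δˢ G₂ s t

    δˢ-refl : ∀ s → δˢ G₂ s s ≈ 1#
    δˢ-refl (inj₁ x) = δ-refl x
    δˢ-refl (inj₂ e) = δ-refl e

    δˢ-≢ : ∀ s t → s ≢ t → δˢ G₂ s t ≈ 0#
    δˢ-≢ (inj₁ x) (inj₁ y) s≢t = δ-≢ (s≢t ∘ ≡.cong inj₁)
    δˢ-≢ (inj₂ e) (inj₂ f) s≢t = δ-≢ (s≢t ∘ ≡.cong inj₂)
    δˢ-≢ (inj₁ _) (inj₂ _) _   = refl
    δˢ-≢ (inj₂ _) (inj₁ _) _   = refl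

    δᵛ-refl : ∀ u → δᵛ u u ≈ 1#
    δᵛ-refl (inj₁ i)       = δ-refl i
    δᵛ-refl (inj₂ (i , s)) = trans (*-cong (δ-refl i) (δˢ-refl s)) (*-identityˡ 1#)

    δᵛ-≢ : ∀ u v → u ≢ v → δᵛ u v ≈ 0#
    δᵛ-≢ (inj₁ i)       (inj₁ j)       u≢v = δ-≢ (u≢v ∘ ≡.cong inj₁)
    δᵛ-≢ (inj₁ _)       (inj₂ _)       _   = refl
    δᵛ-≢ (inj₂ _)       (inj₁ _)       _   = refl
    δᵛ-≢ (inj₂ (i , s)) (inj₂ (j , t)) u≢v = off-diagonal (i ≟ j)
      where
      off-diagonal : Dec (i ≡ j) → δ i j * δˢ G₂ s t ≈ 0#
      off-diagonal (yes ≡.refl) = trans (*-congˡ (δˢ-≢ s t (u≢v ∘ ≡.cong λ s → inj₂ (i , s)))) (x*0≈0 _)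
      off-diagonal (no i≢j)     = trans (*-congʳ (δ-≢ i≢j)) (zeroˡ _)

    δ-to : ∀ k l → δ k l ≈ δᵛ (to k) (to l)
    δ-to k l = compare (k ≟ l)
      where
      compare : Dec (k ≡ l) → δ k l ≈ δᵛ (to k) (to l)
      compare (yes ≡.refl) = trans (δ-refl k) (sym (δᵛ-refl (to k)))
      compare (no k≢l)     = trans (δ-≢ k≢l) (sym (δᵛ-≢ (to k) (to l) λ eq →
        k≢l (≡.trans (≡.sym (strictlyInverseʳ k)) (≡.trans (≡.cong from eq) (strictlyInverseʳ l)))))

    netCurrentᵛ : (V → Carrier) → V → Carrier
    netCurrentᵛ φ u = sumᵛ λ v → indicator (adj C u v) * (φ u - φ v)

    -- The number of vertices in one block, a root together with its copy.
    h : Carrier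
    h = 1# + (⟦ n₂ ⟧ + ⟦ m₂ ⟧)

    -- A potential ψ on G₁, extended constantly to the copies, plus a potential χ
    -- vanishing at the root in the k-th copy.
    module _ (k : Fin n₁) (ψ : Vect n₁) (χ : S → Carrier) where

      glue : V → Carrier
      glue (inj₁ i)       = ψ i
      glue (inj₂ (i , s)) = ψ i + δ i k * χ s

      localise : ∀ {m} i (p : Fin m → Bool) (h : Fin n₁ → Vect m) →
        (sum λ j → sum λ y → indicator (does (i ≟ j) ∧ p y) * h j y) ≈ (sum λ y → indicator (p y) * h i y)
      localise i p h = trans (∑-comm λ j y → indicator (does (i ≟ j) ∧ p y) * h j y)
        (sum-cong λ y → sum-indicator i (p y) (λ j → h j y))

      localiseˢ : ∀ i (p : S → Bool) (h : Fin n₁ → S → Carrier) →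
        (sum λ j → sumˢ G₂ λ s → indicator (does (i ≟ j) ∧ p s) * h j s) ≈ sumˢ G₂ λ s → indicator (p s) * h i s
      localiseˢ i p h = trans
        (∑-distrib-+ (λ j → sum λ x → indicator (does (i ≟ j) ∧ p (inj₁ x)) * h j (inj₁ x))
                     (λ j → sum λ e → indicator (does (i ≟ j) ∧ p (inj₂ e)) * h j (inj₂ e)))
        (+-cong (localise i (p ∘ inj₁) (λ j → h j ∘ inj₁)) (localise i (p ∘ inj₂) (λ j → h j ∘ inj₂)))

      -- χ is measured relative to the root, so the edges from root `k` into its copy carry away
      -- minus the sum of χ over the original vertices.
      glue-root : ∀ i {total} → (sum λ x → χ (inj₁ x)) ≈ total → netCurrentᵛ glue (inj₁ i) ≈ netCurrent G₁ ψ i - δ i k * total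
      glue-root i {total} χ-total = +-congˡ (begin
        (sum λ j → sumˢ G₂ λ s → indicator (does (i ≟ j) ∧ isOriginal G₂ s) * (ψ i - glue (inj₂ (j , s))))
          ≈⟨ localiseˢ i (isOriginal G₂) (λ j s → ψ i - glue (inj₂ (j , s))) ⟩
        (sum λ x → 1# * (ψ i - (ψ i + δ i k * χ (inj₁ x)))) + (sum λ e → 0# * (ψ i - (ψ i + δ i k * χ (inj₂ e))))
          ≈⟨ +-cong (sum-cong λ x → solve 3 (λ p d c → con (+ 1) :* (p :- (p :+ d :* c)) := :- d :* c) refl (ψ i) (δ i k) (χ (inj₁ x)))
                    (sum-zero λ e → zeroˡ (ψ i - (ψ i + δ i k * χ (inj₂ e)))) ⟩
        (sum λ x → - δ i k * χ (inj₁ x)) + 0#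
          ≈⟨ +-congʳ (trans (sym (*-distribˡ-sum (- δ i k) (χ ∘ inj₁))) (*-congˡ χ-total)) ⟩
        - δ i k * total + 0#       ≈⟨ solve 2 (λ d t → :- d :* t :+ con (+ 0) := :- (d :* t)) refl (δ i k) total ⟩
        - (δ i k * total)          ∎)

      -- ψ i cancels from every potential difference within the block, leaving the grounded equation
      -- in χ; the 1 in `1# + π G₂ x` counts the edge to the root.
      glue-original : ∀ i x {a} → (1# + π G₂ x) * χ (inj₁ x) - (sum λ e → B G₂ x e * χ (inj₂ e)) ≈ a →
                      netCurrentᵛ glue (inj₂ (i , inj₁ x)) ≈ δ i k * a
      glue-original i x {g} χ-original = begin
        (sum λ j → indicator (does (i ≟ j) ∧ true) * (ψ i + d * a - ψ j)) +
          (sum λ j → sumˢ G₂ λ t → indicator (does (i ≟ j) ∧ adj (subdivision G₂) (inj₁ x) t) * (ψ i + d * a - glue (inj₂ (j , t))))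
          ≈⟨ +-cong (sum-indicator i true (λ j → ψ i + d * a - ψ j))
                    (localiseˢ i (adj (subdivision G₂) (inj₁ x)) (λ j t → ψ i + d * a - glue (inj₂ (j , t)))) ⟩
        1# * (ψ i + d * a - ψ i) +
          ((sum λ y → 0# * (ψ i + d * a - (ψ i + d * χ (inj₁ y)))) + (sum λ e → B G₂ x e * (ψ i + d * a - (ψ i + d * χ (inj₂ e)))))
          ≈⟨ +-congˡ (+-cong (sum-zero λ y → zeroˡ (ψ i + d * a - (ψ i + d * χ (inj₁ y))))
               (trans (sum-cong λ e → solve 5 (λ b p d a c → b :* (p :+ d :* a :- (p :+ d :* c)) := d :* (a :* b :- b :* c)) refl (B G₂ x e) (ψ i) d a (χ (inj₂ e)))
                 (trans (sym (*-distribˡ-sum d (λ e → a * B G₂ x e - B G₂ x e * χ (inj₂ e))))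
                   (*-congˡ (trans (sum-sub (λ e → a * B G₂ x e) (λ e → B G₂ x e * χ (inj₂ e)))
                     (+-congʳ (trans (sym (*-distribˡ-sum a (B G₂ x))) (*-congˡ (B-rowSum G₂ x))))))))) ⟩
        1# * (ψ i + d * a - ψ i) + (0# + d * (a * π G₂ x - Bχ))
          ≈⟨ solve 5 (λ p d a q b → con (+ 1) :* (p :+ d :* a :- p) :+ (con (+ 0) :+ d :* (a :* q :- b)) := d :* ((con (+ 1) :+ q) :* a :- b)) refl (ψ i) d a (π G₂ x) Bχ ⟩
        d * ((1# + π G₂ x) * a - Bχ)        ≈⟨ *-congˡ χ-original ⟩
        d * g                               ∎
        where
        d = δ i k
        a = χ (inj₁ x)
        Bχ = sum λ e → B G₂ x e * χ (inj₂ e)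
      glue-inserted : ∀ i e {a} → ⟦ 2 ⟧ * χ (inj₂ e) - (sum λ x → B G₂ x e * χ (inj₁ x)) ≈ a →
                      netCurrentᵛ glue (inj₂ (i , inj₂ e)) ≈ δ i k * a
      glue-inserted i e {g} χ-inserted = begin
        (sum λ j → indicator (does (i ≟ j) ∧ false) * (ψ i + d * a - ψ j)) +
          (sum λ j → sumˢ G₂ λ t → indicator (does (i ≟ j) ∧ adj (subdivision G₂) (inj₂ e) t) * (ψ i + d * a - glue (inj₂ (j , t))))
          ≈⟨ +-cong (sum-indicator i false (λ j → ψ i + d * a - ψ j))
                    (localiseˢ i (adj (subdivision G₂) (inj₂ e)) (λ j t → ψ i + d * a - glue (inj₂ (j , t)))) ⟩
        0# * (ψ i + d * a - ψ i) +
          ((sum λ x → B G₂ x e * (ψ i + d * a - (ψ i + d * χ (inj₁ x)))) + (sum λ f → 0# * (ψ i + d * a - (ψ i + d * χ (inj₂ f)))))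
          ≈⟨ +-congˡ (+-cong
               (trans (sum-cong λ x → solve 5 (λ b p d a c → b :* (p :+ d :* a :- (p :+ d :* c)) := d :* (a :* b :- b :* c)) refl (B G₂ x e) (ψ i) d a (χ (inj₁ x)))
                 (trans (sym (*-distribˡ-sum d (λ x → a * B G₂ x e - B G₂ x e * χ (inj₁ x))))
                   (*-congˡ (trans (sum-sub (λ x → a * B G₂ x e) (λ x → B G₂ x e * χ (inj₁ x)))
                     (+-congʳ (trans (sym (*-distribˡ-sum a (λ x → B G₂ x e))) (*-congˡ (B-columnSum G₂ e))))))))
               (sum-zero λ f → zeroˡ (ψ i + d * a - (ψ i + d * χ (inj₂ f))))) ⟩
        0# * (ψ i + d * a - ψ i) + (d * (a * (1# + 1#) - Bχ) + 0#)
          ≈⟨ solve 4 (λ p d a b → con (+ 0) :* (p :+ d :* a :- p) :+ (d :* (a :* con (+ 2) :- b) :+ con (+ 0)) :=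
               d :* ((con (+ 1) :+ (con (+ 1) :+ con (+ 0))) :* a :- b)) refl (ψ i) d a Bχ ⟩
        d * (⟦ 2 ⟧ * a - Bχ)                ≈⟨ *-congˡ χ-inserted ⟩
        d * g                               ∎
        where
        d = δ i k
        a = χ (inj₂ e)
        Bχ = sum λ x → B G₂ x e * χ (inj₁ x)

      glue-sum : sumᵛ glue ≈ h * sum ψ + sumˢ G₂ χ
      glue-sum = begin
        sum ψ + (sum λ i → sumˢ G₂ λ s → ψ i + δ i k * χ s)
          ≈⟨ +-congˡ (sum-cong λ i → trans (sumˢ-+ G₂ (λ _ → ψ i) (λ s → δ i k * χ s))
               (+-cong (trans (+-cong (sum-const n₂ (ψ i)) (sum-const m₂ (ψ i))) (sym (distribʳ (ψ i) ⟦ n₂ ⟧ ⟦ m₂ ⟧)))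
                       (trans (sumˢ-* G₂ (δ i k) χ) (*-comm (δ i k) (sumˢ G₂ χ))))) ⟩
        sum ψ + (sum λ i → (⟦ n₂ ⟧ + ⟦ m₂ ⟧) * ψ i + sumˢ G₂ χ * δ i k)
          ≈⟨ +-congˡ (trans (sum-linear (⟦ n₂ ⟧ + ⟦ m₂ ⟧) (sumˢ G₂ χ) ψ (λ i → δ i k)) (+-congˡ (*-congˡ (sum-δ-column k)))) ⟩
        sum ψ + ((⟦ n₂ ⟧ + ⟦ m₂ ⟧) * sum ψ + sumˢ G₂ χ * 1#)
          ≈⟨ solve 3 (λ p q c → p :+ (q :* p :+ c :* con (+ 1)) := (con (+ 1) :+ q) :* p :+ c) refl (sum ψ) (⟦ n₂ ⟧ + ⟦ m₂ ⟧) (sumˢ G₂ χ) ⟩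
        h * sum ψ + sumˢ G₂ χ ∎

-- The Green matrix of the corona and the resulting formula.

module CoronaKirchhoff {c ℓ₁ ℓ₂ : Level} (K : HeytingField c ℓ₁ ℓ₂) (char0 : CharacteristicZero K) where

  open Scalars K char0
  open Positivity K char0
  open Resistance K char0
  open Incidence K char0
  open Spectrum K char0
  open GroundedCopy K char0
  open CoronaResistance K char0

  module _ {p n₂ : ℕ} (G₁ : Graph (Fin (suc p))) (G₂ : Graph (Fin n₂)) (connected : Connected G₁)
           (R : Matrix n₂) (R-inverse : IsInverse (Q G₂) R) where

    open GroundedAtZero G₁ using (green; green-isGreen)
    open Inverse (coronaVertices G₁ G₂) using (to)

    private
      n₁ = suc p
      m₂ = numEdges G₂
      S  = SubdivisionVertex G₂
      V  = CoronaVertex G₁ G₂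
      C  = corona G₁ G₂
      Tᶜ : S → S → Carrier
      Tᶜ = T G₂ R R-inverse
      h₂ : Carrier
      h₂ = h G₁ G₂

    X₁ : Matrix n₁
    X₁ = green connected

    root : V → Fin n₁
    root (inj₁ i)       = i
    root (inj₂ (i , _)) = i

    copyPotential : V → S → Carrier
    copyPotential (inj₁ _)       s = 0#
    copyPotential (inj₂ (_ , t)) s = Tᶜ s t

    X : V → V → Carrier
    X u w = glue G₁ G₂ (root w) (λ i → X₁ i (root w)) (copyPotential w) u

    -- All current is withdrawn at vertex `zero` of G₁. For a source inside copy j, that copy
    -- delivers a unit current to root j by `T-columnSum`, which is the unit that the column of X₁
    -- sends onward from there; the root merely relays it.
    X-green : ∀ w u → netCurrentᵛ G₁ G₂ (λ v → X v w) u ≈ δᵛ G₁ G₂ u w - δᵛ G₁ G₂ u (inj₁ zero)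
    X-green w@(inj₁ j) (inj₁ i) = begin
      netCurrentᵛ G₁ G₂ (λ v → X v w) (inj₁ i)
        ≈⟨ glue-root G₁ G₂ j (λ i → X₁ i j) (copyPotential w) i (sum-zero {n₂} λ _ → refl) ⟩
      netCurrent G₁ (λ i → X₁ i j) i - δ i j * 0#     ≈⟨ +-congʳ (green-isGreen connected j i) ⟩
      δ i j - δ i zero - δ i j * 0#                   ≈⟨ solve 2 (λ a b → a :- b :- a :* con (+ 0) := a :- b) refl (δ i j) (δ i zero) ⟩
      δ i j - δ i zero                                ∎
    X-green w@(inj₁ j) (inj₂ (i , inj₁ x)) = trans
      (glue-original G₁ G₂ j (λ i → X₁ i j) (copyPotential w) i x
        (trans (+-congˡ (-‿cong (sum-zero λ e → x*0≈0 (B G₂ x e)))) (solve 1 (λ q → (con (+ 1) :+ q) :* con (+ 0) :- con (+ 0) := con (+ 0)) refl (π G₂ x))))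
      (solve 1 (λ d → d :* con (+ 0) := con (+ 0) :- con (+ 0)) refl (δ i j))
    X-green w@(inj₁ j) (inj₂ (i , inj₂ e)) = trans
      (glue-inserted G₁ G₂ j (λ i → X₁ i j) (copyPotential w) i e
        (trans (+-congˡ (-‿cong (sum-zero λ x → x*0≈0 (B G₂ x e)))) (solve 1 (λ q → q :* con (+ 0) :- con (+ 0) := con (+ 0)) refl ⟦ 2 ⟧)))
      (solve 1 (λ d → d :* con (+ 0) := con (+ 0) :- con (+ 0)) refl (δ i j))
    X-green w@(inj₂ (j , t)) (inj₁ i) = begin
      netCurrentᵛ G₁ G₂ (λ v → X v w) (inj₁ i)
        ≈⟨ glue-root G₁ G₂ j (λ i → X₁ i j) (copyPotential w) i (T-columnSum G₂ R R-inverse t) ⟩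
      netCurrent G₁ (λ i → X₁ i j) i - δ i j * 1#     ≈⟨ +-congʳ (green-isGreen connected j i) ⟩
      δ i j - δ i zero - δ i j * 1#                   ≈⟨ solve 2 (λ a b → a :- b :- a :* con (+ 1) := con (+ 0) :- b) refl (δ i j) (δ i zero) ⟩
      0# - δ i zero                                   ∎
    X-green w@(inj₂ (j , t)) (inj₂ (i , inj₁ x)) = trans
      (glue-original G₁ G₂ j (λ i → X₁ i j) (copyPotential w) i x (T-original G₂ R R-inverse x t))
      (sym (x-0≈x _))
    X-green w@(inj₂ (j , t)) (inj₂ (i , inj₂ e)) = trans
      (glue-inserted G₁ G₂ j (λ i → X₁ i j) (copyPotential w) i e (T-inserted G₂ R R-inverse e t))
      (sym (x-0≈x _))

    coronaGreen : Matrix (n₁ ℕ.+ n₁ ℕ.* (n₂ ℕ.+ m₂))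
    coronaGreen k l = X (to k) (to l)

    coronaGreen-isGreen : IsGreenMatrix (G₁ ◇ G₂) (λ k → δᵛ G₁ G₂ (to k) (inj₁ zero)) coronaGreen
    coronaGreen-isGreen l k = begin
      netCurrent (G₁ ◇ G₂) (λ i → coronaGreen i l) k
        ≈⟨ sum-coronaVertices G₁ G₂ (λ v → indicator (adj C (to k) v) * (X (to k) (to l) - X v (to l))) ⟩
      netCurrentᵛ G₁ G₂ (λ v → X v (to l)) (to k)
        ≈⟨ X-green (to l) (to k) ⟩
      δᵛ G₁ G₂ (to k) (to l) - δᵛ G₁ G₂ (to k) (inj₁ zero)
        ≈⟨ +-congʳ (δ-to G₁ G₂ k l) ⟨
      δ k l - δᵛ G₁ G₂ (to k) (inj₁ zero) ∎

    sumˢ-const : ∀ a → sumˢ G₂ (λ _ → a) ≈ (⟦ n₂ ⟧ + ⟦ m₂ ⟧) * a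
    sumˢ-const a = trans (+-cong (sum-const n₂ a) (sum-const m₂ a)) (sym (distribʳ a ⟦ n₂ ⟧ ⟦ m₂ ⟧))

    trT : Carrier
    trT = sumˢ G₂ λ s → Tᶜ s s

    coronaGreen-trace : tr coronaGreen ≈ h₂ * tr X₁ + ⟦ n₁ ⟧ * trT
    coronaGreen-trace = begin
      tr coronaGreen                      ≈⟨ sum-coronaVertices G₁ G₂ (λ u → X u u) ⟩
      tr X₁ + (sum λ i → sumˢ G₂ λ s → X₁ i i + δ i i * Tᶜ s s)
        ≈⟨ +-congˡ (sum-cong λ i → trans (sumˢ-+ G₂ (λ _ → X₁ i i) (λ s → δ i i * Tᶜ s s))
             (+-cong (sumˢ-const (X₁ i i)) (trans (sumˢ-* G₂ (δ i i) (λ s → Tᶜ s s)) (trans (*-congʳ (δ-refl i)) (*-identityˡ trT))))) ⟩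
      tr X₁ + (sum λ i → (⟦ n₂ ⟧ + ⟦ m₂ ⟧) * X₁ i i + trT)
        ≈⟨ +-congˡ (trans (∑-distrib-+ (λ i → (⟦ n₂ ⟧ + ⟦ m₂ ⟧) * X₁ i i) (λ _ → trT))
             (+-cong (sym (*-distribˡ-sum (⟦ n₂ ⟧ + ⟦ m₂ ⟧) (λ i → X₁ i i))) (sum-const n₁ trT))) ⟩
      tr X₁ + ((⟦ n₂ ⟧ + ⟦ m₂ ⟧) * tr X₁ + ⟦ n₁ ⟧ * trT)
        ≈⟨ solve 3 (λ t q z → t :+ (q :* t :+ z) := (con (+ 1) :+ q) :* t :+ z) refl (tr X₁) (⟦ n₂ ⟧ + ⟦ m₂ ⟧) (⟦ n₁ ⟧ * trT) ⟩
      h₂ * tr X₁ + ⟦ n₁ ⟧ * trT           ∎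

    totalT : Carrier
    totalT = sumˢ G₂ λ t → sumˢ G₂ λ s → Tᶜ s t

    -- Columns are summed first because each one is a glued potential, covered by `glue-sum`. That
    -- gives one factor h₂; the other counts the columns of a block.
    coronaGreen-total : (sum λ k → sum (coronaGreen k)) ≈ h₂ * h₂ * (sum λ i → sum (X₁ i)) + ⟦ n₁ ⟧ * totalT
    coronaGreen-total = begin
      (sum λ k → sum λ l → X (to k) (to l))       ≈⟨ ∑-comm coronaGreen ⟩
      (sum λ l → sum λ k → X (to k) (to l))       ≈⟨ sum-cong (λ l → columnSum (to l)) ⟩
      (sum λ l → h₂ * c₁ (root (to l)) + sumˢ G₂ (copyPotential (to l)))
        ≈⟨ sum-coronaVertices G₁ G₂ (λ w → h₂ * c₁ (root w) + sumˢ G₂ (copyPotential w)) ⟩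
      (sum λ j → h₂ * c₁ j + sumˢ G₂ (λ _ → 0#)) + (sum λ j → sumˢ G₂ λ t → h₂ * c₁ j + sumˢ G₂ λ s → Tᶜ s t)
        ≈⟨ +-cong
             (trans (sum-cong λ j → trans (+-congˡ (trans (sumˢ-const 0#) (x*0≈0 _))) (+-identityʳ (h₂ * c₁ j))) (sym (*-distribˡ-sum h₂ c₁)))
             (sum-cong λ j → trans (sumˢ-+ G₂ (λ _ → h₂ * c₁ j) (λ t → sumˢ G₂ λ s → Tᶜ s t)) (+-congʳ (sumˢ-const (h₂ * c₁ j)))) ⟩
      h₂ * sum c₁ + (sum λ j → q * (h₂ * c₁ j) + totalT)
        ≈⟨ +-congˡ (trans (∑-distrib-+ (λ j → q * (h₂ * c₁ j)) (λ _ → totalT))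
             (+-cong (trans (sum-cong λ j → sym (*-assoc q h₂ (c₁ j))) (sym (*-distribˡ-sum (q * h₂) c₁))) (sum-const n₁ totalT))) ⟩
      h₂ * sum c₁ + (q * h₂ * sum c₁ + ⟦ n₁ ⟧ * totalT)
        ≈⟨ solve 3 (λ q s z → (con (+ 1) :+ q) :* s :+ (q :* (con (+ 1) :+ q) :* s :+ z) := (con (+ 1) :+ q) :* (con (+ 1) :+ q) :* s :+ z)
             refl q (sum c₁) (⟦ n₁ ⟧ * totalT) ⟩
      h₂ * h₂ * sum c₁ + ⟦ n₁ ⟧ * totalT          ≈⟨ +-congʳ (*-congˡ (∑-comm λ j i → X₁ i j)) ⟩
      h₂ * h₂ * (sum λ i → sum (X₁ i)) + ⟦ n₁ ⟧ * totalT ∎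
      where
      q = ⟦ n₂ ⟧ + ⟦ m₂ ⟧
      c₁ : Vect n₁
      c₁ j = sum λ i → X₁ i j
      columnSum : ∀ w → (sum λ k → X (to k) w) ≈ h₂ * c₁ (root w) + sumˢ G₂ (copyPotential w)
      columnSum w = trans (sum-coronaVertices G₁ G₂ (λ v → X v w))
        (glue-sum G₁ G₂ (root w) (λ i → X₁ i (root w)) (copyPotential w))

    -- The corona has n₁ h₂ vertices, so the terms in X₁ combine to h₂² (n₁ tr X₁ - sum of X₁) = h₂²
    -- Kf₁, and the chosen Green matrix of G₁ drops out.
    kirchhoffIndex-corona : ∀ {Kf₁ Kf} → IsKirchhoffIndex G₁ Kf₁ → IsKirchhoffIndex (G₁ ◇ G₂) Kf →
                            Kf ≈ h₂ * h₂ * Kf₁ + ⟦ n₁ ⟧ * ⟦ n₁ ⟧ * h₂ * trT - ⟦ n₁ ⟧ * totalT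
    kirchhoffIndex-corona {Kf₁} {Kf} kf₁ kf = begin
      Kf
        ≈⟨ kirchhoffIndex-formula (G₁ ◇ G₂) {X = coronaGreen} coronaGreen-isGreen kf ⟩
      ⟦ n₁ ℕ.+ n₁ ℕ.* (n₂ ℕ.+ m₂) ⟧ * tr coronaGreen - (sum λ k → sum (coronaGreen k))
        ≈⟨ +-cong (*-cong (trans (×-homo-+ 1# n₁ (n₁ ℕ.* (n₂ ℕ.+ m₂))) (+-congˡ (trans (×1-homo-* n₁ (n₂ ℕ.+ m₂)) (*-congˡ (×-homo-+ 1# n₂ m₂)))))
                          coronaGreen-trace)
                  (-‿cong coronaGreen-total) ⟩
      (⟦ n₁ ⟧ + ⟦ n₁ ⟧ * q) * (h₂ * t + ⟦ n₁ ⟧ * trT) - (h₂ * h₂ * s + ⟦ n₁ ⟧ * totalT)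
        ≈⟨ solve 6 (λ n q t T s U → (n :+ n :* q) :* ((con (+ 1) :+ q) :* t :+ n :* T) :- ((con (+ 1) :+ q) :* (con (+ 1) :+ q) :* s :+ n :* U) :=
             (con (+ 1) :+ q) :* (con (+ 1) :+ q) :* (n :* t :- s) :+ n :* n :* (con (+ 1) :+ q) :* T :- n :* U)
             refl ⟦ n₁ ⟧ q t trT s totalT ⟩
      h₂ * h₂ * (⟦ n₁ ⟧ * t - s) + ⟦ n₁ ⟧ * ⟦ n₁ ⟧ * h₂ * trT - ⟦ n₁ ⟧ * totalT
        ≈⟨ +-congʳ (+-congʳ (*-congˡ (kirchhoffIndex-formula G₁ {X = X₁} (green-isGreen connected) kf₁))) ⟨
      h₂ * h₂ * Kf₁ + ⟦ n₁ ⟧ * ⟦ n₁ ⟧ * h₂ * trT - ⟦ n₁ ⟧ * totalT ∎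
      where
      q = ⟦ n₂ ⟧ + ⟦ m₂ ⟧
      t = tr X₁
      s = sum λ i → sum (X₁ i)

    trA+trD bil : Carrier
    trA+trD = tr (R ⊗ A G₂) + tr (R ⊗ D G₂)
    bil = bilinear (π G₂) R (π G₂)

    kirchhoffIndex-corona-Q : ∀ {Kf₁ Kf Σ⁻¹} → IsKirchhoffIndex G₁ Kf₁ → IsKirchhoffIndex (G₁ ◇ G₂) Kf → tr R ≈ Σ⁻¹ →
      Kf ≈ ⟦ n₁ ℕ.* (1 ℕ.+ n₂ ℕ.+ m₂) ⟧ *
             ( ⟦ n₁ ℕ.* m₂ ⟧ ÷ 2 + ⟦ n₁ ⟧ ÷ 2 * trA+trD + ⟦ 2 ℕ.* n₁ ⟧ * Σ⁻¹ + ⟦ m₂ ℕ.+ n₂ ℕ.+ 1 ⟧ ÷ n₁ * Kf₁ )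
           - ⟦ n₁ ⟧ ÷ 2 * bil
           - ⟦ 5 ℕ.* n₁ ℕ.* m₂ ℕ.+ 2 ℕ.* n₁ ℕ.* n₂ ⟧ ÷ 2
    kirchhoffIndex-corona-Q {Kf₁} {Kf} {Σ⁻¹} kf₁ kf trR≈ = begin
      Kf
        ≈⟨ kirchhoffIndex-corona kf₁ kf ⟩
      h₂ * h₂ * Kf₁ + n * n * h₂ * trT - n * totalT
        -- Factors n₁ (1/n₁) = 1 and 2 · ½ = 1 are inserted so that the remaining identity is
        -- polynomial, with 1/n₁ and ½ as indeterminates.
        ≈⟨ +-cong (+-cong (trans (sym (*-identityˡ _)) (*-congʳ (sym (*-1/ (char0 n₁)))))
                          (*-congˡ (trans (trace-T G₂ R R-inverse) (+-congʳ (*-congˡ trR≈)))))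
                  (-‿cong (*-congˡ (trans (total-T G₂ R R-inverse) (+-congʳ (trans (sym (*-identityˡ _)) (*-congʳ (sym 2*half))))))) ⟩
      n * i * (h₂ * h₂ * Kf₁) + n * n * h₂ * (⟦ 2 ⟧ * Σ⁻¹ + half * (m + trA+trD))
        - n * (⟦ 2 ⟧ * half * (a + m) + half * (m + (⟦ 2 ⟧ * m + bil)))
        ≈⟨ solve 9 (λ n a m i h k s t b →
             let one = con (+ 1)
                 two = one :+ (one :+ con (+ 0))
                 H   = one :+ (a :+ m)
             in n :* i :* (H :* H :* k) :+ n :* n :* H :* (two :* s :+ h :* (m :+ t)) :- n :* (two :* h :* (a :+ m) :+ h :* (m :+ (two :* m :+ b)))
                := n :* (one :+ (a :+ m)) :* (n :* m :* h :+ n :* h :* t :+ two :* n :* s :+ (m :+ a :+ (one :+ con (+ 0))) :* i :* k)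
                   :- n :* h :* b :- (con (+ 5) :* n :* m :+ two :* n :* a) :* h)
             refl n a m i half Kf₁ Σ⁻¹ trA+trD bil ⟩
      n * (1# + (a + m)) * (n * m * half + n * half * trA+trD + ⟦ 2 ⟧ * n * Σ⁻¹ + (m + a + (1# + 0#)) * i * Kf₁)
        - n * half * bil - (five * n * m + ⟦ 2 ⟧ * n * a) * half
        ≈⟨ +-cong (+-congʳ (*-cong
             (trans (×1-homo-* n₁ (1 ℕ.+ n₂ ℕ.+ m₂)) (*-congˡ (+-congˡ (×-homo-+ 1# n₂ m₂))))
             (+-cong (+-cong (+-congʳ (*-congʳ (×1-homo-* n₁ m₂))) (*-congʳ (×1-homo-* 2 n₁)))
                     (*-congʳ (*-congʳ (trans (×-homo-+ 1# (m₂ ℕ.+ n₂) 1) (+-congʳ (×-homo-+ 1# m₂ n₂))))))))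
             (-‿cong (*-congʳ (trans (×-homo-+ 1# (5 ℕ.* n₁ ℕ.* m₂) (2 ℕ.* n₁ ℕ.* n₂))
               (+-cong (trans (×1-homo-* (5 ℕ.* n₁) m₂) (*-congʳ (trans (×1-homo-* 5 n₁) (*-congʳ five≈))))
                       (trans (×1-homo-* (2 ℕ.* n₁) n₂) (*-congʳ (×1-homo-* 2 n₁))))))) ⟨
      _ ∎
      where
      n = ⟦ n₁ ⟧
      a = ⟦ n₂ ⟧
      m = ⟦ m₂ ⟧
      i = 1/ (char0 n₁)
      five : Carrier
      five = 1# + 1# + 1# + 1# + 1#
      five≈ : ⟦ 5 ⟧ ≈ five
      five≈ = solve 0 (con (+ 1) :+ (con (+ 1) :+ (con (+ 1) :+ (con (+ 1) :+ (con (+ 1) :+ con (+ 0))))) := con (+ 5)) refl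

open CoronaConnected

theorem4p1 :
  ∀ {c ℓ₁ ℓ₂} (K : HeytingField c ℓ₁ ℓ₂) (char0 : CharacteristicZero K) →
  let open HeytingField K
      open OverField K char0
  in
  ∀ {n₁ n₂ : ℕ} .{{_ : NonZero n₁}}
  (G₁ : Graph (Fin n₁)) (G₂ : Graph (Fin n₂)) → Connected G₁ →
  (μ : Vect n₂) → IsLaplacianSpectrum G₂ μ →
  let m₂ = numEdges G₂ in
  -- the quantities occurring in the formula exist
  Connected (G₁ ◇ G₂) ×
  ∃ (IsKirchhoffIndex G₁) ×
  ∃ (IsKirchhoffIndex (G₁ ◇ G₂)) ×
  ∃ (IsInverse (Q G₂)) ×
  (Σ[ μ+2#0 ∈ (∀ i → (μ i + ⟦ 2 ⟧) # 0#) ]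
  -- and satisfy it
  (∀ (Kf₁ Kf : Carrier) (Q⁻¹ : Matrix n₂) →
   IsKirchhoffIndex G₁ Kf₁ →
   IsKirchhoffIndex (G₁ ◇ G₂) Kf →
   IsInverse (Q G₂) Q⁻¹ →
   Kf ≈ ⟦ n₁ ℕ.* (1 ℕ.+ n₂ ℕ.+ m₂) ⟧ *
          ( ⟦ n₁ ℕ.* m₂ ⟧ ÷ 2
          + ⟦ n₁ ⟧ ÷ 2 * (tr (Q⁻¹ ⊗ A G₂) + tr (Q⁻¹ ⊗ D G₂))
          + ⟦ 2 ℕ.* n₁ ⟧ * sum (λ i → 1/ (μ+2#0 i))
          + ⟦ m₂ ℕ.+ n₂ ℕ.+ 1 ⟧ ÷ n₁ * Kf₁ )
        - ⟦ n₁ ⟧ ÷ 2 * bilinear (π G₂) Q⁻¹ (π G₂)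
        - ⟦ 5 ℕ.* n₁ ℕ.* m₂ ℕ.+ 2 ℕ.* n₁ ℕ.* n₂ ⟧ ÷ 2))
-- Writing n₁ as a successor provides the vertex `zero` of G₁ that serves as the ground.
theorem4p1 K char0 {n₁ = suc p} G₁ G₂ connected μ spectrum =
  ◇-connected , kirchhoffIndex-exists G₁ connected , kirchhoffIndex-exists (G₁ ◇ G₂) ◇-connected ,
  Q-inverse G₂ , μ+2#0 G₂ μ spectrum , λ Kf₁ Kf R kf₁ kf R-inverse →
  kirchhoffIndex-corona-Q G₁ G₂ connected R R-inverse kf₁ kf (tr-Q⁻¹ G₂ μ spectrum R R-inverse)
  where
  open Resistance K char0 using (kirchhoffIndex-exists)
  open Spectrum K char0 using (Q-inverse; μ+2#0; tr-Q⁻¹)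
  open CoronaKirchhoff K char0 using (kirchhoffIndex-corona-Q)
  ◇-connected : Connected (G₁ ◇ G₂)
  ◇-connected = relabel-connected (coronaVertices G₁ G₂) (corona G₁ G₂) (corona-connected G₁ G₂ connected)
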